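{- \textsc{Restricted Unary Bin Packing} is W[1]-hard when parameterized by the number of bins $k$.
   Context: For a finite multiset $S$ of positive integers, $\Sigma(S)$ denotes the sum of its elements; $[k] = \{1,\dots,k\}$ and $\binom{[k]}{2}$ denotes the set of 2-element subsets of $[k]$. \textsc{Restricted Unary Bin Packing}: given positive integers $S = \{s_1, \ldots, s_n\}$ encoded in unary, a positive integer $k$, and a function $f : S \to \binom{[k]}{2}$ (assigning to each item a set of exactly two allowed bins), decide whether $S$ can be partitioned into $k$ subsets $S_1, \ldots, S_k$ such that for all $i \in [k]$: (i) $\Sigma(S_i) = \Sigma(S)/k$, and (ii) every $s \in S_i$ satisfies $i \in f(s)$. -}

module Defs where

import Data.Nat.Properties
open import Algebra.Properties.CommutativeMonoid.Sum Data.Nat.Properties.+-0-commutativeMonoid using (sum)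
open import Data.Bool using (Bool; true; false; not; if_then_else_)
open import Data.Bool.ListAction using (all; any)
open import Data.Fin using (Fin; toℕ; _≟_)
open import Data.Fin.Subset using (Subset; ∣_∣; _∈_)
open import Data.List using (List; []; _∷_; _++_; [_]; length; map; replicate; foldr; concat; tabulate)
open import Data.Nat using (ℕ; zero; suc; _+_; _*_; _^_; _⊔_; _≤_; _<_; _<ᵇ_; NonZero)
open import Data.Product using (Σ; ∃-syntax; _×_; _,_)
open import Data.Vec using (Vec; []; _∷_; lookup; toList)
import Data.Vec as Vec
open import Data.Vec.Functional using (Vector)
open import Function.Bundles using (_⇔_)
open import Relation.Binary.PropositionalEquality using (_≡_)
open import Relation.Nullary.Decidable using (does)

-- The machine model is a one-variable WHILE language on binary trees with
-- unit cost, in the style of N. Jones (Computability and Complexity, 1997).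
-- With trees represented as pointers to shared nodes, each unit of cost is a
-- constant number of pointer operations creating at most one node, so running
-- times agree with those of Turing machines up to a polynomial.  Each unit
-- increases the height of a tree by at most one, so an output string is never
-- longer than the height of the input plus the cost.

data Tree : Set where
  nil : Tree
  _∙_ : Tree → Tree → Tree

infixr 5 _∙_

data Prog : Set where
  id# nil# hd# tl# : Prog
  cons#  : Prog → Prog → Prog
  _⨟_    : Prog → Prog → Prog
  if#    : Prog → Prog → Prog → Prog
  while# : Prog → Prog → Prog

-- p ⊢ x ⇓ y ∣ t : on input x, the program p halts with output y at cost t.
-- A test counts as true when its value is not nil.

infix 4 _⊢_⇓_∣_

data _⊢_⇓_∣_ : Prog → Tree → Tree → ℕ → Set where
  id⇓    : ∀ {x} → id# ⊢ x ⇓ x ∣ 1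
  nil⇓   : ∀ {x} → nil# ⊢ x ⇓ nil ∣ 1
  hd⇓    : ∀ {x y} → hd# ⊢ (x ∙ y) ⇓ x ∣ 1
  hd⇓nil : hd# ⊢ nil ⇓ nil ∣ 1
  tl⇓    : ∀ {x y} → tl# ⊢ (x ∙ y) ⇓ y ∣ 1
  tl⇓nil : tl# ⊢ nil ⇓ nil ∣ 1
  cons⇓  : ∀ {p q x y z s t} → p ⊢ x ⇓ y ∣ s → q ⊢ x ⇓ z ∣ t →
           cons# p q ⊢ x ⇓ (y ∙ z) ∣ suc (s + t)
  ⨟⇓     : ∀ {p q x y z s t} → p ⊢ x ⇓ y ∣ s → q ⊢ y ⇓ z ∣ t →
           (p ⨟ q) ⊢ x ⇓ z ∣ suc (s + t)
  then⇓  : ∀ {b p q x u v y s t} → b ⊢ x ⇓ (u ∙ v) ∣ s → p ⊢ x ⇓ y ∣ t →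
           if# b p q ⊢ x ⇓ y ∣ suc (s + t)
  else⇓  : ∀ {b p q x y s t} → b ⊢ x ⇓ nil ∣ s → q ⊢ x ⇓ y ∣ t →
           if# b p q ⊢ x ⇓ y ∣ suc (s + t)
  stop⇓  : ∀ {b p x s} → b ⊢ x ⇓ nil ∣ s →
           while# b p ⊢ x ⇓ x ∣ suc s
  loop⇓  : ∀ {b p x u v y z r s t} →
           b ⊢ x ⇓ (u ∙ v) ∣ r → p ⊢ x ⇓ y ∣ s → while# b p ⊢ y ⇓ z ∣ t →
           while# b p ⊢ x ⇓ z ∣ suc (r + s + t)

bitTree : Bool → Tree
bitTree false = nil
bitTree true  = nil ∙ nil

bitsTree : List Bool → Tree
bitsTree = foldr (λ b t → bitTree b ∙ t) nil

numTree : ℕ → Tree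
numTree zero    = nil
numTree (suc n) = nil ∙ numTree n

Computable : (ℕ → ℕ) → Set
Computable f = ∃[ p ] ∀ n → ∃[ t ] p ⊢ numTree n ⇓ numTree (f n) ∣ t

-- A parameterized problem is a subset of {0,1}* × ℕ.

Problem : Set₁
Problem = List Bool → ℕ → Set

infix 4 _≤fpt_

record _≤fpt_ (A B : Problem) : Set where
  field
    word  : List Bool → ℕ → List Bool
    param : List Bool → ℕ → ℕ

    correct : ∀ x k → A x k ⇔ B (word x k) (param x k)

    g            : ℕ → ℕ
    g-computable : Computable g
    param≤g      : ∀ x k → param x k ≤ g k

    prog         : Prog
    f            : ℕ → ℕ
    f-computable : Computable f
    c            : ℕ
    runs : ∀ x k → ∃[ t ]
           (prog ⊢ (bitsTree x ∙ numTree k) ⇓ (bitsTree (word x k) ∙ numTree (param x k)) ∣ t)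
           × t ≤ f k * suc (length x) ^ c

-- In `Gates n w` there are w nodes: n input nodes followed by w - n gates in
-- topological order.  Nodes are indexed backwards, so that at each stage
-- `zero` is the most recently added node and the inputs have the n largest
-- indices.  Conjunctions and disjunctions of no nodes are Boolean constants.

data Gate (w : ℕ) : Set where
  ¬ᵍ  : Fin w → Gate w
  ⋀ ⋁ : List (Fin w) → Gate w

data Gates (n : ℕ) : ℕ → Set where
  inputs : Gates n n
  _▷_    : ∀ {w} → Gates n w → Gate w → Gates n (suc w)

record Circuit : Set where
  field
    {#inputs #nodes} : ℕ
    gates            : Gates #inputs #nodes
    output           : Fin #nodes

annotate : ∀ {X : Set} {n w} → (∀ {v} → Gate v → Vec X v → X) →
           Vec X n → Gates n w → Vec X w
annotate step xs inputs   = xs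
annotate step xs (gs ▷ g) = let ys = annotate step xs gs in step g ys ∷ ys

preds : ∀ {w} → Gate w → List (Fin w)
preds (¬ᵍ i)  = i ∷ []
preds (⋀ is) = is
preds (⋁ is) = is

maximum : List ℕ → ℕ
maximum = foldr _⊔_ 0

gateValue : ∀ {w} → Gate w → Vec Bool w → Bool
gateValue (¬ᵍ i)  vs = not (lookup vs i)
gateValue (⋀ is) vs = all (lookup vs) is
gateValue (⋁ is) vs = any (lookup vs) is

gateDepth : ∀ {w} → Gate w → Vec ℕ w → ℕ
gateDepth g ds = suc (maximum (map (lookup ds) (preds g)))

-- Weft counts the large gates, those of fan-in more than 2, along a path.

gateWeft : ∀ {w} → Gate w → Vec ℕ w → ℕ
gateWeft g ws =
  (if 2 <ᵇ length (preds g) then 1 else 0) + maximum (map (lookup ws) (preds g))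

module _ (C : Circuit) where
  open Circuit C

  value : Subset #inputs → Bool
  value a = lookup (annotate gateValue a gates) output

  depth : ℕ
  depth = lookup (annotate gateDepth (Vec.replicate #inputs 0) gates) output

  weft : ℕ
  weft = lookup (annotate gateWeft (Vec.replicate #inputs 0) gates) output

unary : ℕ → List Bool
unary n = replicate n true ++ [ false ]

encodeIndices : ∀ {w} → List (Fin w) → List Bool
encodeIndices is = concat (map (λ i → true ∷ unary (toℕ i)) is) ++ [ false ]

encodeGate : ∀ {w} → Gate w → List Bool
encodeGate (¬ᵍ i)  = false ∷ unary (toℕ i)
encodeGate (⋀ is) = true ∷ false ∷ encodeIndices is
encodeGate (⋁ is) = true ∷ true ∷ encodeIndices is

encodeGates : ∀ {n w} → Gates n w → List Bool
encodeGates inputs   = []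
encodeGates (gs ▷ g) = encodeGates gs ++ true ∷ encodeGate g

encodeCircuit : Circuit → List Bool
encodeCircuit C = unary #inputs ++ encodeGates gates ++ false ∷ unary (toℕ output)
  where open Circuit C

-- Given a circuit of weft at most t and depth at most d, is there a satisfying
-- assignment of weight exactly k?  (Assignments are the sets of true inputs.)

WeightedCircuitSat : (t d : ℕ) → Problem
WeightedCircuitSat t d x k =
  Σ Circuit λ C → x ≡ encodeCircuit C × weft C ≤ t × depth C ≤ d ×
    (∃[ a ] ∣ a ∣ ≡ k × value C a ≡ true)

W[_] : ℕ → Problem → Set
W[ t ] A = ∃[ d ] A ≤fpt WeightedCircuitSat t d

_-Hard : (Problem → Set) → Problem → Set₁
(𝒞 -Hard) B = ∀ A → 𝒞 A → A ≤fpt B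

-- Items are indexed by Fin #items, so that equal sizes may occur repeatedly
-- and carry different sets of allowed bins.

record Packing (k : ℕ) : Set where
  field
    {#items}  : ℕ
    size      : Vector ℕ #items
    size>0    : ∀ j → 0 < size j
    allowed   : Vector (Subset k) #items
    ∣allowed∣ : ∀ j → ∣ allowed j ∣ ≡ 2

  -- An assignment of items to bins is a partition into k possibly empty parts.
  load : (Fin #items → Fin k) → Fin k → ℕ
  load bin i = sum λ j → if does (bin j ≟ i) then size j else 0

  -- load bin i = sum size / k, with the division cleared
  Balanced : (Fin #items → Fin k) → Set
  Balanced bin = ∀ i → k * load bin i ≡ sum size

  Respects : (Fin #items → Fin k) → Set
  Respects bin = ∀ i j → bin j ≡ i → i ∈ allowed j

  encodePacking : List Bool
  encodePacking = concat (tabulate λ j → unary (size j) ++ toList (allowed j))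

open Packing using (encodePacking; Balanced; Respects)

RestrictedUnaryBinPacking : Problem
RestrictedUnaryBinPacking x k =
  NonZero k × Σ (Packing k) λ P → x ≡ encodePacking P ×
    (∃[ bin ] Balanced P bin × Respects P bin)

-- A circuit of weft 1 and depth d unrolls to a formula of depth d, whose value
-- on a set S of inputs is determined by a single number, the digest of S: a
-- large gate contributes the number of its true arguments, and small gates
-- combine such numbers as digits.  An argument of a large gate depends on at
-- most 2^d inputs, so the iterated differences of the digest of order more than
-- 2^d vanish.  By Möbius inversion the digest of S is therefore a sum of weights
-- of the small subsets of S, and there are only polynomially many small sets of
-- inputs.  Finding S thus amounts to choosing its k elements, its small subsets
-- (one for each small set of indices) and a digest that yields the value true,
-- subject to linear equations: in each of f(k) rows one of polynomially many
-- vectors is chosen so that the vectors have a given sum.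
--
-- Such a vector sum becomes a packing by placing the bins in a grid, with one
-- row for each choice and one column for each coordinate.  Every item fits into
-- two neighbouring bins.  Large items carry the choice around the row, and unit
-- items carry the partial sums down the columns.
--
-- For fixed d all of this is computable in time polynomial in |x| + k.

module Submission where

open import Defs

import Data.Nat
import Data.Nat.Properties
open import Algebra.Properties.CommutativeMonoid.Sum Data.Nat.Properties.+-0-commutativeMonoid
  using () renaming (sum to ∑ᶠ)
open import Data.Bool using (Bool; true; false; not; if_then_else_; _∧_; _∨_; T)
open import Data.Bool.ListAction using (and; or; all; any)
open import Data.Bool.Properties using (∧-identityʳ)
open import Data.Empty using (⊥)
open import Data.Fin using (Fin; zero; suc; toℕ; fromℕ<) renaming (_≟_ to _≟ᶠ_)
open import Data.Fin.Properties using (toℕ<n; toℕ-fromℕ<)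
open import Data.Fin.Subset using (Subset; ∣_∣) renaming (_∈_ to _∈ˢ_)
open import Data.List using (List; []; _∷_; _++_; _ʳ++_; [_]; length; map; replicate; foldr; foldl;
  concat; reverse; drop; applyUpTo; upTo; downFrom)
import Data.List as List
open import Data.List.Membership.DecPropositional Data.Nat._≟_ using (_∈?_)
open import Data.List.Membership.Propositional using (_∈_; _∉_)
open import Data.List.Membership.Propositional.Properties using
  (∈-∃++; ∈-++⁺ˡ; ∈-++⁺ʳ; ∈-++⁻; ∈-map⁺; ∈-map⁻; ∈-concat⁺′; ∈-concat⁻′; ∈-upTo⁺; ∈-upTo⁻)
open import Data.List.Properties using
  (++-assoc; ++-identityʳ; ∷-injective; foldl-++; length-++; length-map; length-upTo; map-++; map-cong;
    map-cong-local; map-id; map-is-foldr; map-upTo; map-∘; reverse-downFrom; reverse-foldr; reverse-involutive)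
open import Data.List.Relation.Binary.Sublist.Propositional using (_⊆_; []; _∷_; _∷ʳ_; ⊆-trans)
import Data.List.Relation.Binary.Sublist.Propositional as Sublist
open import Data.List.Relation.Binary.Sublist.Propositional.Properties using (All-resp-⊆; map⁺)
open import Data.List.Relation.Unary.All using (All; []; _∷_)
import Data.List.Relation.Unary.All as All
import Data.List.Relation.Unary.All.Properties as All
open import Data.List.Relation.Unary.AllPairs using (AllPairs; []; _∷_)
import Data.List.Relation.Unary.AllPairs as AllPairs
import Data.List.Relation.Unary.AllPairs.Properties as AllPairs
open import Data.List.Relation.Unary.Any using (here; there)
open import Data.List.Relation.Unary.Unique.Propositional using (Unique)
open import Data.Nat using (ℕ; zero; suc; pred; _+_; _*_; _∸_; _^_; _⊔_; _≤_; _<_; z≤n; s≤s; _≡ᵇ_; _<ᵇ_; NonZero)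
open import Data.Nat.ListAction using (sum)
open import Data.Nat.Properties
open import Data.Nat.Tactic.RingSolver using (solve-∀)
open import Data.Product using (Σ; _×_; _,_; proj₁; proj₂)
open import Data.Sum using (_⊎_; inj₁; inj₂) renaming ([_,_] to case-⊎)
open import Data.Unit using (⊤; tt)
open import Data.Vec using (Vec; []; _∷_; lookup; toList)
import Data.Vec as Vec
open import Data.Vec.Properties using
  ([]=⇒lookup; lookup⇒[]=; lookup∘tabulate; lookup-replicate; length-toList; tabulate-cong)
open import Function using (_∘_)
open import Function.Bundles using (_⇔_; mk⇔; Equivalence)
open import Function.Properties.Equivalence using () renaming (trans to ⇔-trans)
open import Relation.Binary.PropositionalEquality using
  (_≡_; _≢_; refl; sym; trans; cong; cong₂; subst; subst₂; _≗_; module ≡-Reasoning)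
open import Relation.Nullary using (yes; no; contradiction)
open import Relation.Nullary.Decidable using (does)

open Equivalence using (to; from)
open Packing using (encodePacking)

-- Digests replace truth values because the value of a large gate need not be a sum of weights of
-- small sets, whereas its number of true arguments is one. Combining digits in mixed radix is
-- linear and preserves this, so all nonlinearity is confined to a single table lookup, made by the
-- row that chooses the digest. Iterated differences may be negative while vectors may not; hence
-- each small set has a positive and a negative part, and a constant `offset` is added once per row.
-- That the chosen inputs are distinct is enforced without an equation of its own: options are
-- sublists of `upTo n`, thus increasing, and the pairs of indices are among the rows.
--
-- Running time is certified compositionally: `PT f` consists of a program for `f` and a polynomial.
-- Since iterating a polynomial-time step may explode, a loop demands that each step raise the
-- height of the accumulator by an amount that depends only on the context and the list element.
-- Recursion on the depth `d` and on the order `r` of differences happens while the program is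
-- built, so these constants may appear in exponents.

-- Heights of trees along a run

ht : Tree → ℕ
ht nil     = 0
ht (x ∙ y) = suc (ht x ⊔ ht y)

ht-∙ : ∀ x y → ht (x ∙ y) ≤ suc (ht x + ht y)
ht-∙ x y = s≤s (m⊔n≤m+n (ht x) (ht y))

ht-head : ∀ x y → ht x ≤ ht (x ∙ y)
ht-head x y = m≤n⇒m≤1+n (m≤m⊔n (ht x) (ht y))

ht-tail : ∀ x y → ht y ≤ ht (x ∙ y)
ht-tail x y = m≤n⇒m≤1+n (m≤n⊔m (ht x) (ht y))

ht-run : ∀ {p x y t} → p ⊢ x ⇓ y ∣ t → ht y ≤ ht x + t
ht-run id⇓ = m≤m+n _ _
ht-run nil⇓ = z≤n
ht-run (hd⇓ {x} {y}) = ≤-trans (ht-head x y) (m≤m+n _ _)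
ht-run hd⇓nil = z≤n
ht-run (tl⇓ {x} {y}) = ≤-trans (ht-tail x y) (m≤m+n _ _)
ht-run tl⇓nil = z≤n
ht-run (cons⇓ {x = x} {s = s} {t = t} d e) =
  ≤-trans (s≤s (⊔-lub (≤-trans (ht-run d) (+-monoʳ-≤ (ht x) (m≤m+n s t)))
                      (≤-trans (ht-run e) (+-monoʳ-≤ (ht x) (m≤n+m t s)))))
          (≤-reflexive (sym (+-suc (ht x) (s + t))))
ht-run (⨟⇓ {x = x} {s = s} {t = t} d e) =
  ≤-trans (ht-run e) (≤-trans (+-monoˡ-≤ t (ht-run d))
    (≤-trans (≤-reflexive (+-assoc (ht x) s t)) (+-monoʳ-≤ (ht x) (n≤1+n _))))
ht-run (then⇓ {x = x} {s = s} {t = t} d e) = ≤-trans (ht-run e) (+-monoʳ-≤ (ht x) (m≤n⇒m≤1+n (m≤n+m t s)))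
ht-run (else⇓ {x = x} {s = s} {t = t} d e) = ≤-trans (ht-run e) (+-monoʳ-≤ (ht x) (m≤n⇒m≤1+n (m≤n+m t s)))
ht-run (stop⇓ d) = m≤m+n _ _
ht-run (loop⇓ {x = x} {r = r} {s = s} {t = t} d e f) =
  ≤-trans (ht-run f) (≤-trans (+-monoˡ-≤ t (ht-run e))
    (≤-trans (≤-reflexive (+-assoc (ht x) s t))
      (+-monoʳ-≤ (ht x) (m≤n⇒m≤1+n (+-monoˡ-≤ t (m≤n+m s r))))))

-- Polynomial bounds and their degrees

infixl 6 _⊕_
infixl 7 _⊗_
infixr 8 _⊚_

-- Kept as syntax, so that every bound is monotone by construction and independence of the argument
-- can be read off the expression.
data Poly : Set where
  X           : Poly
  K           : ℕ → Poly
  _⊕_ _⊗_ _⊚_ : Poly → Poly → Poly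

⟦_⟧ : Poly → ℕ → ℕ
⟦ X ⟧     n = n
⟦ K m ⟧   n = m
⟦ P ⊕ Q ⟧ n = ⟦ P ⟧ n + ⟦ Q ⟧ n
⟦ P ⊗ Q ⟧ n = ⟦ P ⟧ n * ⟦ Q ⟧ n
⟦ P ⊚ Q ⟧ n = ⟦ P ⟧ (⟦ Q ⟧ n)

⟦⟧-mono : ∀ P {m n} → m ≤ n → ⟦ P ⟧ m ≤ ⟦ P ⟧ n
⟦⟧-mono X       le = le
⟦⟧-mono (K _)   le = ≤-refl
⟦⟧-mono (P ⊕ Q) le = +-mono-≤ (⟦⟧-mono P le) (⟦⟧-mono Q le)
⟦⟧-mono (P ⊗ Q) le = *-mono-≤ (⟦⟧-mono P le) (⟦⟧-mono Q le)
⟦⟧-mono (P ⊚ Q) le = ⟦⟧-mono P (⟦⟧-mono Q le)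

n≤2^n : ∀ n → n ≤ 2 ^ n
n≤2^n zero    = z≤n
n≤2^n (suc n) = +-mono-≤ (m^n>0 2 n) (≤-trans (n≤2^n n) (≤-reflexive (sym (+-identityʳ _))))

a^c+a^c≤a^1+c : ∀ n c → (2 + n) ^ c + (2 + n) ^ c ≤ (2 + n) ^ suc c
a^c+a^c≤a^1+c n c = +-monoʳ-≤ ((2 + n) ^ c) (m≤m+n _ _)

sum≤pow : ∀ n c c' → (2 + n) ^ c + (2 + n) ^ c' ≤ (2 + n) ^ suc (c + c')
sum≤pow n c c' = ≤-trans (+-mono-≤ (^-monoʳ-≤ (2 + n) (m≤m+n c c')) (^-monoʳ-≤ (2 + n) (m≤n+m c' c)))
                         (a^c+a^c≤a^1+c n (c + c'))

-- An exponent for the base `2 + n`, which absorbs constants because `m ≤ 2 ^ m`, and sums because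
-- doubling costs one more factor. Under composition, the 2 that the outer base adds to the inner
-- value costs two further degrees.
degree : Poly → ℕ
degree X       = 1
degree (K m)   = m
degree (P ⊕ Q) = suc (degree P + degree Q)
degree (P ⊗ Q) = degree P + degree Q
degree (P ⊚ Q) = (2 + degree Q) * degree P

⟦⟧≤pow : ∀ P n → ⟦ P ⟧ n ≤ (2 + n) ^ degree P
⟦⟧≤pow X n = ≤-trans (m≤n+m n 2) (≤-reflexive (sym (*-identityʳ (2 + n))))
⟦⟧≤pow (K m) n = ≤-trans (n≤2^n m) (^-monoˡ-≤ m (m≤m+n 2 n))
⟦⟧≤pow (P ⊕ Q) n = ≤-trans (+-mono-≤ (⟦⟧≤pow P n) (⟦⟧≤pow Q n)) (sum≤pow n (degree P) (degree Q))
⟦⟧≤pow (P ⊗ Q) n = ≤-trans (*-mono-≤ (⟦⟧≤pow P n) (⟦⟧≤pow Q n))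
  (≤-reflexive (sym (^-distribˡ-+-* (2 + n) (degree P) (degree Q))))
⟦⟧≤pow (P ⊚ Q) n = begin
  ⟦ P ⟧ (⟦ Q ⟧ n)                                ≤⟨ ⟦⟧≤pow P _ ⟩
  (2 + ⟦ Q ⟧ n) ^ degree P                       ≤⟨ ^-monoˡ-≤ (degree P) (+-monoʳ-≤ 2 (⟦⟧≤pow Q n)) ⟩
  (2 + (2 + n) ^ degree Q) ^ degree P            ≤⟨ ^-monoˡ-≤ (degree P) step ⟩
  ((2 + n) ^ (2 + degree Q)) ^ degree P          ≡⟨ ^-*-assoc (2 + n) (2 + degree Q) (degree P) ⟩
  (2 + n) ^ ((2 + degree Q) * degree P)          ∎
  where
  open ≤-Reasoning
  step : 2 + (2 + n) ^ degree Q ≤ (2 + n) ^ (2 + degree Q)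
  step = ≤-trans (+-monoˡ-≤ ((2 + n) ^ degree Q) (≤-trans (m≤m+n 2 n) (≤-reflexive (sym (*-identityʳ (2 + n))))))
                 (sum≤pow n 1 (degree Q))

-- Polynomial-time functions on encoded data

-- Time is measured against the height of the input tree.  As a run of cost t
-- increases the height by at most t, polynomial bounds compose, and they also
-- bound the length of an output string and the value of an output number.

infixr 5 _`×_

data Ty : Set where
  unit nat bool : Ty
  list          : Ty → Ty
  _`×_          : Ty → Ty → Ty

El : Ty → Set
El unit     = ⊤
El nat      = ℕ
El bool     = Bool
El (list A) = List (El A)
El (A `× B) = El A × El B

enc : ∀ A → El A → Tree
enc unit     _       = nil
enc nat      n       = numTree n
enc bool     b       = bitTree b
enc (list A)         = foldr (λ a t → enc A a ∙ t) nil
enc (A `× B) (a , b) = enc A a ∙ enc B b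

record PT {A B : Ty} (f : El A → El B) : Set where
  constructor mkPT
  field
    prog  : Prog
    bound : Poly
    runs  : ∀ a → Σ ℕ λ t → (prog ⊢ enc A a ⇓ enc B (f a) ∣ t) × t ≤ ⟦ bound ⟧ (ht (enc A a))
open PT public

private variable
  Γ A B C S : Ty

growth : {f : El A → El B} (P : PT f) → ∀ a → ht (enc B (f a)) ≤ ht (enc A a) + ⟦ bound P ⟧ (ht (enc A a))
growth {A = A} P a with runs P a
... | t , r , le = ≤-trans (ht-run r) (+-monoʳ-≤ (ht (enc A a)) le)

-- Programs are built from folds, tests and defaults; this transfers their bounds to the function in
-- the form in which it is reasoned about.
PT-ext : {f g : El A → El B} → PT f → f ≗ g → PT g
PT-ext {A = A} {B = B} (mkPT p b r) eq =
  mkPT p b λ a → let (t , d , le) = r a in t , subst (λ y → p ⊢ enc A a ⇓ enc B y ∣ t) (eq a) d , le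

idP : PT {A} {A} (λ a → a)
idP = mkPT id# (K 1) λ a → 1 , id⇓ , ≤-refl

fstP : PT {A `× B} {A} proj₁
fstP = mkPT hd# (K 1) λ a → 1 , hd⇓ , ≤-refl

sndP : PT {A `× B} {B} proj₂
sndP = mkPT tl# (K 1) λ a → 1 , tl⇓ , ≤-refl

infixr 9 _∘P_

_∘P_ : {g : El B → El C} {f : El A → El B} → PT g → PT f → PT (λ a → g (f a))
_∘P_ {A = A} {f = f} G F = mkPT (prog F ⨟ prog G) (K 1 ⊕ (bound F ⊕ bound G ⊚ (X ⊕ bound F))) λ a →
  let (s , d , ls) = runs F a
      (t , e , lt) = runs G (f a)
  in suc (s + t) , ⨟⇓ d e ,
     s≤s (+-mono-≤ ls (≤-trans lt (⟦⟧-mono (bound G) (growth F a))))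

infixr 4 _,P_

_,P_ : {f : El A → El B} {g : El A → El C} → PT f → PT g → PT {A} {B `× C} (λ a → f a , g a)
F ,P G = mkPT (cons# (prog F) (prog G)) (K 1 ⊕ (bound F ⊕ bound G)) λ a →
  let (s , d , ls) = runs F a
      (t , e , lt) = runs G a
  in suc (s + t) , cons⇓ d e , s≤s (+-mono-≤ ls lt)

-- A nonempty list is encoded by the same tree as the pair of its head and tail, so the pairing
-- program serves again.
consP : {f : El A → El B} {g : El A → List (El B)} → PT f → PT {A} {list B} g → PT {A} {list B} (λ a → f a ∷ g a)
consP F G = mkPT (prog (F ,P G)) (bound (F ,P G)) (runs (F ,P G))

quoteTree : Tree → Prog
quoteTree nil     = nil#
quoteTree (x ∙ y) = cons# (quoteTree x) (quoteTree y)

quoteCost : Tree → ℕ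
quoteCost nil     = 1
quoteCost (x ∙ y) = suc (quoteCost x + quoteCost y)

quote⇓ : ∀ {x} y → quoteTree y ⊢ x ⇓ y ∣ quoteCost y
quote⇓ nil     = nil⇓
quote⇓ (y ∙ z) = cons⇓ (quote⇓ y) (quote⇓ z)

constP : ∀ (b : El B) → PT {A} {B} (λ _ → b)
constP {B = B} b = mkPT (quoteTree (enc B b)) (K (quoteCost (enc B b))) λ a → _ , quote⇓ _ , ≤-refl

ifP : {b : El A → Bool} {f g : El A → El B} → PT {A} {bool} b → PT f → PT g → PT (λ a → if b a then f a else g a)
ifP {A = A} {B = B} {b} {f} {g} P F G =
  mkPT (if# (prog P) (prog F) (prog G)) (K 1 ⊕ (bound P ⊕ (bound F ⊕ bound G))) λ a →
  let (s , d , ls) = runs P a in aux a (b a) s d ls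
  where
  aux : ∀ a v s → prog P ⊢ enc A a ⇓ bitTree v ∣ s → s ≤ ⟦ bound P ⟧ (ht (enc A a)) →
        Σ ℕ λ t → (if# (prog P) (prog F) (prog G) ⊢ enc A a ⇓ enc B (if v then f a else g a) ∣ t) ×
                  t ≤ ⟦ K 1 ⊕ (bound P ⊕ (bound F ⊕ bound G)) ⟧ (ht (enc A a))
  aux a true s d ls = let (t , e , lt) = runs F a in
    _ , then⇓ d e , s≤s (+-mono-≤ ls (≤-trans lt (m≤m+n _ _)))
  aux a false s d ls = let (t , e , lt) = runs G a in
    _ , else⇓ d e , s≤s (+-mono-≤ ls (≤-trans lt (m≤n+m _ _)))

testProg : Prog
testProg = if# id# nil# (cons# nil# nil#)

isZero : ℕ → Bool
isZero zero    = true
isZero (suc _) = false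

isZeroP : PT {nat} {bool} isZero
isZeroP = mkPT testProg (K 5) λ where
  zero    → 5 , else⇓ id⇓ (cons⇓ nil⇓ nil⇓) , ≤-refl
  (suc n) → 3 , then⇓ id⇓ nil⇓ , s≤s (s≤s (s≤s z≤n))

isNil : {A : Set} → List A → Bool
isNil []      = true
isNil (_ ∷ _) = false

isNilP : PT {list A} {bool} isNil
isNilP = mkPT testProg (K 5) λ where
  []      → 5 , else⇓ id⇓ (cons⇓ nil⇓ nil⇓) , ≤-refl
  (_ ∷ _) → 3 , then⇓ id⇓ nil⇓ , s≤s (s≤s (s≤s z≤n))

sucP : PT {nat} {nat} suc
sucP = mkPT (cons# nil# id#) (K 3) λ n → 3 , cons⇓ nil⇓ id⇓ , ≤-refl

predP : PT {nat} {nat} pred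
predP = mkPT tl# (K 1) λ where
  zero    → 1 , tl⇓nil , ≤-refl
  (suc n) → 1 , tl⇓ , ≤-refl

tl : {A : Set} → List A → List A
tl []       = []
tl (_ ∷ xs) = xs

tlP : PT {list A} {list A} tl
tlP = mkPT tl# (K 1) λ where
  []      → 1 , tl⇓nil , ≤-refl
  (_ ∷ _) → 1 , tl⇓ , ≤-refl

hd : {A : Set} → A → List A → A
hd d []      = d
hd d (x ∷ _) = x

hdP : (d : El A) → PT {list A} {A} (hd d)
hdP {A = A} d = mkPT (if# id# hd# (quoteTree (enc A d))) (K (3 + quoteCost (enc A d))) λ where
  []      → _ , else⇓ id⇓ (quote⇓ _) , m≤n⇒m≤1+n ≤-refl
  (_ ∷ _) → 3 , then⇓ id⇓ hd⇓ , s≤s (s≤s (s≤s z≤n))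

units : ℕ → List ⊤
units n = replicate n tt

enc-units : ∀ n → enc (list unit) (units n) ≡ numTree n
enc-units zero    = refl
enc-units (suc n) = cong (nil ∙_) (enc-units n)

-- Numbers and lists of units have the same encodings. Recursion on a number is therefore a fold,
-- and the conversion is `id#`.
unitsP : PT {nat} {list unit} units
unitsP = mkPT id# (K 1) λ n → 1 , subst (λ y → id# ⊢ numTree n ⇓ y ∣ 1) (sym (enc-units n)) id⇓ , ≤-refl

enc-length : ∀ xs → ht (numTree (length xs)) ≤ ht (enc (list A) xs)
enc-length [] = z≤n
enc-length {A = A} (x ∷ xs) = s≤s (≤-trans (enc-length xs) (m≤n⊔m (ht (enc A x)) _))

ht-num : ∀ n → ht (numTree n) ≡ n
ht-num zero    = refl
ht-num (suc n) = cong suc (ht-num n)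

length≤ht : ∀ xs → length xs ≤ ht (enc (list A) xs)
length≤ht {A = A} xs = subst (_≤ ht (enc (list A) xs)) (ht-num (length xs)) (enc-length xs)

-- Loops with additive growth

-- The loop state is γ ∙ (l ∙ s), with context γ, remaining list l and
-- accumulator s.

module Fold {Γ A S : Ty} {f : El (Γ `× A `× S) → El S} (F : PT f) (G : Poly)
            (grow : ∀ γ a s → ht (enc S (f (γ , a , s))) ≤
                              ht (enc S s) + ⟦ G ⟧ (ht (enc Γ γ) + ht (enc A a))) where

  step : El Γ → El S → El A → El S
  step γ s a = f (γ , a , s)

  cond body loop : Prog
  cond = tl# ⨟ hd#
  body = cons# hd# (cons# (tl# ⨟ (hd# ⨟ tl#))
           (cons# hd# (cons# (tl# ⨟ (hd# ⨟ hd#)) (tl# ⨟ tl#)) ⨟ prog F))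
  loop = while# cond body

  state : El Γ → List (El A) → El S → Tree
  state γ l s = enc Γ γ ∙ (enc (list A) l ∙ enc S s)

  -- `M` bounds the height of the accumulator together with the growth still to come, so it remains
  -- valid from round to round and one bound on the cost of `F` fits all rounds. A round costs 24
  -- besides `F`, and the final test costs 4.
  loop⇓∃ : ∀ γ l s H M → ht (enc (list A) l) ≤ H →
          ht (enc S s) + length l * ⟦ G ⟧ (ht (enc Γ γ) + H) ≤ M →
          Σ ℕ λ t → (loop ⊢ state γ l s ⇓ state γ [] (foldl (step γ) s l) ∣ t) ×
            t ≤ length l * (24 + ⟦ bound F ⟧ (2 + (ht (enc Γ γ) + (H + M)))) + 4
  loop⇓∃ γ [] s H M hl hs = 4 , stop⇓ (⨟⇓ tl⇓ hd⇓) , ≤-refl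
  loop⇓∃ γ (a ∷ l) s H M hl hs =
    let (t , d , lt) = runs F (γ , a , s)
        (u , e , lu) = loop⇓∃ γ l (step γ s a) H M (≤-trans (ht-tail (enc A a) _) hl) hs'
    in _ , loop⇓ (⨟⇓ tl⇓ hd⇓)
             (cons⇓ hd⇓ (cons⇓ (⨟⇓ tl⇓ (⨟⇓ hd⇓ tl⇓))
               (⨟⇓ (cons⇓ hd⇓ (cons⇓ (⨟⇓ tl⇓ (⨟⇓ hd⇓ hd⇓)) (⨟⇓ tl⇓ tl⇓))) d))) e
         , ≤-trans (+-mono-≤ (+-monoʳ-≤ 24 (≤-trans lt (⟦⟧-mono (bound F) arg≤))) lu)
                   (≤-reflexive (sym (+-assoc (24 + ⟦ bound F ⟧ _) (length l * _) 4)))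
    where
    hγ = ht (enc Γ γ)
    ha : ht (enc A a) ≤ H
    ha = ≤-trans (ht-head (enc A a) (enc (list A) l)) hl
    g = ⟦ G ⟧ (hγ + H)
    hs' : ht (enc S (step γ s a)) + length l * g ≤ M
    hs' = ≤-trans (+-monoˡ-≤ (length l * g) (≤-trans (grow γ a s)
            (+-monoʳ-≤ (ht (enc S s)) (⟦⟧-mono G (+-monoʳ-≤ hγ ha)))))
            (≤-trans (≤-reflexive (+-assoc (ht (enc S s)) g (length l * g))) hs)
    arg≤ : ht (enc Γ γ ∙ (enc A a ∙ enc S s)) ≤ 2 + (hγ + (H + M))
    arg≤ = ≤-trans (ht-∙ (enc Γ γ) (enc A a ∙ enc S s)) (s≤s (≤-trans (+-monoʳ-≤ hγ (ht-∙ (enc A a) (enc S s)))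
             (≤-trans (≤-reflexive (+-suc hγ _))
               (s≤s (+-monoʳ-≤ hγ (+-mono-≤ ha (m+n≤o⇒m≤o _ hs)))))))

  foldlP : {l : El Γ → List (El A)} {i : El Γ → El S} → PT {Γ} {list A} l → PT i →
           PT (λ γ → foldl (λ s a → f (γ , a , s)) (i γ) (l γ))
  foldlP {l} {i} L I =
    mkPT ((cons# id# (cons# (prog L) (prog I)) ⨟ loop) ⨟ (tl# ⨟ tl#)) bnd λ γ →
      let (s , d , ls) = runs L γ
          (t , e , lt) = runs I γ
          h   = ht (enc Γ γ)
          H   = h + ⟦ bound L ⟧ h
          M   = (h + ⟦ bound I ⟧ h) + H * ⟦ G ⟧ (h + H)
          (u , k , lu) = loop⇓∃ γ (l γ) (i γ) H M (growth L γ)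
                           (+-mono-≤ (growth I γ) (*-monoˡ-≤ (⟦ G ⟧ (h + H)) (≤-trans (length≤ht (l γ)) (growth L γ))))
      in _ , ⨟⇓ (⨟⇓ (cons⇓ id⇓ (cons⇓ d e)) k) (⨟⇓ tl⇓ tl⇓) ,
         s≤s (+-monoˡ-≤ 3 (s≤s (+-mono-≤ (+-monoʳ-≤ 3 (+-mono-≤ ls lt))
           (≤-trans lu (+-monoˡ-≤ 4 (*-monoˡ-≤ (24 + ⟦ bound F ⟧ (2 + (h + (H + M))))
             (≤-trans (length≤ht (l γ)) (growth L γ))))))))
    where
    bH bM bnd : Poly
    bH  = X ⊕ bound L
    bM  = (X ⊕ bound I) ⊕ bH ⊗ (G ⊚ (X ⊕ bH))
    bnd = K 1 ⊕ ((K 1 ⊕ ((K 3 ⊕ (bound L ⊕ bound I)) ⊕ (bH ⊗ (K 24 ⊕ bound F ⊚ (K 2 ⊕ (X ⊕ (bH ⊕ bM)))) ⊕ K 4))) ⊕ K 3)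

reverseP : PT {list A} {list A} reverse
reverseP {A} = PT-ext {f = λ γ → foldl (λ s a → a ∷ s) [] γ}
  (Fold.foldlP {Γ = list A} {A = A} {S = list A} {f = λ (_ , a , s) → a ∷ s}
    (consP (fstP ∘P sndP) (sndP ∘P sndP)) (K 1 ⊕ X)
    (λ γ a s → ≤-trans (ht-∙ (enc A a) (enc (list A) s)) (≤-trans (s≤s (≤-reflexive (+-comm (ht (enc A a)) _)))
       (≤-trans (≤-reflexive (sym (+-suc _ _))) (+-monoʳ-≤ (ht (enc (list A) s)) (s≤s (m≤n+m _ _))))))
    idP (constP [])) (λ γ → refl)

foldrP : {f : El (Γ `× A `× S) → El S} {l : El Γ → List (El A)} {i : El Γ → El S} →
         (F : PT f) (G : Poly)
         (grow : ∀ γ a s → ht (enc S (f (γ , a , s))) ≤ ht (enc S s) + ⟦ G ⟧ (ht (enc Γ γ) + ht (enc A a))) →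
         PT {Γ} {list A} l → PT i → PT (λ γ → foldr (λ a s → f (γ , a , s)) (i γ) (l γ))
foldrP {f = f} {l} {i} F G grow L I = PT-ext (Fold.foldlP F G grow (reverseP ∘P L) I) λ γ →
  trans (sym (reverse-foldr (λ a s → f (γ , a , s)) (i γ) (reverse (l γ))))
        (cong (foldr _ (i γ)) (reverse-involutive (l γ)))

≤+G : ∀ {a b c : ℕ} → a ≤ b + c → a ≤ c + b
≤+G {a} {b} {c} le = ≤-trans le (≤-reflexive (+-comm b c))

pairG : Poly → Poly
pairG P = (K 1 ⊕ X) ⊕ P ⊚ (K 1 ⊕ X)

growth₂ : {h : El (Γ `× A) → El B} (P : PT h) → ∀ γ a →
          ht (enc B (h (γ , a))) ≤ ⟦ pairG (bound P) ⟧ (ht (enc Γ γ) + ht (enc A a))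
growth₂ {Γ = Γ} {A = A} P γ a = ≤-trans (growth P (γ , a))
  (+-mono-≤ (ht-∙ (enc Γ γ) (enc A a)) (⟦⟧-mono (bound P) (ht-∙ (enc Γ γ) (enc A a))))

ctx₂ : {h : El (Γ `× A) → El B} → PT h → PT {Γ `× A `× S} {B} (λ p → h (proj₁ p , proj₁ (proj₂ p)))
ctx₂ H = H ∘P (fstP ,P fstP ∘P sndP)

ht-∷ : ∀ (a : El A) s → ht (enc (list A) (a ∷ s)) ≤ ht (enc (list A) s) + suc (ht (enc A a))
ht-∷ {A} a s = ≤-trans (ht-∙ (enc A a) (enc (list A) s)) (≤+G {b = suc (ht (enc A a))} ≤-refl)

mapP : {h : El (Γ `× A) → El B} {l : El Γ → List (El A)} → PT h → PT {Γ} {list A} l →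
       PT {Γ} {list B} (λ γ → map (λ a → h (γ , a)) (l γ))
mapP {B = B} {h} {l} H L = PT-ext
  (foldrP {S = list B} {f = λ (γ , a , s) → h (γ , a) ∷ s} (consP (ctx₂ H) (sndP ∘P sndP)) (K 1 ⊕ pairG (bound H))
    (λ γ a s → ≤-trans (ht-∷ (h (γ , a)) s) (+-monoʳ-≤ (ht (enc (list B) s)) (s≤s (growth₂ H γ a))))
    L (constP []))
  (λ γ → sym (map-is-foldr (l γ)))

appendP : {f g : El Γ → List (El A)} → PT {Γ} {list A} f → PT {Γ} {list A} g → PT {Γ} {list A} (λ γ → f γ ++ g γ)
appendP {A = A} {f} {g} F G = PT-ext
  (foldrP {S = list A} {f = λ (γ , a , s) → a ∷ s} (consP (fstP ∘P sndP) (sndP ∘P sndP)) (K 1 ⊕ X)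
    (λ γ a s → ≤-trans (ht-∷ a s) (+-monoʳ-≤ (ht (enc (list A) s)) (s≤s (m≤n+m _ _)))) F G)
  (λ γ → go (f γ) (g γ))
  where
  go : ∀ xs ys → foldr _∷_ ys xs ≡ xs ++ ys
  go []       ys = refl
  go (x ∷ xs) ys = cong (x ∷_) (go xs ys)

ht-++ : ∀ (xs ys : List (El A)) → ht (enc (list A) (xs ++ ys)) ≤ ht (enc (list A) xs) + ht (enc (list A) ys)
ht-++ []       ys = ≤-refl
ht-++ {A} (x ∷ xs) ys = s≤s (⊔-lub (≤-trans (m≤m⊔n (ht (enc A x)) _) (m≤m+n _ _))
  (≤-trans (ht-++ xs ys) (+-monoˡ-≤ _ (m≤n⊔m (ht (enc A x)) _))))

concatP : {l : El Γ → List (List (El A))} → PT {Γ} {list (list A)} l → PT {Γ} {list A} (λ γ → concat (l γ))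
concatP {A = A} L = foldrP {A = list A} {S = list A} {f = λ (γ , a , s) → a ++ s}
  (appendP (fstP ∘P sndP) (sndP ∘P sndP)) X
  (λ γ a s → ≤-trans (ht-++ a s) (≤-trans (≤+G {b = ht (enc (list A) a)} ≤-refl)
    (+-monoʳ-≤ (ht (enc (list A) s)) (m≤n+m _ _)))) L (constP [])

natrecP : {f : El (Γ `× S) → El S} {n : El Γ → ℕ} {i : El Γ → El S} (F : PT f) (G : Poly) →
          (∀ γ s → ht (enc S (f (γ , s))) ≤ ht (enc S s) + ⟦ G ⟧ (ht (enc Γ γ))) →
          PT {Γ} {nat} n → PT i → PT (λ γ → foldr (λ _ s → f (γ , s)) (i γ) (units (n γ)))
natrecP {Γ = Γ} {S = S} {f} F G grow N I = foldrP {A = unit} {f = λ (γ , _ , s) → f (γ , s)}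
  (F ∘P (fstP ,P sndP ∘P sndP)) G
  (λ γ a s → ≤-trans (grow γ s) (+-monoʳ-≤ (ht (enc S s)) (⟦⟧-mono G (m≤m+n _ 0)))) (unitsP ∘P N) I

-- Arithmetic, lists and Booleans

addP : {m n : El Γ → ℕ} → PT {Γ} {nat} m → PT {Γ} {nat} n → PT {Γ} {nat} (λ γ → m γ + n γ)
addP {m = m} {n} M N = PT-ext (natrecP {f = λ (γ , s) → suc s} (sucP ∘P sndP) (K 1)
  (λ γ s → ≤-reflexive (+-comm 1 (ht (numTree s)))) M N) (λ γ → go (m γ) (n γ))
  where
  go : ∀ a b → foldr (λ _ s → suc s) b (units a) ≡ a + b
  go zero b = refl
  go (suc a) b = cong suc (go a b)

monusP : {m n : El Γ → ℕ} → PT {Γ} {nat} m → PT {Γ} {nat} n → PT {Γ} {nat} (λ γ → m γ ∸ n γ)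
monusP {m = m} {n} M N = PT-ext (natrecP {f = λ (γ , s) → pred s} (predP ∘P sndP) (K 0)
  (λ γ s → ≤-trans (le s) (m≤m+n _ 0)) N M) (λ γ → go (m γ) (n γ))
  where
  le : ∀ s → ht (numTree (pred s)) ≤ ht (numTree s)
  le zero = z≤n
  le (suc s) = m≤n⇒m≤1+n ≤-refl
  go : ∀ b a → foldr (λ _ s → pred s) b (units a) ≡ b ∸ a
  go b zero = refl
  go b (suc a) = trans (cong pred (go b a)) (pred[m∸n]≡m∸[1+n] b a)

mulP : {m n : El Γ → ℕ} → PT {Γ} {nat} m → PT {Γ} {nat} n → PT {Γ} {nat} (λ γ → m γ * n γ)
mulP {Γ = Γ} {m = m} {n} M N = PT-ext (natrecP {f = λ (γ , s) → n γ + s} (addP (N ∘P fstP) sndP) (X ⊕ bound N)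
  (λ γ s → ≤-trans (≤-reflexive (trans (ht-num (n γ + s)) (+-comm (n γ) s)))
     (+-mono-≤ (≤-reflexive (sym (ht-num s))) (≤-trans (≤-reflexive (sym (ht-num (n γ)))) (growth N γ)))) M (constP 0))
  (λ γ → go (m γ) (n γ))
  where
  go : ∀ a b → foldr (λ _ s → b + s) 0 (units a) ≡ a * b
  go zero b = refl
  go (suc a) b = cong (b +_) (go a b)

powP : ∀ c → PT {nat} {nat} (_^ c)
powP zero    = constP 1
powP (suc c) = mulP idP (powP c)

sumP : {l : El Γ → List ℕ} → PT {Γ} {list nat} l → PT {Γ} {nat} (λ γ → sum (l γ))
sumP L = foldrP {A = nat} {S = nat} {f = λ (γ , a , s) → a + s} (addP (fstP ∘P sndP) (sndP ∘P sndP)) X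
  (λ γ a s → ≤-trans (≤-reflexive (trans (ht-num (a + s)) (trans (+-comm a s) (sym (cong₂ _+_ (ht-num s) (ht-num a))))))
    (+-monoʳ-≤ (ht (numTree s)) (m≤n+m _ _))) L (constP 0)

lengthP : {l : El Γ → List (El A)} → PT {Γ} {list A} l → PT {Γ} {nat} (λ γ → length (l γ))
lengthP {A = A} {l} L = PT-ext (foldrP {A = A} {S = nat} {f = λ (γ , a , s) → suc s} (sucP ∘P sndP ∘P sndP) (K 1)
  (λ γ a s → ≤-reflexive (+-comm 1 (ht (numTree s)))) L (constP 0)) (λ γ → go (l γ))
  where
  go : ∀ xs → foldr (λ _ s → suc s) 0 xs ≡ length xs
  go []       = refl
  go (x ∷ xs) = cong suc (go xs)

replicateP : {n : El Γ → ℕ} {f : El Γ → El A} → PT {Γ} {nat} n → PT f → PT {Γ} {list A} (λ γ → replicate (n γ) (f γ))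
replicateP {n = n} {f} N F = PT-ext (mapP (F ∘P fstP) (unitsP ∘P N)) (λ γ → go (n γ) (f γ))
  where
  go : ∀ {X : Set} n (x : X) → map (λ _ → x) (units n) ≡ replicate n x
  go zero x = refl
  go (suc n) x = cong (x ∷_) (go n x)

dropP : {n : El Γ → ℕ} {l : El Γ → List (El A)} → PT {Γ} {nat} n → PT {Γ} {list A} l → PT {Γ} {list A}
  (λ γ → drop (n γ) (l γ))
dropP {A = A} {n} {l} N L = PT-ext (natrecP {S = list A} {f = λ (γ , s) → tl s} (tlP ∘P sndP) (K 0)
  (λ γ s → ≤-trans (le s) (m≤m+n _ 0)) N L) (λ γ → go (n γ) (l γ))
  where
  le : ∀ s → ht (enc (list A) (tl s)) ≤ ht (enc (list A) s)
  le [] = z≤n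
  le (x ∷ s) = ht-tail (enc A x) _
  tl-drop : ∀ n l → tl (drop n l) ≡ drop (suc n) l
  tl-drop zero [] = refl
  tl-drop zero (x ∷ l) = refl
  tl-drop (suc n) [] = refl
  tl-drop (suc n) (x ∷ l) = tl-drop n l
  go : ∀ n l → foldr (λ _ s → tl s) l (units n) ≡ drop n l
  go zero l = refl
  go (suc n) l = trans (cong tl (go n l)) (tl-drop n l)

nth : {A : Set} → A → List A → ℕ → A
nth d []       _       = d
nth d (x ∷ _)  zero    = x
nth d (_ ∷ xs) (suc n) = nth d xs n

nthP : (d : El A) {l : El Γ → List (El A)} {n : El Γ → ℕ} → PT {Γ} {list A} l → PT {Γ} {nat} n → PT
  (λ γ → nth d (l γ) (n γ))
nthP d {l} {n} L N = PT-ext (hdP d ∘P dropP N L) (λ γ → go (l γ) (n γ))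
  where
  go : ∀ l n → hd d (drop n l) ≡ nth d l n
  go []      zero    = refl
  go []      (suc n) = refl
  go (x ∷ l) zero    = refl
  go (x ∷ l) (suc n) = go l n

downFromP : PT {nat} {list nat} downFrom
downFromP = PT-ext (sndP ∘P natrecP {S = nat `× list nat} {f = λ (γ , c , l) → suc c , c ∷ l}
  (sucP ∘P fstP ∘P sndP ,P consP (fstP ∘P sndP) (sndP ∘P sndP)) (K 1)
  (λ γ (c , l) → ≤-trans (s≤s (le (ht (numTree c)) (ht (enc (list nat) l)))) (≤-reflexive (+-comm 1 _)))
  idP (constP {B = nat `× list nat} (0 , []))) (λ n → cong proj₂ (go n))
  where
  le : ∀ a b → suc a ⊔ suc (a ⊔ b) ≤ suc (a ⊔ b)
  le a b = ⊔-lub (s≤s (m≤m⊔n a b)) ≤-refl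
  go : ∀ n → foldr {B = ℕ × List ℕ} (λ _ (c , l) → suc c , c ∷ l) (0 , []) (units n) ≡ (n , downFrom n)
  go zero = refl
  go (suc n) rewrite go n = refl

upToP : {n : El Γ → ℕ} → PT {Γ} {nat} n → PT {Γ} {list nat} (λ γ → upTo (n γ))
upToP {n = n} N = PT-ext (reverseP ∘P downFromP ∘P N) (λ γ → reverse-downFrom (n γ))

suffixes : {A : Set} → List A → List (List A)
suffixes []       = [] ∷ []
suffixes (x ∷ xs) = (x ∷ xs) ∷ suffixes xs

suffixesP : {l : El Γ → List (El A)} → PT {Γ} {list A} l → PT {Γ} {list (list A)} (λ γ → suffixes (l γ))
suffixesP {A = A} {l} L = PT-ext (foldrP {A = A} {S = Ls} {f = λ (γ , a , s) → (a ∷ hd [] s) ∷ s}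
  (consP (consP (fstP ∘P sndP) (hdP [] ∘P sndP ∘P sndP)) (sndP ∘P sndP)) (K 2 ⊕ X)
  (λ γ a s → ≤-trans (s≤s (⊔-lub (s≤s (⊔-lub (m≤m+n (ht (enc A a)) _) (≤-trans (ht-hd s) (m≤n+m _ _))))
    (m≤n⇒m≤1+n (m≤n+m _ (ht (enc A a))))))
    (≤-trans (≤+G {b = 2 + ht (enc A a)} ≤-refl) (+-monoʳ-≤ (ht (enc Ls s)) (s≤s (s≤s (m≤n+m _ _))))))
  L (constP ([] ∷ []))) (λ γ → go (l γ))
  where
  Ls = list (list A)
  ht-hd : ∀ s → ht (enc (list A) (hd [] s)) ≤ ht (enc Ls s)
  ht-hd [] = z≤n
  ht-hd (x ∷ s) = ht-head (enc (list A) x) (enc Ls s)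
  hd-suffixes : {A : Set} (l : List A) → hd [] (suffixes l) ≡ l
  hd-suffixes [] = refl
  hd-suffixes (x ∷ l) = refl
  go : ∀ l → foldr (λ a s → (a ∷ hd [] s) ∷ s) ([] ∷ []) l ≡ suffixes l
  go [] = refl
  go (x ∷ l) rewrite go l = cong (λ z → (x ∷ z) ∷ suffixes l) (hd-suffixes l)

notP : {b : El Γ → Bool} → PT {Γ} {bool} b → PT {Γ} {bool} (λ γ → not (b γ))
notP {b = b} P = PT-ext (ifP P (constP false) (constP true)) (λ γ → go (b γ))
  where
  go : ∀ b → (if b then false else true) ≡ not b
  go false = refl
  go true = refl

andP : {b c : El Γ → Bool} → PT {Γ} {bool} b → PT {Γ} {bool} c → PT {Γ} {bool} (λ γ → b γ ∧ c γ)
andP {b = b} {c} P Q = PT-ext (ifP P Q (constP false)) (λ γ → go (b γ) (c γ))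
  where
  go : ∀ b c → (if b then c else false) ≡ b ∧ c
  go false c = refl
  go true c = refl

orP : {b c : El Γ → Bool} → PT {Γ} {bool} b → PT {Γ} {bool} c → PT {Γ} {bool} (λ γ → b γ ∨ c γ)
orP {b = b} {c} P Q = PT-ext (ifP P (constP true) Q) (λ γ → go (b γ) (c γ))
  where
  go : ∀ b c → (if b then true else c) ≡ b ∨ c
  go false c = refl
  go true c = refl

ht-bool : ∀ b → ht (bitTree b) ≤ 1
ht-bool false = z≤n
ht-bool true  = ≤-refl

andsP : {l : El Γ → List Bool} → PT {Γ} {list bool} l → PT {Γ} {bool} (λ γ → and (l γ))
andsP L = foldrP {A = bool} {S = bool} {f = λ (γ , a , s) → a ∧ s} (andP (fstP ∘P sndP) (sndP ∘P sndP)) (K 1)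
  (λ γ a s → ≤-trans (ht-bool (a ∧ s)) (m≤n+m 1 _)) L (constP true)

orsP : {l : El Γ → List Bool} → PT {Γ} {list bool} l → PT {Γ} {bool} (λ γ → or (l γ))
orsP L = foldrP {A = bool} {S = bool} {f = λ (γ , a , s) → a ∨ s} (orP (fstP ∘P sndP) (sndP ∘P sndP)) (K 1)
  (λ γ a s → ≤-trans (ht-bool (a ∨ s)) (m≤n+m 1 _)) L (constP false)

allP : {h : El (Γ `× A) → Bool} {l : El Γ → List (El A)} → PT {Γ `× A} {bool} h → PT {Γ} {list A} l →
       PT {Γ} {bool} (λ γ → all (λ a → h (γ , a)) (l γ))
allP H L = andsP (mapP H L)

anyP : {h : El (Γ `× A) → Bool} {l : El Γ → List (El A)} → PT {Γ `× A} {bool} h → PT {Γ} {list A} l →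
       PT {Γ} {bool} (λ γ → any (λ a → h (γ , a)) (l γ))
anyP H L = orsP (mapP H L)

ltP : {m n : El Γ → ℕ} → PT {Γ} {nat} m → PT {Γ} {nat} n → PT {Γ} {bool} (λ γ → m γ <ᵇ n γ)
ltP {m = m} {n} M N = PT-ext (notP (isZeroP ∘P monusP N M)) (λ γ → go (m γ) (n γ))
  where
  go : ∀ m n → not (isZero (n ∸ m)) ≡ (m <ᵇ n)
  go zero    zero    = refl
  go (suc m) zero    = refl
  go zero    (suc n) = refl
  go (suc m) (suc n) = go m n

eqP : {m n : El Γ → ℕ} → PT {Γ} {nat} m → PT {Γ} {nat} n → PT {Γ} {bool} (λ γ → m γ ≡ᵇ n γ)
eqP {m = m} {n} M N = PT-ext (andP (isZeroP ∘P monusP M N) (isZeroP ∘P monusP N M)) (λ γ → go (m γ) (n γ))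
  where
  go : ∀ m n → (isZero (m ∸ n) ∧ isZero (n ∸ m)) ≡ (m ≡ᵇ n)
  go zero    zero    = refl
  go (suc m) zero    = refl
  go zero    (suc n) = refl
  go (suc m) (suc n) = go m n

-- Like filterᵇ, but composed of functions that have been compiled above.

keep : {A : Set} → (A → Bool) → List A → List A
keep p l = concat (map (λ a → if p a then a ∷ [] else []) l)

keepP : {h : El (Γ `× A) → Bool} {l : El Γ → List (El A)} → PT {Γ `× A} {bool} h → PT {Γ} {list A} l →
       PT {Γ} {list A} (λ γ → keep (λ a → h (γ , a)) (l γ))
keepP {A = A} H L = concatP (mapP (ifP H (consP sndP (constP [])) (constP {B = list A} [])) L)

∑ : ℕ → (ℕ → ℕ) → ℕ
∑ zero    f = 0
∑ (suc n) f = f 0 + ∑ n (f ∘ suc)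

sum-applyUpTo : ∀ (f g : ℕ → ℕ) n → sum (map f (applyUpTo g n)) ≡ ∑ n (f ∘ g)
sum-applyUpTo f g zero    = refl
sum-applyUpTo f g (suc n) = cong (f (g 0) +_) (sum-applyUpTo f (g ∘ suc) n)

∑P : {h : El (Γ `× nat) → ℕ} {n : El Γ → ℕ} → PT {Γ `× nat} {nat} h → PT {Γ} {nat} n →
     PT {Γ} {nat} (λ γ → ∑ (n γ) (λ i → h (γ , i)))
∑P {h = h} {n} H N = PT-ext (sumP (mapP H (upToP N))) (λ γ → sum-applyUpTo (λ i → h (γ , i)) (λ i → i) (n γ))

-- Formulas of bounded depth, their tables and digests

-- Formulas of depth at most δ: a tag (0 input, 1 nand, 2 and, 3 or), the
-- index of the input, and the arguments.

F : ℕ → Ty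
F zero    = nat
F (suc δ) = nat `× nat `× list (F δ)

RGate RCircuit : Ty
RGate    = nat `× list nat
RCircuit = nat `× list RGate `× nat

-- The newest gate comes first in a list of gates, as in Gates.

unroll : ∀ δ → El (list RGate) → ℕ → El (F δ)
-- Indices below `length gs` are gates and the others are inputs. On a gate the truncated difference
-- is a meaningless 0, which `depthOK` excludes.
unroll zero    gs i = i ∸ length gs
unroll (suc δ) gs i =
  if isNil (drop i gs) then (0 , i ∸ length gs , [])
  else (let (t , is) = hd (0 , []) (drop i gs) in t , 0 , map (unroll δ (tl (drop i gs))) is)

-- Unrolling copies shared gates, and every level may multiply the size by the largest fan-in. This
-- stays polynomial because `δ` is a constant, over which programs are nested.
unrollP : ∀ δ → PT {list RGate `× nat} {F δ} (λ (gs , i) → unroll δ gs i)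
unrollP zero    = monusP sndP (lengthP fstP)
unrollP (suc δ) = ifP (isNilP ∘P rest) (constP 0 ,P monusP sndP (lengthP fstP) ,P constP {B = list (F δ)} [])
  (fstP ∘P gate ,P constP 0 ,P mapP (unrollP δ ∘P (tlP ∘P rest ∘P fstP ,P sndP)) (sndP ∘P gate))
  where
  rest : PT {list RGate `× nat} {list RGate} (λ (gs , i) → drop i gs)
  rest = dropP sndP fstP
  gate : PT {list RGate `× nat} {RGate} (λ (gs , i) → hd (0 , []) (drop i gs))
  gate = hdP (0 , []) ∘P rest

depthOK : ℕ → El (list RGate) → ℕ → Bool
depthOK zero    gs i = isNil (drop i gs)
depthOK (suc δ) gs i = isNil (drop i gs) ∨ all (depthOK δ (tl (drop i gs))) (proj₂ (hd (0 , []) (drop i gs)))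

depthOKP : ∀ δ → PT {list RGate `× nat} {bool} (λ (gs , i) → depthOK δ gs i)
depthOKP zero    = isNilP ∘P dropP sndP fstP
depthOKP (suc δ) = orP (isNilP ∘P rest)
  (allP (depthOKP δ ∘P (tlP ∘P rest ∘P fstP ,P sndP)) (sndP ∘P hdP (0 , []) ∘P rest))
  where
  rest : PT {list RGate `× nat} {list RGate} (λ (gs , i) → drop i gs)
  rest = dropP sndP fstP

-- A large gate uses up the weft allowed on its paths, so below it `weft₁` hands over to `weft₀`,
-- which admits no large gate.
weft₀ weft₁ : ∀ δ → El (F δ) → Bool
weft₀ zero    _            = true
weft₀ (suc δ) (t , i , cs) = isZero t ∨ (if 2 <ᵇ length cs then false else all (weft₀ δ) cs)

weft₁ zero    _            = true
weft₁ (suc δ) (t , i , cs) = isZero t ∨ (if 2 <ᵇ length cs then all (weft₀ δ) cs else all (weft₁ δ) cs)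

bigP : PT {nat `× nat `× list A} {bool} (λ (_ , _ , cs) → 2 <ᵇ length cs)
bigP = ltP (constP 2) (lengthP (sndP ∘P sndP))

weft₀P : ∀ δ → PT {F δ} {bool} (weft₀ δ)
weft₀P zero    = constP true
weft₀P (suc δ) = orP (isZeroP ∘P fstP) (ifP bigP (constP false) (allP (weft₀P δ ∘P sndP) (sndP ∘P sndP)))

weft₁P : ∀ δ → PT {F δ} {bool} (weft₁ δ)
weft₁P zero    = constP true
weft₁P (suc δ) = orP (isZeroP ∘P fstP)
  (ifP bigP (allP (weft₀P δ ∘P sndP) (sndP ∘P sndP)) (allP (weft₁P δ ∘P sndP) (sndP ∘P sndP)))

memb : ℕ → List ℕ → Bool
memb i = any (i ≡ᵇ_)

membP : {i : El Γ → ℕ} {l : El Γ → List ℕ} → PT {Γ} {nat} i → PT {Γ} {list nat} l → PT {Γ} {bool}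
  (λ γ → memb (i γ) (l γ))
membP I L = anyP (eqP (I ∘P fstP) sndP) L

gateOp : ℕ → List Bool → Bool
gateOp t bs = if t ≡ᵇ 1 then not (and bs) else if t ≡ᵇ 2 then and bs else or bs

gateOpP : {t : El Γ → ℕ} {bs : El Γ → List Bool} → PT {Γ} {nat} t → PT {Γ} {list bool} bs →
          PT {Γ} {bool} (λ γ → gateOp (t γ) (bs γ))
gateOpP T Bs = ifP (eqP T (constP 1)) (notP (andsP Bs)) (ifP (eqP T (constP 2)) (andsP Bs) (orsP Bs))

val : ∀ δ → El (F δ) → List ℕ → Bool
val zero    i            B = memb i B
val (suc δ) (t , i , cs) B = if isZero t then memb i B else gateOp t (map (λ c → val δ c B) cs)

valP : ∀ δ → PT {F δ `× list nat} {bool} (λ (φ , B) → val δ φ B)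
valP zero    = membP fstP sndP
valP (suc δ) = ifP (isZeroP ∘P fstP ∘P fstP) (membP (fstP ∘P sndP ∘P fstP) sndP)
  (gateOpP (fstP ∘P fstP) (mapP (valP δ ∘P (sndP ,P sndP ∘P fstP)) (sndP ∘P sndP ∘P fstP)))

-- The value of a formula is read off in the list table at the position digest.
-- A large gate contributes the number of its true arguments as a digit, and a
-- small gate combines the digits of its arguments into one number.

neutral : ℕ → Bool
neutral t = if t ≡ᵇ 1 then true else if t ≡ᵇ 2 then true else false

countOp : ℕ → ℕ → ℕ → Bool
countOp t m j = if t ≡ᵇ 1 then not (j ≡ᵇ m) else if t ≡ᵇ 2 then j ≡ᵇ m else not (isZero j)

-- `T₀` runs fastest, so the entry for the digests `i` and `j` of the two arguments stands at
-- `i + length T₀ * j`, the number formed by `digest`.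
prodTable : ℕ → List Bool → List Bool → List Bool
prodTable t T₀ T₁ = concat (map (λ b₁ → map (λ b₀ → gateOp t (b₀ ∷ b₁ ∷ [])) T₀) T₁)

table : ∀ δ → El (F δ) → List Bool
table zero    _            = false ∷ true ∷ []
table (suc δ) (t , i , cs) =
  if isZero t then false ∷ true ∷ []
  else if 2 <ᵇ length cs then map (countOp t (length cs)) (upTo (suc (length cs)))
  else prodTable t (hd (neutral t ∷ []) (map (table δ) cs)) (hd (neutral t ∷ []) (tl (map (table δ) cs)))

-- The default depends on the context, while `hdP` can only quote a constant. After the test for
-- emptiness the constant is never returned.
hdP′ : {d : El Γ → El A} {l : El Γ → List (El A)} → PT d → PT {Γ} {list A} l → PT (λ γ → hd (d γ) (l γ))
hdP′ {A = A} {d} {l} D L = PT-ext (ifP (isNilP ∘P L) D (hdP {A = A} default ∘P L)) (λ γ → go (d γ) (l γ))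
  where
  defaultOf : ∀ A → El A
  defaultOf unit     = tt
  defaultOf nat      = 0
  defaultOf bool     = false
  defaultOf (list A) = []
  defaultOf (A `× B) = defaultOf A , defaultOf B
  default = defaultOf A
  go : ∀ d l → (if isNil l then d else hd default l) ≡ hd d l
  go d []      = refl
  go d (x ∷ l) = refl

neutralP : {t : El Γ → ℕ} → PT {Γ} {nat} t → PT {Γ} {bool} (λ γ → neutral (t γ))
neutralP T = ifP (eqP T (constP 1)) (constP true) (ifP (eqP T (constP 2)) (constP true) (constP false))

tableP : ∀ δ → PT {F δ} {list bool} (table δ)
tableP zero    = constP {B = list bool} (false ∷ true ∷ [])
tableP (suc δ) = ifP (isZeroP ∘P fstP) (constP {B = list bool} (false ∷ true ∷ []))
  (ifP bigP
    (mapP (ifP (eqP (fstP ∘P fstP) (constP 1)) (notP (eqP sndP len))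
           (ifP (eqP (fstP ∘P fstP) (constP 2)) (eqP sndP len) (notP (isZeroP ∘P sndP))))
      (upToP (sucP ∘P lengthP (sndP ∘P sndP))))
    (concatP (mapP (mapP (gateOpP (fstP ∘P fstP ∘P fstP) (consP sndP (consP (sndP ∘P fstP) (constP []))))
                         (hdP′ (dflt ∘P fstP) (ts ∘P fstP)))
                   (hdP′ dflt (tlP ∘P ts)))))
  where
  Φ = nat `× nat `× list (F δ)
  len : PT {Φ `× nat} {nat} (λ (φ , _) → length (proj₂ (proj₂ φ)))
  len = lengthP (sndP ∘P sndP ∘P fstP)
  ts : PT {Φ} {list (list bool)} (λ φ → map (table δ) (proj₂ (proj₂ φ)))
  ts = mapP (tableP δ ∘P sndP) (sndP ∘P sndP)
  dflt : PT {Φ} {list bool} (λ φ → neutral (proj₁ φ) ∷ [])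
  dflt = consP (neutralP fstP) (constP [])

bit : Bool → ℕ
bit b = if b then 1 else 0

digest : ∀ δ → El (F δ) → List ℕ → ℕ
digest zero    i            B = bit (memb i B)
digest (suc δ) (t , i , cs) B =
  if isZero t then bit (memb i B)
  else if 2 <ᵇ length cs then sum (map (λ c → bit (val δ c B)) cs)
  else hd 0 (map (λ c → digest δ c B) cs) +
       length (hd (neutral t ∷ []) (map (table δ) cs)) * hd 0 (tl (map (λ c → digest δ c B) cs))

bitP : {b : El Γ → Bool} → PT {Γ} {bool} b → PT {Γ} {nat} (λ γ → bit (b γ))
bitP P = ifP P (constP 1) (constP 0)

digestP : ∀ δ → PT {F δ `× list nat} {nat} (λ (φ , B) → digest δ φ B)
digestP zero    = bitP (membP fstP sndP)
digestP (suc δ) = ifP (isZeroP ∘P fstP ∘P fstP) (bitP (membP (fstP ∘P sndP ∘P fstP) sndP))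
  (ifP (bigP ∘P fstP)
    (sumP (mapP (bitP (valP δ ∘P (sndP ,P sndP ∘P fstP))) (sndP ∘P sndP ∘P fstP)))
    (addP (hdP 0 ∘P ps)
      (mulP (lengthP (hdP′ (consP (neutralP (fstP ∘P fstP)) (constP []))
        (mapP (tableP δ ∘P sndP) (sndP ∘P sndP ∘P fstP))))
            (hdP 0 ∘P tlP ∘P ps))))
  where
  ps : PT {F (suc δ) `× list nat} {list nat} (λ (φ , B) → map (λ c → digest δ c B) (proj₂ (proj₂ φ)))
  ps = mapP (digestP δ ∘P (sndP ,P sndP ∘P fstP)) (sndP ∘P sndP ∘P fstP)

-- Small sublists and iterated differences

-- subs r L lists the sublists of L of length less than r.

subs subs⁺ : {A : Set} → ℕ → List A → List (List A)
subs zero    L = []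
subs (suc r) L = [] ∷ subs⁺ r L
subs⁺ r []      = []
subs⁺ r (x ∷ L) = map (x ∷_) (subs r L) ++ subs⁺ r L

-- The constant `r` is unfolded into nested programs, and the recursion on the list becomes one pass
-- over its suffixes: each suffix yields the sublists that begin with its head.
subsP : ∀ r → PT {list nat} {list (list nat)} (subs r)
subsP zero    = constP {B = list (list nat)} []
subsP (suc r) = consP (constP {B = list nat} [])
  (PT-ext (concatP (mapP (ifP (isNilP ∘P sndP) (constP {B = list (list nat)} [])
     (mapP (consP (hdP 0 ∘P sndP ∘P fstP) sndP) (subsP r ∘P tlP ∘P sndP))) (suffixesP idP))) go)
  where
  go : ∀ L → concat (map (λ s → if isNil s then [] else map (hd 0 s ∷_) (subs r (tl s))) (suffixes L)) ≡ subs⁺ r L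
  go []      = refl
  go (x ∷ L) = cong (map (x ∷_) (subs r L) ++_) (go L)

-- The positive and the negative part of the iterated difference of digest
-- along A at base; r is fuel.

mob : ∀ {δ} → ℕ → El (F δ) → List ℕ → List ℕ → ℕ × ℕ
mob {δ} zero    φ base A       = digest δ φ base , 0
mob {δ} (suc r) φ base []      = digest δ φ base , 0
mob {δ} (suc r) φ base (a ∷ A) =
  let (p , n) = mob {δ} r φ (base ++ [ a ]) A ; (p′ , n′) = mob {δ} r φ base A in p + n′ , n + p′

mobP : ∀ δ r → PT {F δ `× list nat `× list nat} {nat `× nat} (λ (φ , base , A) → mob {δ} r φ base A)
mobP δ zero    = digestP δ ∘P (fstP ,P fstP ∘P sndP) ,P constP 0
mobP δ (suc r) = PT-ext (ifP (isNilP ∘P sndP ∘P sndP) (digestP δ ∘P (fstP ,P fstP ∘P sndP) ,P constP 0)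
  (addP (fstP ∘P with-a) (sndP ∘P without) ,P addP (sndP ∘P with-a) (fstP ∘P without))) λ where
    (φ , base , [])    → refl
    (φ , base , a ∷ A) → refl
  where
  with-a : PT {F δ `× list nat `× list nat} {nat `× nat} (λ (φ , base , A) → mob {δ} r φ (base ++ [ hd 0 A ]) (tl A))
  with-a = mobP δ r ∘P (fstP ,P appendP (fstP ∘P sndP)
    (consP (hdP 0 ∘P sndP ∘P sndP) (constP [])) ,P tlP ∘P sndP ∘P sndP)
  without : PT {F δ `× list nat `× list nat} {nat `× nat} (λ (φ , base , A) → mob {δ} r φ base (tl A))
  without = mobP δ r ∘P (fstP ,P fstP ∘P sndP ,P tlP ∘P sndP ∘P sndP)

encItem : ℕ → ℕ × ℕ × ℕ → List Bool
encItem k (z , u , v) = unary z ++ map (λ i → (i ≡ᵇ u) ∨ (i ≡ᵇ v)) (upTo k)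

-- From vector sums to packings: the construction

-- Multiple-choice vector sums: in each row e < E choose one option s < N e
-- so that the vectors a e s add up to τ in each of the Q coordinates.

record Instance : Set where
  field
    E Q : ℕ
    N   : ℕ → ℕ
    a   : ℕ → ℕ → ℕ → ℕ
    τ   : ℕ → ℕ

-- The bins form a grid of E rows and suc Q columns, where row e is a cycle.
-- Going along the cycle, the item handed from column q to column q + 1 tells
-- the chosen option s, in units of M, and the part of the vector a e s from
-- coordinate suc q on.  The rest is added to the unit items going down column q.
-- Column Q takes up the slack by which the sum of the vector falls short of U.
-- Bin V + i receives exactly the filler item of size Cap, which forces the other
-- filler item into bin i.

module Grid (I : Instance) where
  open Instance I

  pre : ℕ → ℕ → ℕ → ℕ
  pre e s q = ∑ q (a e s)

  -- `U` bounds the partial sums of every option, so that subtracting them from `U` is exact, and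
  -- `W` bounds the units that pass down a column. Sizes are read as digits: `M` exceeds a remainder
  -- of a vector plus the units carried, so these never spill over into the option `s`, and `L`
  -- exceeds all that lies below it, so that the multiple of `L` counts the items.
  U W M L V : ℕ
  U = suc (∑ E λ e → ∑ (N e) λ s → pre e s Q)
  W = E * U
  M = suc (U + (W + ∑ Q τ))
  L = M * (2 + ∑ E N)
  V = E * suc Q

  -- In the slack column, the rows together fall short of `E * U` by the sum of all coordinates of
  -- the chosen vectors, which is the sum of the targets.
  τ′ : ℕ → ℕ
  τ′ q = if q <ᵇ Q then τ q else W ∸ ∑ Q τ

  sz : ℕ → ℕ → ℕ → ℕ
  sz e q s = L + M * s + (U ∸ pre e s (suc q))

  -- If the items staying in a bin are counted as all items of their groups minus those that leave,
  -- `cost` collects the constants. In the last column `L` stands in for the leading digit of a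
  -- departing item, since return items are multiples of `M` only; in the last row `τ′ q` stands in
  -- for departing units.
  tot cost : ℕ → ℕ → ℕ
  tot e q  = if q <ᵇ Q then ∑ (N e) (sz e q) else N e * M
  cost e q = tot e q + (if q <ᵇ Q then 0 else L) + (if suc e <ᵇ E then W else τ′ q)

  -- Larger than every `cost`, so that the fillers `δ e q` are positive.
  Cap : ℕ
  Cap = suc (∑ E λ e → ∑ (suc Q) (cost e))

  δ : ℕ → ℕ → ℕ
  -- In column 0 the summand `L + U` replaces part of the item that other columns receive from the
  -- left; the missing `M * s` comes from the return items.
  δ e q = (Cap + (if isZero q then L + U else 0)) ∸ cost e q

  bin : ℕ → ℕ → ℕ
  bin e q = e * suc Q + q

  Item : Set
  Item = ℕ × ℕ × ℕ

  choiceItems returnItems sumItems fillItems : ℕ → ℕ → List Item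
  choiceItems e q = map (λ s → sz e q s , bin e q , bin e (suc q)) (upTo (N e))
  returnItems e _ = map (λ _ → M , bin e Q , bin e 0) (upTo (N e))
  sumItems    e q = map (λ _ → 1 , bin e q , bin (suc e) q) (upTo W)
  fillItems   e q = (δ e q , bin e q , V + bin e q) ∷ (Cap , bin e q , V + bin e q) ∷ []

  grid : ℕ → ℕ → (ℕ → ℕ → List Item) → List Item
  grid m n f = concat (map (λ e → concat (map (f e) (upTo n))) (upTo m))

  items : List Item
  items = grid E Q choiceItems ++ grid E 1 returnItems ++ grid (E ∸ 1) (suc Q) sumItems ++ grid E (suc Q) fillItems

  bins : ℕ
  bins = V + V

  consistent : Bool
  consistent = sum (map proj₁ items) ≡ᵇ bins * Cap

  -- The test spares a proof that the items of an instance have total size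
  -- bins * Cap: if they do not, then no assignment gives all bins load Cap.
  -- The negative instance returned in this case has 0 bins.

  output : List Bool × ℕ
  output = if consistent then (concat (map (encItem bins) items) , bins) else ([] , 0)

unaryP : {n : El Γ → ℕ} → PT {Γ} {nat} n → PT {Γ} {list bool} (λ γ → unary (n γ))
unaryP N = appendP (replicateP N (constP true)) (consP (constP false) (constP []))

encItemP : PT {nat `× nat `× nat `× nat} {list bool} (λ (k , it) → encItem k it)
encItemP = appendP (unaryP (fstP ∘P sndP))
  (mapP (orP (eqP sndP (fstP ∘P sndP ∘P sndP ∘P fstP)) (eqP sndP (sndP ∘P sndP ∘P sndP ∘P fstP))) (upToP fstP))

module GridP {Γ : Ty} (I : El Γ → Instance)
  (EP : PT {Γ} {nat} (λ γ → Instance.E (I γ)))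
  (QP : PT {Γ} {nat} (λ γ → Instance.Q (I γ)))
  (NP : PT {Γ `× nat} {nat} (λ (γ , e) → Instance.N (I γ) e))
  (aP : PT {Γ `× nat `× nat `× nat} {nat} (λ (γ , e , s , q) → Instance.a (I γ) e s q))
  (τP : PT {Γ `× nat} {nat} (λ (γ , q) → Instance.τ (I γ) q)) where

  module G (γ : El Γ) = Grid (I γ)

  preP : PT {Γ `× nat `× nat `× nat} {nat} (λ (γ , e , s , q) → G.pre γ e s q)
  preP = ∑P (aP ∘P (fstP ∘P fstP ,P fstP ∘P sndP ∘P fstP ,P fstP ∘P sndP ∘P sndP ∘P fstP ,P sndP))
    (sndP ∘P sndP ∘P sndP)

  UP : PT {Γ} {nat} (λ γ → G.U γ)
  UP = sucP ∘P ∑P (∑P (preP ∘P (fstP ∘P fstP ,P sndP ∘P fstP ,P sndP ,P QP ∘P fstP ∘P fstP)) NP) EP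

  WP : PT {Γ} {nat} (λ γ → G.W γ)
  WP = mulP EP UP

  MP : PT {Γ} {nat} (λ γ → G.M γ)
  MP = sucP ∘P addP UP (addP WP (∑P τP QP))

  LP : PT {Γ} {nat} (λ γ → G.L γ)
  LP = mulP MP (addP (constP 2) (∑P NP EP))

  VP : PT {Γ} {nat} (λ γ → G.V γ)
  VP = mulP EP (sucP ∘P QP)

  τ′P : PT {Γ `× nat} {nat} (λ (γ , q) → G.τ′ γ q)
  τ′P = ifP (ltP sndP (QP ∘P fstP)) τP (monusP (WP ∘P fstP) (∑P τP QP ∘P fstP))

  szP : PT {Γ `× nat `× nat `× nat} {nat} (λ (γ , e , q , s) → G.sz γ e q s)
  szP = addP (addP (LP ∘P fstP) (mulP (MP ∘P fstP) (sndP ∘P sndP ∘P sndP)))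
    (monusP (UP ∘P fstP) (preP ∘P (fstP ,P fstP ∘P sndP ,P sndP ∘P sndP ∘P sndP ,P sucP ∘P fstP ∘P sndP ∘P sndP)))

  private
    g : PT {Γ `× nat `× nat} {Γ} proj₁
    g = fstP
    e : PT {Γ `× nat `× nat} {nat} (λ (_ , e , _) → e)
    e = fstP ∘P sndP
    q : PT {Γ `× nat `× nat} {nat} (λ (_ , _ , q) → q)
    q = sndP ∘P sndP

  totP : PT {Γ `× nat `× nat} {nat} (λ (γ , e , q) → G.tot γ e q)
  totP = ifP (ltP q (QP ∘P g)) (∑P (szP ∘P (g ∘P fstP ,P e ∘P fstP ,P q ∘P fstP ,P sndP)) (NP ∘P (g ,P e)))
    (mulP (NP ∘P (g ,P e)) (MP ∘P g))

  costP : PT {Γ `× nat `× nat} {nat} (λ (γ , e , q) → G.cost γ e q)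
  costP = addP (addP totP (ifP (ltP q (QP ∘P g)) (constP 0) (LP ∘P g)))
    (ifP (ltP (sucP ∘P e) (EP ∘P g)) (WP ∘P g) (τ′P ∘P (g ,P q)))

  CapP : PT {Γ} {nat} (λ γ → G.Cap γ)
  CapP = sucP ∘P ∑P (∑P (costP ∘P (fstP ∘P fstP ,P sndP ∘P fstP ,P sndP)) (sucP ∘P QP ∘P fstP)) EP

  δP : PT {Γ `× nat `× nat} {nat} (λ (γ , e , q) → G.δ γ e q)
  δP = monusP (addP (CapP ∘P g) (ifP (isZeroP ∘P q) (addP (LP ∘P g) (UP ∘P g)) (constP 0))) costP

  binP : {Δ : Ty} {y : El Δ → El Γ} {m n : El Δ → ℕ} → PT y → PT {Δ} {nat} m → PT {Δ} {nat} n →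
         PT {Δ} {nat} (λ γ → G.bin (y γ) (m γ) (n γ))
  binP Y M N = addP (mulP M (sucP ∘P QP ∘P Y)) N

  Item : Ty
  Item = nat `× nat `× nat

  gridP : {m n : El Γ → ℕ} {f : El Γ → ℕ → ℕ → List (El Item)} → PT {Γ} {nat} m → PT {Γ} {nat} n →
          PT {Γ `× nat `× nat} {list Item} (λ (γ , e , q) → f γ e q) →
          PT {Γ} {list Item} (λ γ → G.grid γ (m γ) (n γ) (f γ))
  gridP M N P = concatP (mapP (concatP
    (mapP (P ∘P (fstP ∘P fstP ,P sndP ∘P fstP ,P sndP)) (upToP (N ∘P fstP)))) (upToP M))

  itemsP : PT {Γ} {list Item} (λ γ → G.items γ)
  itemsP = appendP (gridP EP QP (mapP (szP ∘P (g ∘P fstP ,P e ∘P fstP ,P q ∘P fstP ,P sndP)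
                                       ,P binP g e q ∘P fstP ,P binP g e (sucP ∘P q) ∘P fstP) (upToP (NP ∘P (g ,P e)))))
    (appendP (gridP EP (constP 1) (mapP ((MP ∘P g ,P binP g e (QP ∘P g) ,P binP g e (constP 0)) ∘P fstP)
      (upToP (NP ∘P (g ,P e)))))
    (appendP (gridP (monusP EP (constP 1)) (sucP ∘P QP)
                    (mapP ((constP 1 ,P binP g e q ,P binP g (sucP ∘P e) q) ∘P fstP) (upToP (WP ∘P g))))
      (gridP EP (sucP ∘P QP) (consP (δP ,P binP g e q ,P addP (VP ∘P g) (binP g e q))
        (consP (CapP ∘P g ,P binP g e q ,P addP (VP ∘P g) (binP g e q)) (constP []))))))

  binsP : PT {Γ} {nat} (λ γ → G.bins γ)
  binsP = addP VP VP

  consistentP : PT {Γ} {bool} (λ γ → G.consistent γ)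
  consistentP = eqP (sumP (mapP (fstP ∘P sndP) itemsP)) (mulP binsP CapP)

  outputP : PT {Γ} {list bool `× nat} (λ γ → G.output γ)
  outputP = ifP consistentP
    (concatP (mapP (encItemP ∘P (binsP ∘P fstP ,P sndP)) itemsP) ,P binsP)
    (constP {B = list bool `× nat} ([] , 0))

-- Parsing circuits

-- A program whose bound does not mention X runs in constant time, so it
-- increases heights by at most a constant.

IsConst : Poly → Set
IsConst X       = ⊥
IsConst (K _)   = ⊤
IsConst (P ⊕ Q) = IsConst P × IsConst Q
IsConst (P ⊗ Q) = IsConst P × IsConst Q
IsConst (P ⊚ Q) = IsConst P

const-bound : ∀ P → IsConst P → ∀ m n → ⟦ P ⟧ m ≡ ⟦ P ⟧ n
const-bound (K _)   c m n = refl
const-bound (P ⊕ Q) (c , d) m n = cong₂ _+_ (const-bound P c m n) (const-bound Q d m n)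
const-bound (P ⊗ Q) (c , d) m n = cong₂ _*_ (const-bound P c m n) (const-bound Q d m n)
const-bound (P ⊚ Q) c m n = const-bound P c _ _

-- Comparison with a literal takes constant time, whereas the bound of `eqP` depends on its
-- arguments. A parser step has to run in constant time.
eqLit : ℕ → ℕ → Bool
eqLit zero    n = isZero n
eqLit (suc c) n = if isZero n then false else eqLit c (n ∸ 1)

eqLitP : ∀ c → PT {nat} {bool} (eqLit c)
eqLitP zero    = isZeroP
eqLitP (suc c) = ifP isZeroP (constP false) (eqLitP c ∘P PT-ext predP λ { zero → refl ; (suc n) → refl })

-- The states of the parser: mode, counter, number of inputs, tag of the
-- current gate, its arguments and the gates read so far (both newest first).

State : Ty
State = nat `× nat `× nat `× nat `× list nat `× list RGate

-- Modes: 0 counts the inputs; 1 expects a gate or the output; 2 tells a negation from other gates;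
-- 3 reads the argument of a negation; 4 tells conjunction from disjunction; 5 expects a further
-- argument or the end of the gate; 6 reads an argument; 7 reads the output; 8 is final.
parseStep : Bool → El State → El State
parseStep b (m , c , n , t , is , gs) =
  if eqLit 0 m then (if b then (0 , suc c , n , t , is , gs) else (1 , 0 , c , t , is , gs)) else
  if eqLit 1 m then (if b then (2 , 0 , n , t , is , gs) else (7 , 0 , n , t , is , gs)) else
  if eqLit 2 m then (if b then (4 , 0 , n , t , is , gs) else (3 , 0 , n , t , is , gs)) else
  if eqLit 3 m then (if b then (3 , suc c , n , t , is , gs) else (1 , 0 , n , t , is , (1 , c ∷ []) ∷ gs)) else
  if eqLit 4 m then (if b then (5 , 0 , n , 3 , [] , gs) else (5 , 0 , n , 2 , [] , gs)) else
  if eqLit 5 m then (if b then (6 , 0 , n , t , is , gs) else (1 , 0 , n , t , [] , (t , is) ∷ gs)) else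
  if eqLit 6 m then (if b then (6 , suc c , n , t , is , gs) else (5 , 0 , n , t , c ∷ is , gs)) else
  if eqLit 7 m then (if b then (7 , suc c , n , t , is , gs) else (8 , c , n , t , is , gs)) else
  (8 , c , n , t , is , gs)

parseStepP : PT {bool `× State} {State} (λ (b , s) → parseStep b s)
parseStepP =
  on 0 (ifP b (k 0 ,P sucP ∘P c ,P n ,P t ,P is ,P gs) (k 1 ,P k 0 ,P c ,P t ,P is ,P gs))
  (on 1 (ifP b (k 2 ,P k 0 ,P n ,P t ,P is ,P gs) (k 7 ,P k 0 ,P n ,P t ,P is ,P gs))
  (on 2 (ifP b (k 4 ,P k 0 ,P n ,P t ,P is ,P gs) (k 3 ,P k 0 ,P n ,P t ,P is ,P gs))
  (on 3 (ifP b (k 3 ,P sucP ∘P c ,P n ,P t ,P is ,P gs)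
               (k 1 ,P k 0 ,P n ,P t ,P is ,P consP (k 1 ,P consP c (constP {B = list nat} [])) gs))
  (on 4 (ifP b (k 5 ,P k 0 ,P n ,P k 3 ,P constP {B = list nat} [] ,P gs)
    (k 5 ,P k 0 ,P n ,P k 2 ,P constP {B = list nat} [] ,P gs))
  (on 5 (ifP b (k 6 ,P k 0 ,P n ,P t ,P is ,P gs)
    (k 1 ,P k 0 ,P n ,P t ,P constP {B = list nat} [] ,P consP (t ,P is) gs))
  (on 6 (ifP b (k 6 ,P sucP ∘P c ,P n ,P t ,P is ,P gs) (k 5 ,P k 0 ,P n ,P t ,P consP c is ,P gs))
  (on 7 (ifP b (k 7 ,P sucP ∘P c ,P n ,P t ,P is ,P gs) (k 8 ,P c ,P n ,P t ,P is ,P gs))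
  (k 8 ,P c ,P n ,P t ,P is ,P gs))))))))
  where
  Arg = bool `× State
  k : ∀ i → PT {Arg} {nat} (λ _ → i)
  k i = constP i
  b : PT {Arg} {bool} _
  b = fstP
  m : PT {Arg} {nat} _
  m = fstP ∘P sndP
  c : PT {Arg} {nat} _
  c = fstP ∘P sndP ∘P sndP
  n : PT {Arg} {nat} _
  n = fstP ∘P sndP ∘P sndP ∘P sndP
  t : PT {Arg} {nat} _
  t = fstP ∘P sndP ∘P sndP ∘P sndP ∘P sndP
  is : PT {Arg} {list nat} _
  is = fstP ∘P sndP ∘P sndP ∘P sndP ∘P sndP ∘P sndP
  gs : PT {Arg} {list RGate} _
  gs = sndP ∘P sndP ∘P sndP ∘P sndP ∘P sndP ∘P sndP
  on : ∀ i {f g : El Arg → El State} → PT f → PT g → PT {Arg} {State}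
    (λ a → if eqLit i (proj₁ (proj₂ a)) then f a else g a)
  on i P Q = ifP (eqLitP i ∘P m) P Q

start : El State
start = 0 , 0 , 0 , 0 , [] , []

result : El State → El RCircuit
result (_ , c , n , _ , _ , gs) = n , map (λ (t , is) → t , reverse is) gs , c

parse : List Bool → El RCircuit
parse x = result (foldl (λ s b → parseStep b s) start x)

parseP : PT {list bool} {RCircuit} parse
parseP = resultP ∘P run
  where
  -- The bound of a constant-time step at 0 is its bound at every state, which makes the growth per
  -- step independent of the accumulator, as the loop requires.
  k₀ : ℕ
  k₀ = ⟦ bound parseStepP ⟧ 0
  growth-step : ∀ (γ : List Bool) b s → ht (enc State (parseStep b s)) ≤
                ht (enc State s) + ⟦ K k₀ ⊕ (K 1 ⊕ X) ⟧ (ht (enc (list bool) γ) + ht (bitTree b))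
  growth-step γ b s = begin
    ht (enc State (parseStep b s))                           ≤⟨ growth parseStepP (b , s) ⟩
    hs,b + ⟦ bound parseStepP ⟧ hs,b                         ≤⟨ +-mono-≤
      (ht-∙ (bitTree b) (enc State s)) (≤-reflexive (const-bound (bound parseStepP) _ hs,b 0)) ⟩
    1 + (hb + hs) + k₀                                  ≡⟨ lemma hs hb k₀ ⟩
    hs + (k₀ + (1 + hb))                                ≤⟨ +-monoʳ-≤ hs
      (+-monoʳ-≤ k₀ (s≤s (m≤n+m hb (ht (enc (list bool) γ))))) ⟩
    hs + (k₀ + (1 + (ht (enc (list bool) γ) + hb)))     ∎
    where
    open ≤-Reasoning
    hs = ht (enc State s)
    hb = ht (bitTree b)
    hs,b = ht (bitTree b ∙ enc State s)
    lemma : ∀ a b c → 1 + (b + a) + c ≡ a + (c + (1 + b))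
    lemma = solve-∀
  run : PT {list bool} {State} (foldl (λ s b → parseStep b s) start)
  run = Fold.foldlP {Γ = list bool} {A = bool} {S = State} {f = λ (_ , b , s) → parseStep b s} (parseStepP ∘P sndP)
        (K k₀ ⊕ (K 1 ⊕ X)) growth-step idP (constP {B = State} start)
  resultP : PT {State} {RCircuit} result
  resultP = fstP ∘P sndP ∘P sndP ,P
    mapP (fstP ∘P sndP ,P reverseP ∘P sndP ∘P sndP) (sndP ∘P sndP ∘P sndP ∘P sndP ∘P sndP) ,P
    fstP ∘P sndP

-- From formulas to vector sums: the construction

module Reduction (d : ℕ) where

  -- Differences of order above `2 ^ d` vanish, so lengths up to `2 ^ d` must be covered. The 3 puts
  -- the pairs of indices among the rows, which forces the chosen inputs to be increasing.
  r : ℕ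
  r = 3 + 2 ^ d

  Env : Ty
  Env = F d `× nat `× nat

  rows : ℕ → List (List ℕ)
  rows k = subs r (upTo k)

  choices : ℕ → List ℕ → List (List ℕ)
  choices n I = keep (λ T → length T ≡ᵇ length I) (subs r (upTo n))

  row : ℕ → ℕ → List ℕ
  row k e = nth [] (rows k) e

  coords : ℕ → List (ℕ × ℕ × ℕ)
  coords k = concat (map (λ e → map (λ j → e , j , nth 0 (row k e) j) (upTo (length (row k e))))
    (upTo (length (rows k))))

  möbius : El (F d) → List ℕ → ℕ × ℕ
  möbius φ T = mob {d} r φ [] T

  -- The sum of all negative parts dominates each of them, so subtracting one from it never
  -- truncates.
  offset : El (F d) → ℕ → ℕ
  offset φ n = sum (map (λ T → proj₂ (möbius φ T)) (subs r (upTo n)))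

  -- The row that chooses the digest `D` contributes `length (table d φ) ∸ D`. The Möbius weights of
  -- the other rows add up to `D`, and each of these rows contributes `offset φ n` besides.
  target : El (F d) → ℕ → ℕ → ℕ
  target φ n k = length (rows k) * offset φ n + length (table d φ)

  -- Rows e < k choose an input v e < n each, row k chooses the digest of the
  -- assignment v, and row suc k + e chooses the restriction of v to row k e.
  -- The coordinate (e , j , i) says that v i is the j-th element of the list
  -- chosen for row k e, and the last coordinate is Möbius inversion.

  pick : ℕ → ℕ → ℕ → ℕ → List ℕ
  pick n k e s = nth [] (choices n (row k e)) s

  consWeight : ℕ → ℕ → ℕ × ℕ × ℕ → ℕ → ℕ → ℕ
  consWeight n k (e₀ , j , i) e s =
    -- The row of index `i` contributes the complement of its input, so the coordinate adds up to
    -- `n` exactly if the entry compared with it is that same input.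
    if e <ᵇ k then (if e ≡ᵇ i then n ∸ s else 0)
    else if e ≡ᵇ k then 0
    else (if e ∸ suc k ≡ᵇ e₀ then nth 0 (pick n k (e ∸ suc k) s) j else 0)

  sumWeight : El Env → ℕ → ℕ → ℕ
  sumWeight (φ , n , k) e s =
    if e <ᵇ k then 0
    -- A digest whose table entry is false exceeds the target on its own and so cannot be chosen.
    else if e ≡ᵇ k then (if nth false (table d φ) s then length (table d φ) ∸ s else suc (target φ n k))
    else (let (p , m) = möbius φ (pick n k (e ∸ suc k) s) in p + (offset φ n ∸ m))

  inst : El Env → Instance
  inst (φ , n , k) = record
    { E = k + suc (length (rows k))
    ; Q = suc (length (coords k))
    ; N = λ e → if e <ᵇ k then n else if e ≡ᵇ k then length (table d φ) else length (choices n (row k (e ∸ suc k)))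
    ; a = λ e s q → if q <ᵇ length (coords k) then consWeight n k (nth (0 , 0 , 0) (coords k) q) e s
                    else sumWeight (φ , n , k) e s
    ; τ = λ q → if q <ᵇ length (coords k) then n else target φ n k
    }

  rowsP : {k : El Γ → ℕ} → PT {Γ} {nat} k → PT {Γ} {list (list nat)} (λ γ → rows (k γ))
  rowsP N = subsP r ∘P upToP N

  rowP : {k e : El Γ → ℕ} → PT {Γ} {nat} k → PT {Γ} {nat} e → PT {Γ} {list nat} (λ γ → row (k γ) (e γ))
  rowP N E = nthP [] (rowsP N) E

  choicesP : {n : El Γ → ℕ} {I : El Γ → List ℕ} → PT {Γ} {nat} n → PT {Γ} {list nat} I →
             PT {Γ} {list (list nat)} (λ γ → choices (n γ) (I γ))
  choicesP N I = keepP (eqP (lengthP sndP) (lengthP (I ∘P fstP))) (subsP r ∘P upToP N)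

  Triple : Ty
  Triple = nat `× nat `× nat

  coordsP : {k : El Γ → ℕ} → PT {Γ} {nat} k → PT {Γ} {list Triple} (λ γ → coords (k γ))
  coordsP N = concatP (mapP (mapP (sndP ∘P fstP ,P sndP ,P nthP 0 (rowP (N ∘P fstP ∘P fstP) (sndP ∘P fstP)) sndP)
                                  (upToP (lengthP (rowP (N ∘P fstP) sndP))))
                            (upToP (lengthP (rowsP N))))

  möbiusP : PT {F d `× list nat} {nat `× nat} (λ (φ , T) → möbius φ T)
  möbiusP = mobP d r ∘P (fstP ,P constP {B = list nat} [] ,P sndP)

  φP : PT {Env} {F d} proj₁
  φP = fstP

  nP kP : PT {Env} {nat} _
  nP = fstP ∘P sndP
  kP = sndP ∘P sndP

  offsetP : PT {Env} {nat} (λ (φ , n , k) → offset φ n)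
  offsetP = sumP (mapP (sndP ∘P möbiusP ∘P (φP ∘P fstP ,P sndP)) (subsP r ∘P upToP nP))

  betaP : PT {Env} {nat} (λ (φ , n , k) → length (table d φ))
  betaP = lengthP (tableP d ∘P φP)

  targetP : PT {Env} {nat} (λ (φ , n , k) → target φ n k)
  targetP = addP (mulP (lengthP (rowsP kP)) offsetP) betaP

  pickP : {n k e s : El Γ → ℕ} → PT {Γ} {nat} n → PT {Γ} {nat} k → PT {Γ} {nat} e → PT {Γ} {nat} s →
          PT {Γ} {list nat} (λ γ → pick (n γ) (k γ) (e γ) (s γ))
  pickP N N′ E S = nthP [] (choicesP N (rowP N′ E)) S

  Arg : Ty
  Arg = Env `× nat `× nat `× nat

  weightP : PT {Arg} {nat} (λ (γ , e , s , q) → Instance.a (inst γ) e s q)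
  weightP = ifP (ltP q (lengthP (coordsP k)))
      (ifP (ltP e k) (ifP (eqP e i) (monusP n s) (constP 0))
        (ifP (eqP e k) (constP 0) (ifP (eqP e′ (fstP ∘P co))
          (nthP 0 (pickP n k e′ s) (fstP ∘P sndP ∘P co)) (constP 0))))
      (ifP (ltP e k) (constP 0)
        (ifP (eqP e k) (ifP (nthP false (tableP d ∘P φP ∘P fstP) s) (monusP (betaP ∘P fstP) s)
          (sucP ∘P targetP ∘P fstP))
          (addP (fstP ∘P möb) (monusP (offsetP ∘P fstP) (sndP ∘P möb)))))
    where
    n : PT {Arg} {nat} (λ ((φ , n , k) , e , s , q) → n)
    n = nP ∘P fstP
    k : PT {Arg} {nat} (λ ((φ , n , k) , e , s , q) → k)
    k = kP ∘P fstP
    e : PT {Arg} {nat} (λ ((φ , n , k) , e , s , q) → e)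
    e = fstP ∘P sndP
    s : PT {Arg} {nat} (λ ((φ , n , k) , e , s , q) → s)
    s = fstP ∘P sndP ∘P sndP
    q : PT {Arg} {nat} (λ ((φ , n , k) , e , s , q) → q)
    q = sndP ∘P sndP ∘P sndP
    e′ : PT {Arg} {nat} (λ ((φ , n , k) , e , s , q) → e ∸ suc k)
    e′ = monusP e (sucP ∘P k)
    co : PT {Arg} {Triple} (λ ((φ , n , k) , e , s , q) → nth (0 , 0 , 0) (coords k) q)
    co = nthP (0 , 0 , 0) (coordsP k) q
    i : PT {Arg} {nat} (λ ((φ , n , k) , e , s , q) → proj₂ (proj₂ (nth (0 , 0 , 0) (coords k) q)))
    i = sndP ∘P sndP ∘P co
    möb : PT {Arg} {nat `× nat} (λ ((φ , n , k) , e , s , q) → möbius φ (pick n k (e ∸ suc k) s))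
    möb = möbiusP ∘P (φP ∘P fstP ,P pickP n k e′ s)

  rowCountP : {k : El Γ → ℕ} → PT {Γ} {nat} k → PT {Γ} {nat} (λ γ → k γ + suc (length (rows (k γ))))
  rowCountP N = addP N (sucP ∘P lengthP (rowsP N))

  coordCountP : {k : El Γ → ℕ} → PT {Γ} {nat} k → PT {Γ} {nat} (λ γ → suc (length (coords (k γ))))
  coordCountP N = sucP ∘P lengthP (coordsP N)

  optionsP : PT {Env `× nat} {nat} (λ (γ , e) → Instance.N (inst γ) e)
  optionsP = ifP (ltP sndP (kP ∘P fstP)) (nP ∘P fstP)
    (ifP (eqP sndP (kP ∘P fstP)) (betaP ∘P fstP)
      (lengthP (choicesP (nP ∘P fstP) (rowP (kP ∘P fstP) (monusP sndP (sucP ∘P kP ∘P fstP))))))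

  goalP : PT {Env `× nat} {nat} (λ (γ , q) → Instance.τ (inst γ) q)
  goalP = ifP (ltP sndP (lengthP (coordsP (kP ∘P fstP)))) (nP ∘P fstP) (targetP ∘P fstP)

  module P = GridP inst (rowCountP kP) (coordCountP kP) optionsP weightP goalP

  -- Rows and coordinates of the instance are counted by functions of `k` alone, without the formula
  -- or `n`. This bounds the new parameter.
  numBins : ℕ → ℕ
  numBins k = V + V
    where V = (k + suc (length (rows k))) * suc (suc (length (coords k)))

  numBinsP : PT {nat} {nat} numBins
  numBinsP = addP VP VP
    where VP = mulP (rowCountP idP) (sucP ∘P coordCountP idP)

-- Recognizing valid words

encIndices : List ℕ → List Bool
encIndices is = concat (map (λ i → true ∷ unary i) is) ++ [ false ]

encGate : El RGate → List Bool
encGate (t , is) = if t ≡ᵇ 1 then false ∷ unary (hd 0 is)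
  else if t ≡ᵇ 2 then true ∷ false ∷ encIndices is else true ∷ true ∷ encIndices is

encGates : List (El RGate) → List Bool
encGates = foldr (λ g s → s ++ true ∷ encGate g) []

encRaw : El RCircuit → List Bool
encRaw (n , gs , o) = unary n ++ encGates gs ++ false ∷ unary o

encGateP : PT {RGate} {list bool} encGate
encGateP = ifP (eqP fstP (constP 1)) (consP (constP false) (unaryP (hdP 0 ∘P sndP)))
  (ifP (eqP fstP (constP 2)) (consP (constP true) (consP (constP false) enc-is))
    (consP (constP true) (consP (constP true) enc-is)))
  where
  enc-is : PT {RGate} {list bool} (λ (t , is) → encIndices is)
  enc-is = appendP (concatP (mapP (consP (constP true) (unaryP sndP)) sndP)) (consP (constP false) (constP []))

concatRevP : {h : El A → List (El B)} → PT {A} {list B} h → PT {list A} {list B} (foldr (λ g s → s ++ h g) [])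
concatRevP {A = A} {B = B} {h} T = foldrP {Γ = list A} {A = A} {S = list B} {f = λ (_ , g , s) → s ++ h g}
  (appendP (sndP ∘P sndP) (T ∘P fstP ∘P sndP)) (X ⊕ bound T)
  (λ γ g s → ≤-trans (ht-++ s (h g)) (+-monoʳ-≤ (ht (enc (list B) s))
    (≤-trans (growth T g) (+-mono-≤ (m≤n+m (ht (enc A g)) (ht (enc (list A) γ)))
                                    (⟦⟧-mono (bound T) (m≤n+m (ht (enc A g)) (ht (enc (list A) γ))))))))
  idP (constP [])

encGatesP : PT {list RGate} {list bool} encGates
encGatesP = concatRevP (consP (constP true) encGateP)

encRawP : PT {RCircuit} {list bool} encRaw
encRawP = appendP (unaryP fstP) (appendP (encGatesP ∘P fstP ∘P sndP) (consP (constP false) (unaryP (sndP ∘P sndP))))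

eqBits : List Bool → List Bool → Bool
eqBits []          []          = true
eqBits []          (_ ∷ _)     = false
eqBits (_ ∷ _)     []          = false
eqBits (false ∷ x) (false ∷ y) = eqBits x y
eqBits (false ∷ x) (true ∷ y)  = false
eqBits (true ∷ x)  (false ∷ y) = false
eqBits (true ∷ x)  (true ∷ y)  = eqBits x y

eqBitsP : PT {list bool `× list bool} {bool} (λ (x , y) → eqBits x y)
eqBitsP = PT-ext (resultP ∘P loop) (λ (x , y) → go true x y)
  where
  St : Ty
  St = bool `× list bool
  upd : El St → Bool → El St
  upd (ok , y) b = (ok ∧ (if isNil y then false else if b then hd false y else not (hd false y))) , tl y
  updP : PT {(list bool `× list bool) `× bool `× St} {St} (λ (_ , b , s) → upd s b)
  updP = andP (fstP ∘P sndP ∘P sndP)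
    (ifP (isNilP ∘P y) (constP false) (ifP (fstP ∘P sndP) (hdP false ∘P y) (notP (hdP false ∘P y))))
         ,P tlP ∘P y
    where
    y : PT {(list bool `× list bool) `× bool `× St} {list bool} (λ (_ , _ , _ , y) → y)
    y = sndP ∘P sndP ∘P sndP
  grow : ∀ (γ : List Bool × List Bool) b s → ht (enc St (upd s b)) ≤ ht (enc St s) + ⟦ K 1 ⟧
    (ht (enc (list bool `× list bool) γ) + ht (bitTree b))
  grow γ b (ok , y) = ≤-trans (s≤s
    (⊔-lub (≤-trans (ht-bool (ok ∧ _)) (m≤n+m 1 _))
      (≤-trans (ht-tl y) (≤-trans (m≤n⊔m (ht (bitTree ok)) (ht (enc (list bool) y))) (m≤m+n _ 1))))) ≤-refl
    where
    ht-tl : ∀ y → ht (enc (list bool) (tl y)) ≤ ht (enc (list bool) y)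
    ht-tl []      = z≤n
    ht-tl (b ∷ y) = ht-tail (bitTree b) _
  loop : PT {list bool `× list bool} {St} (λ (x , y) → foldl upd (true , y) x)
  loop = Fold.foldlP {A = bool} {S = St} {f = λ (_ , b , s) → upd s b} updP (K 1) grow fstP (constP true ,P sndP)
  resultP : PT {St} {bool} (λ (ok , y) → ok ∧ isNil y)
  resultP = andP fstP (isNilP ∘P sndP)
  go : ∀ ok x y → (let (ok , y) = foldl upd (ok , y) x in ok ∧ isNil y) ≡ ok ∧ eqBits x y
  stuck : ∀ x y → (let (ok , y) = foldl upd (false , y) x in ok ∧ isNil y) ≡ false
  stuck []      y = refl
  stuck (x ∷ xs) y = stuck xs (tl y)
  go false x y = stuck x y
  go true []          []          = refl
  go true []          (_ ∷ _)     = refl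
  go true (_ ∷ x)     []          = stuck x []
  go true (false ∷ x) (false ∷ y) = go true x y
  go true (false ∷ x) (true ∷ y)  = stuck x y
  go true (true ∷ x)  (false ∷ y) = stuck x y
  go true (true ∷ x)  (true ∷ y)  = go true x y

gateOK : ℕ → El RGate → Bool
gateOK w (t , is) = (if t ≡ᵇ 1 then length is ≡ᵇ 1 else ((t ≡ᵇ 2) ∨ (t ≡ᵇ 3))) ∧ all (_<ᵇ w) is

-- A nonempty suffix is a gate followed by the earlier gates, so `length (tl s) + n` is the number
-- of nodes to which the gate may refer.
scoped : ℕ → List (El RGate) → Bool
scoped n gs = all (λ s → isNil s ∨ gateOK (length (tl s) + n) (hd (0 , []) s)) (suffixes gs)

scopedP : PT {RCircuit} {bool} (λ (n , gs , o) → scoped n gs)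
scopedP = allP (orP (isNilP ∘P sndP) (andP
    (ifP (eqP (fstP ∘P g) (constP 1)) (eqP (lengthP (sndP ∘P g)) (constP 1))
      (orP (eqP (fstP ∘P g) (constP 2)) (eqP (fstP ∘P g) (constP 3))))
    (allP (ltP sndP (addP (lengthP (tlP ∘P sndP)) (fstP ∘P fstP) ∘P fstP)) (sndP ∘P g))))
  (suffixesP (fstP ∘P sndP))
  where
  g : PT {RCircuit `× list RGate} {RGate} (λ (_ , s) → hd (0 , []) s)
  g = hdP (0 , []) ∘P sndP

-- Re-encoding the parsed circuit and comparing the result with the word rejects all malformed
-- words, whatever the parser makes of them.
valid : ℕ → El (list bool `× RCircuit) → Bool
valid d (x , n , gs , o) = eqBits x (encRaw (n , gs , o)) ∧ scoped n gs ∧ (o <ᵇ length gs + n) ∧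
  depthOK d gs o ∧ weft₁ d (unroll d gs o)

validP : ∀ d → PT {list bool `× RCircuit} {bool} (valid d)
validP d = andP (eqBitsP ∘P (fstP ,P encRawP ∘P sndP)) (andP (scopedP ∘P sndP)
  (andP (ltP o (addP (lengthP gs) (fstP ∘P sndP)))
    (andP (depthOKP d ∘P (gs ,P o)) (weft₁P d ∘P unrollP d ∘P (gs ,P o)))))
  where
  gs : PT {list bool `× RCircuit} {list RGate} (λ (x , n , gs , o) → gs)
  gs = fstP ∘P sndP ∘P sndP
  o : PT {list bool `× RCircuit} {nat} (λ (x , n , gs , o) → o)
  o = sndP ∘P sndP ∘P sndP

module _ (d : ℕ) where
  open Reduction d

  transform : List Bool × ℕ → List Bool × ℕ
  transform (x , k) = let (n , gs , o) = parse x in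
    if valid d (x , parse x) then Grid.output (inst (unroll d gs o , n , k)) else ([] , 0)

  transformP : PT {list bool `× nat} {list bool `× nat} transform
  transformP = ifP (validP d ∘P (fstP ,P raw))
    (P.outputP ∘P (unrollP d ∘P (fstP ∘P sndP ∘P raw ,P sndP ∘P sndP ∘P raw) ,P fstP ∘P raw ,P sndP))
    (constP {B = list bool `× nat} ([] , 0))
    where
    raw : PT {list bool `× nat} {RCircuit} (λ (x , k) → parse x)
    raw = parseP ∘P fstP

-- Composing an fpt reduction with a polynomial-time map

computable-∘ : {f : ℕ → ℕ} {h : ℕ × ℕ → ℕ} → Computable f → PT {nat `× nat} {nat} h → Computable (λ n → h (n , f n))
computable-∘ {f} (p , r) H = (cons# id# p ⨟ prog H) , λ n →
  let (s , d) = r n ; (t , e , _) = runs H (n , f n) in _ , ⨟⇓ (cons⇓ id⇓ d) e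

^-distribʳ-* : ∀ c m n → (m * n) ^ c ≡ m ^ c * n ^ c
^-distribʳ-* zero    m n = refl
^-distribʳ-* (suc c) m n = trans (cong (m * n *_) (^-distribʳ-* c m n)) ([m*n]*[o*p]≡[m*o]*[n*p] m n (m ^ c) (n ^ c))

ht-bits : ∀ x → ht (bitsTree x) ≤ suc (length x)
ht-bits []      = z≤n
ht-bits (b ∷ x) = s≤s (⊔-lub (≤-trans (ht-bool b) (s≤s z≤n)) (ht-bits x))

-- The cost `s` of the first run also bounds the height of its result, by `h₀ + s`, and there the
-- polynomial of the second run is evaluated. As `b` need not be monotone, the bound on the
-- parameter passes through a power that dominates `b`.
≤fpt-∘-PT : {A P Q : Problem} → A ≤fpt P → {h : List Bool × ℕ → List Bool × ℕ} →
  PT {list bool `× nat} {list bool `× nat} h →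
            {b : ℕ → ℕ} → PT {nat} {nat} b → (∀ x k → proj₂ (h (x , k)) ≤ b k) →
            (∀ x k → P x k ⇔ Q (proj₁ (h (x , k))) (proj₂ (h (x , k)))) → A ≤fpt Q
≤fpt-∘-PT {A} {P} {Q} R {h} H {b} Bd h≤b ok = record
  { word         = λ x k → proj₁ (h (word x k , param x k))
  ; param        = λ x k → proj₂ (h (word x k , param x k))
  ; correct      = λ x k → ⇔-trans (correct x k) (ok (word x k) (param x k))
  ; g            = λ k → (2 + g k) ^ cb
  ; g-computable = computable-∘ {h = λ (_ , m) → (2 + m) ^ cb} g-computable (powP cb ∘P addP (constP 2) sndP)
  ; param≤g      = λ x k → ≤-trans (h≤b _ _) (≤-trans (b≤pow _) (^-monoˡ-≤ cb (+-monoʳ-≤ 2 (param≤g x k))))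
  ; prog         = _≤fpt_.prog R ⨟ PT.prog H
  ; f            = λ k → (4 + (k + f k)) ^ c₁
  ; f-computable = computable-∘ {h = λ (k , m) → (4 + (k + m)) ^ c₁} f-computable
                     (powP c₁ ∘P addP (constP 4) (addP fstP sndP))
  ; c            = suc c * c₁
  ; runs         = λ x k →
      let (s , e , s≤) = _≤fpt_.runs R x k
          (t , e′ , t≤) = PT.runs H (word x k , param x k)
      in _ , ⨟⇓ e e′ , time x k s t s≤ (≤-trans t≤ (⟦⟧-mono (bound H) (ht-run e)))
  }
  where
  open _≤fpt_ R hiding (prog; runs)
  open ≤-Reasoning
  c₁ cb : ℕ
  -- Degree 1 pays for `suc s`, `degree (bound H)` for the second run, and one more degree for their
  -- sum.
  c₁  = suc (1 + degree (bound H))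
  cb = degree (X ⊕ bound Bd)
  b≤pow : ∀ k → b k ≤ (2 + k) ^ cb
  b≤pow k = ≤-trans (≤-reflexive (sym (ht-num (b k)))) (≤-trans (growth Bd k)
    (≤-trans (≤-reflexive (cong (λ z → z + ⟦ bound Bd ⟧ z) (ht-num k))) (⟦⟧≤pow (X ⊕ bound Bd) k)))
  time : ∀ x k s t → s ≤ f k * suc (length x) ^ c → t ≤ ⟦ bound H ⟧ (ht (bitsTree x ∙ numTree k) + s) →
         suc (s + t) ≤ (4 + (k + f k)) ^ c₁ * suc (length x) ^ (suc c * c₁)
  time x k s t s≤ t≤ = begin
    suc (s + t)                                        ≤⟨ +-mono-≤ s<S (≤-trans t≤ (⟦⟧≤pow (bound H) (h₀ + s))) ⟩
    (2 + (h₀ + s)) ^ 1 + (2 + (h₀ + s)) ^ degree (bound H)     ≤⟨ sum≤pow (h₀ + s) 1 (degree (bound H)) ⟩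
    (2 + (h₀ + s)) ^ c₁                                 ≤⟨ ^-monoˡ-≤ c₁ S≤ ⟩
    ((4 + (k + f k)) * (a ^ suc c)) ^ c₁                ≡⟨ ^-distribʳ-* c₁ (4 + (k + f k)) (a ^ suc c) ⟩
    (4 + (k + f k)) ^ c₁ * (a ^ suc c) ^ c₁              ≡⟨ cong ((4 + (k + f k)) ^ c₁ *_) (^-*-assoc a (suc c) c₁) ⟩
    (4 + (k + f k)) ^ c₁ * a ^ (suc c * c₁)              ∎
    where
    a h₀ : ℕ
    a  = suc (length x)
    h₀ = ht (bitsTree x ∙ numTree k)
    s<S : suc s ≤ (2 + (h₀ + s)) ^ 1
    s<S = ≤-trans (s≤s (≤-trans (m≤n+m s h₀) (n≤1+n _))) (≤-reflexive (sym (*-identityʳ _)))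
    1≤ : 1 ≤ a ^ suc c
    1≤ = m^n>0 a (suc c)
    a^c≤ : a ^ c ≤ a ^ suc c
    a^c≤ = m≤n*m (a ^ c) a
    a≤ : a ≤ a ^ suc c
    a≤ = ≤-trans (≤-reflexive (sym (*-identityʳ a))) (*-monoʳ-≤ a (m^n>0 a c))
    rearrange : ∀ a z k y → a * z + (3 * z + (k * z + y * z)) ≡ (a + 3 + (k + y)) * z
    rearrange = solve-∀
    -- Every summand is at most its own factor times `a ^ suc c`; this separates the parameter from
    -- the length of the word.
    S≤ : 2 + (h₀ + s) ≤ (4 + (k + f k)) * a ^ suc c
    S≤ = begin
      2 + (h₀ + s)
        ≤⟨ +-monoʳ-≤ 2 (+-mono-≤ (≤-trans (ht-∙ (bitsTree x) (numTree k))
          (s≤s (+-mono-≤ (ht-bits x) (≤-reflexive (ht-num k))))) s≤) ⟩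
      2 + (suc (a + k) + f k * a ^ c)
        ≡⟨ shuffle a k (f k * a ^ c) ⟩
      a + (3 + (k + f k * a ^ c))
        ≤⟨ +-mono-≤ a≤ (+-mono-≤ (*-monoʳ-≤ 3 1≤)
          (+-mono-≤ (≤-trans (≤-reflexive (sym (*-identityʳ k))) (*-monoʳ-≤ k 1≤)) (*-monoʳ-≤ (f k) a^c≤))) ⟩
      a ^ suc c + (3 * a ^ suc c + (k * a ^ suc c + f k * a ^ suc c))
        ≡⟨ cong (_+ (3 * a ^ suc c + (k * a ^ suc c + f k * a ^ suc c))) (sym (*-identityˡ (a ^ suc c))) ⟩
      1 * a ^ suc c + (3 * a ^ suc c + (k * a ^ suc c + f k * a ^ suc c))
        ≡⟨ rearrange 1 (a ^ suc c) k (f k) ⟩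
      (4 + (k + f k)) * a ^ suc c ∎
      where
      shuffle : ∀ a k y → 2 + (suc (a + k) + y) ≡ a + (3 + (k + y))
      shuffle = solve-∀

-- Finite sums

∑-cong : ∀ n {f g} → (∀ j → j < n → f j ≡ g j) → ∑ n f ≡ ∑ n g
∑-cong zero    eq = refl
∑-cong (suc n) eq = cong₂ _+_ (eq 0 (s≤s z≤n)) (∑-cong n λ j lt → eq (suc j) (s≤s lt))

∑-+ : ∀ n f g → ∑ n (λ j → f j + g j) ≡ ∑ n f + ∑ n g
∑-+ zero    f g = refl
∑-+ (suc n) f g = trans (cong (f 0 + g 0 +_) (∑-+ n (f ∘ suc) (g ∘ suc))) (lemma (f 0) (g 0) _ _)
  where
  lemma : ∀ a b c d → a + b + (c + d) ≡ a + c + (b + d)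
  lemma = solve-∀

∑-zero : ∀ n {f} → (∀ j → j < n → f j ≡ 0) → ∑ n f ≡ 0
∑-zero zero    eq = refl
∑-zero (suc n) eq = cong₂ _+_ (eq 0 (s≤s z≤n)) (∑-zero n λ j lt → eq (suc j) (s≤s lt))

∑-const : ∀ n c → ∑ n (λ _ → c) ≡ n * c
∑-const zero    c = refl
∑-const (suc n) c = cong (c +_) (∑-const n c)

∑-swap : ∀ m n (f : ℕ → ℕ → ℕ) → ∑ m (λ i → ∑ n (f i)) ≡ ∑ n (λ j → ∑ m (λ i → f i j))
∑-swap zero    n f = sym (∑-zero n λ _ _ → refl)
∑-swap (suc m) n f = trans (cong (∑ n (f 0) +_) (∑-swap m n (f ∘ suc)))
  (sym (∑-+ n (f 0) (λ j → ∑ m (λ i → f (suc i) j))))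

∑-last : ∀ n f → ∑ (suc n) f ≡ ∑ n f + f n
∑-last zero    f = +-comm (f 0) 0
∑-last (suc n) f = trans (cong (f 0 +_) (∑-last n (f ∘ suc))) (sym (+-assoc (f 0) _ _))

∑-split : ∀ m n f → ∑ (m + n) f ≡ ∑ m f + ∑ n (λ j → f (m + j))
∑-split zero    n f = refl
∑-split (suc m) n f = trans (cong (f 0 +_) (∑-split m n (f ∘ suc))) (sym (+-assoc (f 0) _ _))

term≤∑ : ∀ n f {j} → j < n → f j ≤ ∑ n f
term≤∑ (suc n) f {zero}  lt       = m≤m+n _ _
term≤∑ (suc n) f {suc j} (s≤s lt) = ≤-trans (term≤∑ n (f ∘ suc) lt) (m≤n+m _ (f 0))

∑-monoˡ : ∀ {m n} f → m ≤ n → ∑ m f ≤ ∑ n f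
∑-monoˡ f z≤n      = z≤n
∑-monoˡ f (s≤s le) = +-monoʳ-≤ (f 0) (∑-monoˡ (f ∘ suc) le)

∑-mono : ∀ n {f g} → (∀ j → j < n → f j ≤ g j) → ∑ n f ≤ ∑ n g
∑-mono zero    le = z≤n
∑-mono (suc n) le = +-mono-≤ (le 0 (s≤s z≤n)) (∑-mono n λ j lt → le (suc j) (s≤s lt))

<⇒<ᵇ≡ : ∀ {m n} → m < n → (m <ᵇ n) ≡ true
<⇒<ᵇ≡ {zero}  (s≤s le) = refl
<⇒<ᵇ≡ {suc m} (s≤s le) = <⇒<ᵇ≡ le

≥⇒<ᵇ≡ : ∀ {m n} → n ≤ m → (m <ᵇ n) ≡ false
≥⇒<ᵇ≡ {n = zero}          le       = refl
≥⇒<ᵇ≡ {suc m} {n = suc n} (s≤s le) = ≥⇒<ᵇ≡ le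

≡ᵇ-refl : ∀ n → (n ≡ᵇ n) ≡ true
≡ᵇ-refl zero    = refl
≡ᵇ-refl (suc n) = ≡ᵇ-refl n

≢⇒≡ᵇ : ∀ {m n} → m ≢ n → (m ≡ᵇ n) ≡ false
≢⇒≡ᵇ {zero}  {zero}  ne = contradiction refl ne
≢⇒≡ᵇ {zero}  {suc n} ne = refl
≢⇒≡ᵇ {suc m} {zero}  ne = refl
≢⇒≡ᵇ {suc m} {suc n} ne = ≢⇒≡ᵇ (ne ∘ cong suc)

put : ℕ → ℕ → ℕ → ℕ
put u z i = if u ≡ᵇ i then z else 0

put-≡ : ∀ u z → put u z u ≡ z
put-≡ u z rewrite ≡ᵇ-refl u = refl

put-≢ : ∀ {u i} z → u ≢ i → put u z i ≡ 0
put-≢ z ne rewrite ≢⇒≡ᵇ ne = refl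

∑-put : ∀ n (f : ℕ → ℕ) i → ∑ n (λ j → put j (f j) i) ≡ (if i <ᵇ n then f i else 0)
∑-put zero    f zero    = refl
∑-put zero    f (suc i) = refl
∑-put (suc n) f zero    = trans (cong (f 0 +_) (∑-zero n λ _ _ → refl)) (+-identityʳ _)
∑-put (suc n) f (suc i) = ∑-put n (f ∘ suc) i

∑-put< : ∀ n (f : ℕ → ℕ) {i} → i < n → ∑ n (λ j → put j (f j) i) ≡ f i
∑-put< n f {i} lt = trans (∑-put n f i) (cong (λ b → if b then f i else 0) (<⇒<ᵇ≡ lt))

∑-put-comm : ∀ n u (f : ℕ → ℕ) i → ∑ n (λ j → put u (f j) i) ≡ put u (∑ n f) i
∑-put-comm n u f i with u ≡ᵇ i
... | true  = refl
... | false = ∑-zero n λ _ _ → refl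

choose : {A : Set} {P : ℕ → A → Set} → A → ∀ n → (∀ j → j < n → Σ A (P j)) → Σ (ℕ → A) λ g → ∀ j → j < n → P j (g j)
choose a zero    f = (λ _ → a) , λ _ ()
choose a (suc n) f =
  let (g , p) = choose a n (λ j lt → f (suc j) (s≤s lt)) ; (a₀ , p₀) = f 0 (s≤s z≤n)
  in (λ { zero → a₀ ; (suc j) → g j }) , λ { zero _ → p₀ ; (suc j) (s≤s lt) → p j lt }

-- Splitting groups of items, and load vectors

-- The items of a group share their two allowed bins, so the loads see only two totals: `s` of the
-- items sent to the second bin and `t` of those left in the first.
data Split : (ℕ → ℕ) → ℕ → ℕ → ℕ → Set where
  none     : ∀ {f} → Split f 0 0 0
  select   : ∀ {f n s t} → Split (f ∘ suc) n s t → Split f (suc n) (f 0 + s) t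
  unselect : ∀ {f n s t} → Split (f ∘ suc) n s t → Split f (suc n) s (f 0 + t)

split-total : ∀ {f n s t} → Split f n s t → s + t ≡ ∑ n f
split-total none = refl
split-total {f} (select {s = s} {t} p) = trans (+-assoc (f 0) s t) (cong (f 0 +_) (split-total p))
split-total {f} (unselect {s = s} {t} p) = trans (lemma s (f 0) t) (cong (f 0 +_) (split-total p))
  where
  lemma : ∀ s a t → s + (a + t) ≡ a + (s + t)
  lemma = solve-∀

split-none : ∀ f n → Split f n 0 (∑ n f)
split-none f zero    = none
split-none f (suc n) = unselect (split-none (f ∘ suc) n)

split-one : ∀ f n {j} → j < n → Σ ℕ (Split f n (f j))
split-one f (suc n) {zero}  lt = _ , subst (λ s → Split f (suc n) s (∑ n (f ∘ suc))) (+-identityʳ (f 0))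
  (select (split-none (f ∘ suc) n))
split-one f (suc n) {suc j} (s≤s lt) = _ , unselect (proj₂ (split-one (f ∘ suc) n lt))

split-const : ∀ c n {y} → y ≤ n → Σ ℕ (Split (λ _ → c) n (c * y))
split-const c n {zero} le = _ , subst (λ s → Split (λ _ → c) n s (∑ n (λ _ → c))) (sym (*-zeroʳ c))
  (split-none (λ _ → c) n)
split-const c (suc n) {suc y} (s≤s le) = let (t , p) = split-const c n le in
  t , subst (λ s → Split (λ _ → c) (suc n) s t) (sym (*-suc c y)) (select p)

split-const⁻ : ∀ {c n s t} → Split (λ _ → c) n s t → Σ ℕ λ y → s ≡ c * y × y ≤ n
split-const⁻ {c} none = 0 , sym (*-zeroʳ c) , z≤n
split-const⁻ {c} (select p) = let (y , eq , le) = split-const⁻ p in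
  suc y , trans (cong (c +_) eq) (sym (*-suc c y)) , s≤s le
split-const⁻ (unselect p) = let (y , eq , le) = split-const⁻ p in y , eq , m≤n⇒m≤1+n le

-- A load shows only a total. If all items have size at least `L`, this total still tells apart no
-- item, one item and several items.
split-cases : ∀ {f n s t} L → (∀ j → L ≤ f j) → Split f n s t →
              s ≡ 0 ⊎ (Σ ℕ λ j → j < n × s ≡ f j) ⊎ L + L ≤ s
split-cases L big none = inj₁ refl
split-cases {f} L big (select p) with split-cases L (big ∘ suc) p
... | inj₁ refl = inj₂ (inj₁ (0 , s≤s z≤n , +-identityʳ (f 0)))
... | inj₂ (inj₁ (j , lt , refl)) = inj₂ (inj₂ (+-mono-≤ (big 0) (big (suc j))))
... | inj₂ (inj₂ le) = inj₂ (inj₂ (≤-trans le (m≤n+m _ (f 0))))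
split-cases L big (unselect p) with split-cases L (big ∘ suc) p
... | inj₁ refl = inj₁ refl
... | inj₂ (inj₁ (j , lt , refl)) = inj₂ (inj₁ (suc j , s≤s lt , refl))
... | inj₂ (inj₂ le) = inj₂ (inj₂ le)

-- ℓ is the vector of loads of some assignment of the items to bins.

Asg : List (ℕ × ℕ × ℕ) → (ℕ → ℕ) → Set
Asg []                ℓ = ∀ i → ℓ i ≡ 0
Asg ((z , u , v) ∷ its) ℓ = Σ Bool λ b → Σ (ℕ → ℕ) λ ℓ′ → Asg its ℓ′ × ∀ i → ℓ i ≡ put (if b then v else u) z i + ℓ′ i

asg-cong : ∀ its {ℓ ℓ′} → ℓ ≗ ℓ′ → Asg its ℓ → Asg its ℓ′
asg-cong []        eq p = λ i → trans (sym (eq i)) (p i)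
asg-cong (it ∷ its) eq (b , ℓ″ , p , h) = b , ℓ″ , p , λ i → trans (sym (eq i)) (h i)

asg-++ : ∀ xs {ys ℓ₁ ℓ₂} → Asg xs ℓ₁ → Asg ys ℓ₂ → Asg (xs ++ ys) (λ i → ℓ₁ i + ℓ₂ i)
asg-++ []        {ys} {ℓ₂ = ℓ₂} p q = asg-cong ys (λ i → cong (_+ ℓ₂ i) (sym (p i))) q
asg-++ ((z , u , v) ∷ xs) {ℓ₂ = ℓ₂} (b , ℓ′ , p , h) q =
  b , _ , asg-++ xs p q , λ i → trans (cong (_+ ℓ₂ i) (h i)) (+-assoc (put (if b then v else u) z i) (ℓ′ i) (ℓ₂ i))

asg-++⁻ : ∀ xs {ys ℓ} → Asg (xs ++ ys) ℓ → Σ (ℕ → ℕ) λ ℓ₁ → Σ (ℕ → ℕ) λ ℓ₂ → Asg xs ℓ₁ × Asg ys ℓ₂ × ∀ i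
  → ℓ i ≡ ℓ₁ i + ℓ₂ i
asg-++⁻ []        p = (λ _ → 0) , _ , (λ _ → refl) , p , λ _ → refl
asg-++⁻ ((z , u , v) ∷ xs) (b , ℓ′ , p , h) =
  let (ℓ₁ , ℓ₂ , p₁ , p₂ , h′) = asg-++⁻ xs p
      w = if b then v else u
  in (λ i → put w z i + ℓ₁ i) , ℓ₂ , (b , ℓ₁ , p₁ , λ _ → refl) , p₂ ,
     λ i → trans (h i) (trans (cong (put w z i +_) (h′ i)) (sym (+-assoc (put w z i) (ℓ₁ i) (ℓ₂ i))))

asg-concat : ∀ n (f : ℕ → List (ℕ × ℕ × ℕ)) g {F : ℕ → ℕ → ℕ} → (∀ j → j < n → Asg (f (g j)) (F j)) →
             Asg (concat (map f (applyUpTo g n))) (λ i → ∑ n (λ j → F j i))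
asg-concat zero    f g h = λ _ → refl
asg-concat (suc n) f g h = asg-++ (f (g 0)) (h 0 (s≤s z≤n)) (asg-concat n f (g ∘ suc) λ j lt → h (suc j) (s≤s lt))

asg-concat⁻ : ∀ n (f : ℕ → List (ℕ × ℕ × ℕ)) g {ℓ} → Asg (concat (map f (applyUpTo g n))) ℓ →
              Σ (ℕ → ℕ → ℕ) λ F → (∀ j → j < n → Asg (f (g j)) (F j)) × ∀ i → ℓ i ≡ ∑ n (λ j → F j i)
asg-concat⁻ zero    f g p = (λ _ _ → 0) , (λ _ ()) , p
asg-concat⁻ (suc n) f g p =
  let (ℓ₁ , ℓ₂ , p₁ , p₂ , h) = asg-++⁻ (f (g 0)) p ; (F , q , h′) = asg-concat⁻ n f (g ∘ suc) p₂
  in (λ { zero → ℓ₁ ; (suc j) → F j }) , (λ { zero _ → p₁ ; (suc j) (s≤s lt) → q j lt }) ,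
     λ i → trans (h i) (cong (ℓ₁ i +_) (h′ i))

put-+ : ∀ u a b i → put u (a + b) i ≡ put u a i + put u b i
put-+ u a b i with u ≡ᵇ i
... | true  = refl
... | false = refl

put-0 : ∀ u i → put u 0 i ≡ 0
put-0 u i with u ≡ᵇ i
... | true  = refl
... | false = refl

asg-group : ∀ {u v} n (f : ℕ → ℕ) g {s t} → Split (f ∘ g) n s t →
            Asg (map (λ j → f j , u , v) (applyUpTo g n)) (λ i → put u t i + put v s i)
asg-group {u} {v} zero f g none = λ i → cong₂ _+_ (put-0 u i) (put-0 v i)
asg-group {u} {v} (suc n) f g (select {s = s} {t} p) = true , _ , asg-group n f (g ∘ suc) p , λ i →
  trans (cong (put u t i +_) (put-+ v (f (g 0)) s i)) (lemma (put u t i) (put v (f (g 0)) i) _)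
  where
  lemma : ∀ a b c → a + (b + c) ≡ b + (a + c)
  lemma = solve-∀
asg-group {u} {v} (suc n) f g (unselect {s = s} {t} p) = false , _ , asg-group n f (g ∘ suc) p , λ i →
  trans (cong (_+ put v s i) (put-+ u (f (g 0)) t i)) (+-assoc (put u (f (g 0)) i) _ _)

asg-group⁻ : ∀ {u v} n (f : ℕ → ℕ) g {ℓ} → Asg (map (λ j → f j , u , v) (applyUpTo g n)) ℓ →
             Σ ℕ λ s → Σ ℕ λ t → Split (f ∘ g) n s t × ∀ i → ℓ i ≡ put u t i + put v s i
asg-group⁻ {u} {v} zero f g p = 0 , 0 , none , λ i → trans (p i) (sym (cong₂ _+_ (put-0 u i) (put-0 v i)))
asg-group⁻ {u} {v} (suc n) f g (true , ℓ′ , p , h) =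
  let (s , t , q , h′) = asg-group⁻ n f (g ∘ suc) p in f (g 0) + s , t , select q , λ i →
  trans (h i) (trans (cong (put v (f (g 0)) i +_) (h′ i)) (trans (lemma (put v (f (g 0)) i) (put u t i) (put v s i))
    (cong (put u t i +_) (sym (put-+ v (f (g 0)) s i)))))
  where
  lemma : ∀ a b c → a + (b + c) ≡ b + (a + c)
  lemma = solve-∀
asg-group⁻ {u} {v} (suc n) f g (false , ℓ′ , p , h) =
  let (s , t , q , h′) = asg-group⁻ n f (g ∘ suc) p in s , f (g 0) + t , unselect q , λ i →
  trans (h i) (trans (cong (put u (f (g 0)) i +_) (h′ i)) (trans (sym (+-assoc (put u (f (g 0)) i) _ _))
    (cong (_+ put v s i) (sym (put-+ u (f (g 0)) t i)))))

gridLoad : ℕ → ℕ → (u v : ℕ → ℕ → ℕ) (S T : ℕ → ℕ → ℕ) → ℕ → ℕ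
gridLoad m n u v S T i = ∑ m λ e → ∑ n λ q → put (u e q) (T e q) i + put (v e q) (S e q) i

module _ (I : Instance) where
  open Grid I using (grid)

  asg-grid : ∀ m n (f : ℕ → ℕ → ℕ → ℕ) (N u v : ℕ → ℕ → ℕ) {S T} →
             (∀ e q → e < m → q < n → Split (f e q) (N e q) (S e q) (T e q)) →
             Asg (grid m n (λ e q → map (λ j → f e q j , u e q , v e q) (upTo (N e q)))) (gridLoad m n u v S T)
  asg-grid m n f N u v h = asg-concat m _ (λ e → e) λ e e<m → asg-concat n _ (λ q → q) λ q q<n →
    asg-group (N e q) (f e q) (λ j → j) (h e q e<m q<n)

  asg-grid⁻ : ∀ m n (f : ℕ → ℕ → ℕ → ℕ) (N u v : ℕ → ℕ → ℕ) {ℓ} →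
    Asg (grid m n (λ e q → map (λ j → f e q j , u e q , v e q) (upTo (N e q)))) ℓ →
    Σ (ℕ → ℕ → ℕ × ℕ) λ ST → (∀ e q → e < m → q < n → Split (f e q) (N e q) (proj₁ (ST e q)) (proj₂ (ST e q))) ×
      ∀ i → ℓ i ≡ gridLoad m n u v (λ e q → proj₁ (ST e q)) (λ e q → proj₂ (ST e q)) i
  asg-grid⁻ m n f N u v p =
    let (F , p₁ , h₁) = asg-concat⁻ m _ (λ e → e) p
        G = λ e (lt : e < m) → asg-concat⁻ n _ (λ q → q) (p₁ e lt)
        row = λ e (lt : e < m) → choose {A = ℕ × ℕ}
                {P = λ q st → Split (f e q) (N e q) (proj₁ st) (proj₂ st) ×
                       ∀ i → proj₁ (G e lt) q i ≡ put (u e q) (proj₂ st) i + put (v e q) (proj₁ st) i} (0 , 0) n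
                λ q q<n → let (s , t , sp , h) = asg-group⁻ (N e q) (f e q) (λ j → j) (proj₁ (proj₂ (G e lt)) q q<n)
                          in (s , t) , sp , h
        (ST , q) = choose {A = ℕ → ℕ × ℕ}
                {P = λ e st → (∀ q → q < n → Split (f e q) (N e q) (proj₁ (st q)) (proj₂ (st q))) ×
                       ∀ i → F e i ≡ ∑ n (λ q → put (u e q) (proj₂ (st q)) i + put (v e q)
                         (proj₁ (st q)) i)} (λ _ → 0 , 0) m
                λ e lt → let (st , h) = row e lt in st , (λ q q<n → proj₁ (h q q<n)) ,
                         λ i → trans (proj₂ (proj₂ (G e lt)) i) (∑-cong n λ q q<n → proj₂ (h q q<n) i)
    in ST , (λ e q′ e<m q<n → proj₁ (q e e<m) q′ q<n) ,
       λ i → trans (h₁ i) (∑-cong m λ e e<m → proj₂ (q e e<m) i)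

-- Correctness of the grid

Solvable : Instance → Set
Solvable I = Σ (ℕ → ℕ) λ σ → (∀ e → e < E → σ e < N e) × (∀ q → q < Q → ∑ E (λ e → a e (σ e) q) ≡ τ q)
  where open Instance I

divmod-unique : ∀ M {x x′} y j → x < M → x′ < M → M * y + x ≡ M * j + x′ → y ≡ j × x ≡ x′
divmod-unique M {x} {x′} zero zero x< x′< eq = refl , trans (sym (cong (_+ x) (*-zeroʳ M)))
  (trans eq (cong (_+ x′) (*-zeroʳ M)))
divmod-unique M {x} {x′} zero (suc j) x< x′< eq = contradiction x<
  (≤⇒≯ (≤-trans (≤-trans (≤-trans (m≤m+n M (M * j)) (≤-reflexive (sym (*-suc M j)))) (m≤m+n (M * suc j) x′))
  (≤-reflexive (trans (sym eq) (cong (_+ x) (*-zeroʳ M))))))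
divmod-unique M {x} {x′} (suc y) zero x< x′< eq = contradiction x′<
  (≤⇒≯ (≤-trans (≤-trans (≤-trans (m≤m+n M (M * y)) (≤-reflexive (sym (*-suc M y)))) (m≤m+n (M * suc y) x))
  (≤-reflexive (trans eq (cong (_+ x′) (*-zeroʳ M))))))
divmod-unique M {x} {x′} (suc y) (suc j) x< x′< eq =
  let (p , q) = divmod-unique M y j x< x′<
        (+-cancelˡ-≡ M _ _ (trans (sym (lemma y x)) (trans eq (lemma j x′)))) in cong suc p , q
  where
  lemma : ∀ y x → M * suc y + x ≡ M + (M * y + x)
  lemma y x = trans (cong (_+ x) (*-suc M y)) (+-assoc M (M * y) x)

module GridBins (I : Instance) (Q>0 : 0 < Instance.Q I) where
  open Instance I
  open Grid I

  bin-injective : ∀ {e e′ q q′} → q ≤ Q → q′ ≤ Q → bin e q ≡ bin e′ q′ → e ≡ e′ × q ≡ q′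
  bin-injective {e} {e′} {q} {q′} q≤ q′≤ eq = divmod-unique (suc Q) e e′ (s≤s q≤) (s≤s q′≤)
    (trans (cong (_+ q) (*-comm (suc Q) e)) (trans eq (cong (_+ q′) (*-comm e′ (suc Q)))))

  bin<V : ∀ {e q} → e < E → q ≤ Q → bin e q < V
  bin<V {e} {q} e<E q≤ = ≤-trans (≤-reflexive (sym (+-suc (e * suc Q) q))) (≤-trans (+-monoʳ-≤ (e * suc Q) (s≤s q≤))
    (≤-trans (≤-reflexive (+-comm (e * suc Q) (suc Q))) (*-monoˡ-≤ (suc Q) e<E)))

  bin-surjective : ∀ m {i} → i < m * suc Q → Σ ℕ λ e → Σ ℕ λ q → e < m × q ≤ Q × i ≡ bin e q
  bin-surjective (suc m) {i} lt with i <? suc Q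
  ... | yes (s≤s i≤) = 0 , i , s≤s z≤n , i≤ , refl
  ... | no i≮ =
    let (e , q , e< , q≤ , eq) = bin-surjective m {i ∸ suc Q}
          (+-cancelˡ-< (suc Q) _ _ (subst (_< suc Q + m * suc Q) (sym (m+[n∸m]≡n (≮⇒≥ i≮))) lt))
    in suc e , q , s≤s e< , q≤ , trans (sym (m+[n∸m]≡n (≮⇒≥ i≮)))
      (trans (cong (suc Q +_) eq) (sym (+-assoc (suc Q) (e * suc Q) q)))

  put-bin : ∀ {e e′ q q′} z → q′ ≤ Q → q ≤ Q → put (bin e′ q′) z (bin e q) ≡ put e′ (put q′ z q) e
  put-bin {e} {e′} {q} {q′} z q′≤ q≤ with e′ ≟ e | q′ ≟ q
  ... | yes refl | yes refl = trans (put-≡ (bin e q) z) (sym (trans (put-≡ e _) (put-≡ q z)))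
  ... | yes refl | no  q≢   = trans (put-≢ z (λ eq → q≢ (proj₂ (bin-injective {e′} {e} q′≤ q≤ eq))))
    (sym (trans (put-≡ e _) (put-≢ z q≢)))
  ... | no  e≢   | _        = trans (put-≢ z (λ eq → e≢ (proj₁ (bin-injective {e′} {e} q′≤ q≤ eq)))) (sym (put-≢ _ e≢))

  at-bin : ∀ m n (ρ κ : ℕ → ℕ) (z : ℕ → ℕ → ℕ) e q → (∀ j → j < n → κ j ≤ Q) → q ≤ Q →
           ∑ m (λ i → ∑ n λ j → put (bin (ρ i) (κ j)) (z i j) (bin e q)) ≡
           ∑ m (λ i → put (ρ i) (∑ n λ j → put (κ j) (z i j) q) e)
  at-bin m n ρ κ z e q κ≤ q≤ = ∑-cong m λ i _ → trans
    (∑-cong n λ j j<n → put-bin {e} {ρ i} (z i j) (κ≤ j j<n) q≤) (∑-put-comm n (ρ i) (λ j → put (κ j) (z i j) q) e)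

  right first last below star : ℕ → ℕ → ℕ
  right e q = bin e (suc q)
  first e _ = bin e 0
  last  e _ = bin e Q
  below e q = bin (suc e) q
  star  e q = V + bin e q

  -- An assignment reduced to what the loads depend on. The groups are the choice, return, sum and
  -- filler items, in this order; `S` is the total sent to the second bin of an item and `T` the
  -- total kept in the first.
  record Flow : Set where
    field
      S₁ T₁ S₂ T₂ S₃ T₃ S₄ T₄ : ℕ → ℕ → ℕ

    load : ℕ → ℕ
    load i = gridLoad E Q bin right S₁ T₁ i + (gridLoad E 1 last first S₂ T₂ i +
             (gridLoad (E ∸ 1) (suc Q) bin below S₃ T₃ i + gridLoad E (suc Q) bin star S₄ T₄ i))

  fillSize : ℕ → ℕ → ℕ → ℕ
  fillSize e q zero    = δ e q
  fillSize e q (suc _) = Cap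

  record Feasible (f : Flow) : Set where
    open Flow f
    field
      split₁ : ∀ e q → e < E → q < Q → Split (sz e q) (N e) (S₁ e q) (T₁ e q)
      split₂ : ∀ e q → e < E → q < 1 → Split (λ _ → M) (N e) (S₂ e q) (T₂ e q)
      split₃ : ∀ e q → e < E ∸ 1 → q < suc Q → Split (λ _ → 1) W (S₃ e q) (T₃ e q)
      split₄ : ∀ e q → e < E → q < suc Q → Split (fillSize e q) 2 (S₄ e q) (T₄ e q)

  flow⇒asg : ∀ f → Feasible f → Asg items (Flow.load f)
  flow⇒asg f p = asg-++ (grid E Q choiceItems) (asg-grid I E Q sz (λ e _ → N e) bin right split₁)
    (asg-++ (grid E 1 returnItems) (asg-grid I E 1 (λ _ _ _ → M) (λ e _ → N e) last first split₂)
    (asg-++ (grid (E ∸ 1) (suc Q) sumItems) (asg-grid I (E ∸ 1) (suc Q) (λ _ _ _ → 1) (λ _ _ → W) bin below split₃)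
      (asg-grid I E (suc Q) fillSize (λ _ _ → 2) bin star split₄)))
    where open Feasible p

  asg⇒flow : ∀ {ℓ} → Asg items ℓ → Σ Flow λ f → Feasible f × ℓ ≗ Flow.load f
  asg⇒flow p =
    let (_ , _ , p₁ , p , h)  = asg-++⁻ (grid E Q choiceItems) p
        (_ , _ , p₂ , p , h′) = asg-++⁻ (grid E 1 returnItems) p
        (_ , _ , p₃ , p₄ , h″) = asg-++⁻ (grid (E ∸ 1) (suc Q) sumItems) p
        (_ , s₁ , l₁) = asg-grid⁻ I E Q sz (λ e _ → N e) bin right p₁
        (_ , s₂ , l₂) = asg-grid⁻ I E 1 (λ _ _ _ → M) (λ e _ → N e) last first p₂
        (_ , s₃ , l₃) = asg-grid⁻ I (E ∸ 1) (suc Q) (λ _ _ _ → 1) (λ _ _ → W) bin below p₃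
        (_ , s₄ , l₄) = asg-grid⁻ I E (suc Q) fillSize (λ _ _ → 2) bin star p₄
    in _ , record { split₁ = s₁ ; split₂ = s₂ ; split₃ = s₃ ; split₄ = s₄ } ,
       λ i → trans (h i) (cong₂ _+_ (l₁ i) (trans (h′ i) (cong₂ _+_ (l₂ i) (trans (h″ i) (cong₂ _+_ (l₃ i) (l₄ i))))))

  gridLoad-split : ∀ m n u v S T i → gridLoad m n u v S T i ≡
                   ∑ m (λ e → ∑ n λ q → put (u e q) (T e q) i) + ∑ m (λ e → ∑ n λ q → put (v e q) (S e q) i)
  gridLoad-split m n u v S T i = trans
    (∑-cong m λ e _ → ∑-+ n (λ q → put (u e q) (T e q) i) (λ q → put (v e q) (S e q) i))
    (∑-+ m (λ e → ∑ n (λ q → put (u e q) (T e q) i)) (λ e → ∑ n (λ q → put (v e q) (S e q) i)))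

  ∑∑-miss : ∀ m n (u z : ℕ → ℕ → ℕ) i → (∀ e q → e < m → q < n → u e q ≢ i) → ∑ m
    (λ e → ∑ n λ q → put (u e q) (z e q) i) ≡ 0
  ∑∑-miss m n u z i ne = ∑-zero m λ e e< → ∑-zero n λ q q< → put-≢ (z e q) (ne e q e< q<)

  E∸1<E : ∀ {e} → e < E ∸ 1 → suc e < E
  E∸1<E {e} lt = subst (suc (suc e) ≤_) (m+[n∸m]≡n (≤-trans (≤-trans (s≤s z≤n) lt) (m∸n≤m E 1))) (s≤s lt)

  module _ (f : Flow) where
    open Flow f

    out₁ in₁ out₂ in₂ out₃ in₃ : ℕ → ℕ → ℕ
    out₁ e q = if q <ᵇ Q then T₁ e q else 0
    in₁ e zero    = 0
    in₁ e (suc q) = S₁ e q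
    out₂ e q = put Q (T₂ e 0) q
    in₂ e q = put 0 (S₂ e 0) q
    out₃ e q = if suc e <ᵇ E then T₃ e q else 0
    in₃ zero    q = 0
    in₃ (suc e) q = S₃ e q

    load-bin : ∀ {e q} → e < E → q ≤ Q → load (bin e q) ≡ (out₁ e q + in₁ e q) +
      ((out₂ e q + in₂ e q) + ((out₃ e q + in₃ e q) + T₄ e q))
    load-bin {e} {q} e<E q≤ = cong₂ _+_ (trans (gridLoad-split E Q bin right S₁ T₁ i) (cong₂ _+_ u₁ v₁))
      (cong₂ _+_ (trans (gridLoad-split E 1 last first S₂ T₂ i) (cong₂ _+_ u₂ v₂))
      (cong₂ _+_ (trans (gridLoad-split (E ∸ 1) (suc Q) bin below S₃ T₃ i) (cong₂ _+_ u₃ v₃))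
        (trans (gridLoad-split E (suc Q) bin star S₄ T₄ i) (trans (cong₂ _+_ u₄ v₄) (+-identityʳ (T₄ e q))))))
      where
      i = bin e q
      u₁ : ∑ E (λ e → ∑ Q λ q → put (bin e q) (T₁ e q) i) ≡ out₁ e q
      u₁ = trans (at-bin E Q (λ e → e) (λ q → q) T₁ e q (λ j → <⇒≤) q≤)
             (trans (∑-put< E (λ i → ∑ Q λ j → put j (T₁ i j) q) e<E) (∑-put Q (T₁ e) q))
      v₁ : ∑ E (λ e → ∑ Q λ q → put (bin e (suc q)) (S₁ e q) i) ≡ in₁ e q
      v₁ = trans (at-bin E Q (λ e → e) suc S₁ e q (λ j lt → lt) q≤)
        (trans (∑-put< E (λ i → ∑ Q λ j → put (suc j) (S₁ i j) q) e<E) (col q q≤))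
        where
        col : ∀ q → q ≤ Q → ∑ Q (λ j → put (suc j) (S₁ e j) q) ≡ in₁ e q
        col zero    _  = ∑-zero Q λ _ _ → refl
        col (suc q) lt = ∑-put< Q (S₁ e) lt
      u₂ : ∑ E (λ e → ∑ 1 λ q → put (bin e Q) (T₂ e q) i) ≡ out₂ e q
      u₂ = trans (at-bin E 1 (λ e → e) (λ _ → Q) T₂ e q (λ j _ → ≤-refl) q≤)
             (trans (∑-put< E (λ i → ∑ 1 λ j → put Q (T₂ i j) q) e<E) (+-identityʳ _))
      v₂ : ∑ E (λ e → ∑ 1 λ q → put (bin e 0) (S₂ e q) i) ≡ in₂ e q
      v₂ = trans (at-bin E 1 (λ e → e) (λ _ → 0) S₂ e q (λ j _ → z≤n) q≤)
             (trans (∑-put< E (λ i → ∑ 1 λ j → put 0 (S₂ i j) q) e<E) (+-identityʳ _))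
      u₃ : ∑ (E ∸ 1) (λ e → ∑ (suc Q) λ q → put (bin e q) (T₃ e q) i) ≡ out₃ e q
      u₃ = trans (at-bin (E ∸ 1) (suc Q) (λ e → e) (λ q → q) T₃ e q (λ j → ≤-pred) q≤)
             (trans (∑-put (E ∸ 1) (λ i → ∑ (suc Q) λ j → put j (T₃ i j) q) e)
               (trans (cong (λ z → if e <ᵇ (E ∸ 1) then z else 0) (∑-put< (suc Q) (T₃ e) (s≤s q≤)))
                 (cong (λ b → if b then T₃ e q else 0) (last? E))))
        where
        last? : ∀ E → (e <ᵇ (E ∸ 1)) ≡ (suc e <ᵇ E)
        last? zero    = refl
        last? (suc _) = refl
      v₃ : ∑ (E ∸ 1) (λ e → ∑ (suc Q) λ q → put (bin (suc e) q) (S₃ e q) i) ≡ in₃ e q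
      v₃ = trans (at-bin (E ∸ 1) (suc Q) suc (λ q → q) S₃ e q (λ j → ≤-pred) q≤) (rw e e<E)
        where
        rw : ∀ e → e < E → ∑ (E ∸ 1) (λ i → put (suc i) (∑ (suc Q) λ j → put j (S₃ i j) q) e) ≡ in₃ e q
        rw zero    _  = ∑-zero (E ∸ 1) λ _ _ → refl
        rw (suc e) lt = trans (∑-put< (E ∸ 1) (λ i → ∑ (suc Q) λ j → put j (S₃ i j) q) (∸-monoˡ-≤ 1 lt))
          (∑-put< (suc Q) (S₃ e) (s≤s q≤))
      u₄ : ∑ E (λ e → ∑ (suc Q) λ q → put (bin e q) (T₄ e q) i) ≡ T₄ e q
      u₄ = trans (at-bin E (suc Q) (λ e → e) (λ q → q) T₄ e q (λ j → ≤-pred) q≤)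
             (trans (∑-put< E (λ i → ∑ (suc Q) λ j → put j (T₄ i j) q) e<E) (∑-put< (suc Q) (T₄ e) (s≤s q≤)))
      v₄ : ∑ E (λ e → ∑ (suc Q) λ q → put (V + bin e q) (S₄ e q) i) ≡ 0
      v₄ = ∑∑-miss E (suc Q) star S₄ i λ e′ q′ _ _ eq → <⇒≱ (bin<V {e} e<E q≤)
        (≤-trans (m≤m+n V (bin e′ q′)) (≤-reflexive eq))

    load-star : ∀ {e q} → e < E → q ≤ Q → load (V + bin e q) ≡ S₄ e q
    load-star {e} {q} e<E q≤ = trans
      (cong₂ _+_ (miss E Q bin right S₁ T₁ (λ e q e< q< → bin<V e< (<⇒≤ q<)) (λ e q e< q< → bin<V e< q<))
      (cong₂ _+_ (miss E 1 last first S₂ T₂ (λ e q e< q< → bin<V e< ≤-refl) (λ e q e< q< → bin<V e< z≤n))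
      (cong₂ _+_ (miss (E ∸ 1) (suc Q) bin below S₃ T₃
        (λ e q e< q< → bin<V (≤-trans e< (m∸n≤m E 1)) (≤-pred q<)) (λ e q e< q< → bin<V (E∸1<E e<) (≤-pred q<)))
        (gridLoad-split E (suc Q) bin star S₄ T₄ i)))) (cong₂ _+_ u₄ v₄)
      where
      i = V + bin e q
      ne : ∀ {j} → j < V → j ≢ i
      ne j<V eq = <⇒≱ j<V (≤-trans (m≤m+n V _) (≤-reflexive (sym eq)))
      miss : ∀ m n (u v S T : ℕ → ℕ → ℕ) → (∀ e q → e < m → q < n → u e q < V) →
        (∀ e q → e < m → q < n → v e q < V) → gridLoad m n u v S T i ≡ 0
      miss m n u v S T hu hv = trans (gridLoad-split m n u v S T i)
        (cong₂ _+_ (∑∑-miss m n u T i λ e q e< q< → ne (hu e q e< q<))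
          (∑∑-miss m n v S i λ e q e< q< → ne (hv e q e< q<)))
      u₄ : ∑ E (λ e → ∑ (suc Q) λ q → put (bin e q) (T₄ e q) i) ≡ 0
      u₄ = ∑∑-miss E (suc Q) bin T₄ i λ e q e< q< → ne (bin<V e< (≤-pred q<))
      cancel : ∀ m u z → put (m + u) z (m + bin e q) ≡ put u z (bin e q)
      cancel zero    u z = refl
      cancel (suc m) u z = cancel m u z
      v₄ : ∑ E (λ e → ∑ (suc Q) λ q → put (V + bin e q) (S₄ e q) i) ≡ S₄ e q
      v₄ = trans (∑-cong E λ e′ _ → ∑-cong (suc Q) λ q′ _ → cancel V (bin e′ q′) (S₄ e′ q′))
             (trans (at-bin E (suc Q) (λ e → e) (λ q → q) S₄ e q (λ j → ≤-pred) q≤)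
               (trans (∑-put< E (λ i → ∑ (suc Q) λ j → put j (S₄ i j) q) e<E) (∑-put< (suc Q) (S₄ e) (s≤s q≤))))

room : ∀ p {a u} → p + a ≤ u → a ≤ u ∸ p
room p {a} le = m+n≤o⇒m≤o∸n a (≤-trans (≤-reflexive (+-comm a p)) le)

module GridFlow (I : Instance) (E>0 : 0 < Instance.E I) (Q>0 : 0 < Instance.Q I) where
  open Instance I
  open Grid I
  open GridBins I Q>0

  R : ℕ
  R = W + ∑ Q τ

  cost<Cap : ∀ {e q} → e < E → q ≤ Q → cost e q < Cap
  cost<Cap {e} {q} e<E q≤ = s≤s (≤-trans (term≤∑ (suc Q) (cost e) (s≤s q≤)) (term≤∑ E (λ e → ∑ (suc Q) (cost e)) e<E))

  shift : ℕ → ℕ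
  shift q = if isZero q then L + U else 0

  δ+cost : ∀ {e q} → e < E → q ≤ Q → δ e q + cost e q ≡ Cap + shift q
  δ+cost {e} {q} e<E q≤ = m∸n+n≡m (≤-trans (<⇒≤ (cost<Cap e<E q≤)) (m≤m+n Cap (shift q)))

  δ>0 : ∀ {e q} → e < E → q ≤ Q → 0 < δ e q
  δ>0 {e} {q} e<E q≤ = m<n⇒0<n∸m (≤-trans (cost<Cap e<E q≤) (m≤m+n Cap (shift q)))

  Q≢0 : Q ≢ 0
  Q≢0 eq = <-irrefl (sym eq) Q>0

  -- Subtraction-free form of the condition that bin e q has load Cap.

  module _ (f : Flow) where
    open Flow f

    In Out Acc Acc⁺ : ℕ → ℕ → ℕ
    In e zero    = L + U + S₂ e 0
    In e (suc q) = S₁ e q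
    Out e q = if q <ᵇ Q then S₁ e q else L + S₂ e 0
    Acc = in₃ f
    Acc⁺ e q = if suc e <ᵇ E then S₃ e q else τ′ q

    module _ (feas : Feasible f) where
      open Feasible feas

      -- Adding what leaves a bin to both sides completes the part that stays to the whole group,
      -- whose total is a constant.
      horizontal : ∀ {e} q → e < E → q ≤ Q → (out₁ f e q + in₁ f e q) + (out₂ f e q + in₂ f e q) + shift q + Out e q ≡
                   tot e q + (if q <ᵇ Q then 0 else L) + In e q
      horizontal {e} zero e<E q≤ rewrite <⇒<ᵇ≡ Q>0 | ≢⇒≡ᵇ Q≢0 =
        trans (lemma (T₁ e 0) (S₂ e 0) (L + U) (S₁ e 0))
          (cong (λ z → z + 0 + (L + U + S₂ e 0)) (split-total (split₁ e 0 e<E Q>0)))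
        where
        lemma : ∀ t s l s′ → t + 0 + (0 + s) + l + s′ ≡ s′ + t + 0 + (l + s)
        lemma = solve-∀
      horizontal {e} (suc q) e<E q≤ with suc q <? Q
      ... | yes lt rewrite <⇒<ᵇ≡ lt | ≢⇒≡ᵇ {Q} {suc q} (λ eq → <-irrefl (sym eq) lt) =
        trans (lemma (T₁ e (suc q)) (S₁ e q) (S₁ e (suc q)))
          (cong (λ z → z + 0 + S₁ e q) (split-total (split₁ e (suc q) e<E lt)))
        where
        lemma : ∀ t s s′ → t + s + 0 + 0 + s′ ≡ s′ + t + 0 + s
        lemma = solve-∀
      ... | no ≮ with refl ← ≤-antisym q≤ (≮⇒≥ ≮) rewrite ≥⇒<ᵇ≡ (≤-refl {suc q}) | ≡ᵇ-refl q =
        trans (lemma (S₁ e q) (T₂ e 0) (S₂ e 0) L)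
          (cong (λ z → z + L + S₁ e q) (trans (split-total (split₂ e 0 e<E (s≤s z≤n))) (∑-const (N e) M)))
        where
        lemma : ∀ s t s₂ l → 0 + s + (t + 0) + 0 + (l + s₂) ≡ s₂ + t + l + s
        lemma = solve-∀

      vertical : ∀ {e q} → e < E → q ≤ Q → (out₃ f e q + in₃ f e q) + Acc⁺ e q ≡
        (if suc e <ᵇ E then W else τ′ q) + Acc e q
      vertical {e} {q} e<E q≤ with suc e <? E
      ... | yes lt rewrite <⇒<ᵇ≡ lt = trans (lemma (T₃ e q) (in₃ f e q) (S₃ e q))
            (cong (_+ in₃ f e q) (trans (split-total (split₃ e q (∸-monoˡ-≤ 1 lt) (s≤s q≤)))
              (trans (∑-const W 1) (*-identityʳ W))))
        where
        lemma : ∀ t a s → t + a + s ≡ s + t + a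
        lemma = solve-∀
      ... | no ≮ rewrite ≥⇒<ᵇ≡ (≮⇒≥ ≮) = +-comm (in₃ f e q) (τ′ q)

      balance : ∀ {e q} → e < E → q ≤ Q → T₄ e q ≡ δ e q → load (bin e q) +
        (shift q + Out e q + Acc⁺ e q) ≡ Cap + (shift q + In e q + Acc e q)
      balance {e} {q} e<E q≤ eq = begin
        load (bin e q) + (shift q + Out e q + Acc⁺ e q)
          ≡⟨ cong (_+ (shift q + Out e q + Acc⁺ e q)) (load-bin f e<E q≤) ⟩
        h₁ + (h₂ + (v + T₄ e q)) + (shift q + Out e q + Acc⁺ e q)
          ≡⟨ lemma h₁ h₂ v (T₄ e q) (shift q) (Out e q) (Acc⁺ e q) ⟩
        (h₁ + h₂ + shift q + Out e q) + (v + Acc⁺ e q) + T₄ e q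
          ≡⟨ cong₂ _+_ (cong₂ _+_ (horizontal q e<E q≤) (vertical e<E q≤)) eq ⟩
        (tot e q + b + In e q) + (w + Acc e q) + δ e q
          ≡⟨ lemma′ (tot e q) b (In e q) w (Acc e q) (δ e q) ⟩
        δ e q + cost e q + (In e q + Acc e q)
          ≡⟨ cong (_+ (In e q + Acc e q)) (δ+cost e<E q≤) ⟩
        Cap + shift q + (In e q + Acc e q)
          ≡⟨ lemma″ Cap (shift q) (In e q) (Acc e q) ⟩
        Cap + (shift q + In e q + Acc e q) ∎
        where
        open ≡-Reasoning
        h₁ = out₁ f e q + in₁ f e q
        h₂ = out₂ f e q + in₂ f e q
        v = out₃ f e q + in₃ f e q
        b = if q <ᵇ Q then 0 else L
        w = if suc e <ᵇ E then W else τ′ q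
        lemma : ∀ h₁ h₂ v t s o a → h₁ + (h₂ + (v + t)) + (s + o + a) ≡ (h₁ + h₂ + s + o) + (v + a) + t
        lemma = solve-∀
        lemma′ : ∀ t b i w a d → (t + b + i) + (w + a) + d ≡ d + (t + b + w) + (i + a)
        lemma′ = solve-∀
        lemma″ : ∀ b s i a → b + s + (i + a) ≡ b + (s + i + a)
        lemma″ = solve-∀

      load⇒eq : ∀ {e q} → e < E → q ≤ Q → T₄ e q ≡ δ e q → load (bin e q) ≡ Cap → In e q + Acc e q ≡ Out e q + Acc⁺ e q
      load⇒eq {e} {q} e<E q≤ eq h = sym
        (+-cancelˡ-≡ (Cap + shift q) _ _ (trans (lemma Cap (shift q) (Out e q) (Acc⁺ e q))
        (trans (cong (_+ (shift q + Out e q + Acc⁺ e q)) (sym h))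
          (trans (balance e<E q≤ eq) (sym (lemma Cap (shift q) (In e q) (Acc e q)))))))
        where
        lemma : ∀ b s o a → b + s + (o + a) ≡ b + (s + o + a)
        lemma = solve-∀

      eq⇒load : ∀ {e q} → e < E → q ≤ Q → T₄ e q ≡ δ e q → In e q + Acc e q ≡ Out e q + Acc⁺ e q → load (bin e q) ≡ Cap
      eq⇒load {e} {q} e<E q≤ eq h = +-cancelʳ-≡ (shift q + Out e q + Acc⁺ e q) _ _ (trans (balance e<E q≤ eq)
        (cong (Cap +_) (trans (+-assoc (shift q) _ _) (trans (cong (shift q +_) h) (sym (+-assoc (shift q) _ _))))))

  pre≤U : ∀ {e s q} → e < E → s < N e → q ≤ Q → pre e s q ≤ U
  pre≤U {e} {s} {q} e<E s< q≤ = m≤n⇒m≤1+n (≤-trans (∑-monoˡ (a e s) q≤)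
    (≤-trans (term≤∑ (N e) (λ s → pre e s Q) s<) (term≤∑ E (λ e → ∑ (N e) λ s → pre e s Q) e<E)))

  pre-step : ∀ {e s q} → e < E → s < N e → q < Q → U ∸ pre e s q ≡ U ∸ pre e s (suc q) + a e s q
  pre-step {e} {s} {q} e<E s< q<Q = begin
    U ∸ pre e s q                      ≡⟨ sym
      (m∸n+n≡m (room (pre e s q) (subst (_≤ U) (∑-last q (a e s)) (pre≤U e<E s< q<Q)))) ⟩
    U ∸ pre e s q ∸ a e s q + a e s q  ≡⟨ cong (_+ a e s q)
      (trans (∸-+-assoc U (pre e s q) (a e s q)) (cong (U ∸_) (sym (∑-last q (a e s))))) ⟩
    U ∸ pre e s (suc q) + a e s q      ∎
    where open ≡-Reasoning

  low<M : ∀ {x y} → x ≤ U → y ≤ R → x + y < M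
  low<M x≤ y≤ = s≤s (+-mono-≤ x≤ y≤)

  -- Since `x + y < M`, the digits do not carry, and `L` has room for one more multiple of `M` than
  -- any option needs. Hence two choice items are always too many.
  digits<L : ∀ {e x y s} → e < E → s ≤ N e → x ≤ U → y ≤ R → M * s + (x + y) < L
  digits<L {e} {x} {y} {s} e<E s≤ x≤ y≤ = begin-strict
    M * s + (x + y)      <⟨ +-monoʳ-< (M * s) (low<M x≤ y≤) ⟩
    M * s + M            ≡⟨ trans (+-comm (M * s) M) (sym (*-suc M s)) ⟩
    M * suc s            ≤⟨ *-monoʳ-≤ M (s≤s (≤-trans (≤-trans s≤ (term≤∑ E N e<E)) (n≤1+n _))) ⟩
    M * (2 + ∑ E N)      ∎
    where open ≤-Reasoning

  R<L : ∀ {y} → y ≤ R → y < L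
  R<L {y} y≤ = ≤-trans (low<M z≤n y≤)
    (≤-trans (≤-reflexive (sym (*-identityʳ M))) (*-monoʳ-≤ M {1} {2 + ∑ E N} (s≤s z≤n)))

  -- The only way for a set of items of sizes sz e q to compensate the size
  -- announced in the column before is to consist of the single item y.

  forced : ∀ {e q y s t x x⁺} → e < E → q < Q → y ≤ N e → x ≤ R → x⁺ ≤ R → Split (sz e q) (N e) s t →
           L + M * y + (U ∸ pre e y q) + x ≡ s + x⁺ → y < N e × s ≡ sz e q y × x⁺ ≡ x + a e y q
  forced {e} {q} {y} {s} {t} {x} {x⁺} e<E q<Q y≤ x≤ x⁺≤ sp eq with split-cases L
    (λ j → ≤-trans (m≤m+n L (M * j)) (m≤m+n (L + M * j) _)) sp
  ... | inj₁ refl = contradiction (R<L x⁺≤)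
    (≤⇒≯ (≤-trans (≤-trans (m≤m+n L (M * y)) (≤-trans (m≤m+n _ (U ∸ pre e y q)) (m≤m+n _ x))) (≤-reflexive eq)))
  ... | inj₂ (inj₂ 2L≤) = contradiction (digits<L e<E y≤ (m∸n≤m U (pre e y q)) x≤)
    (≤⇒≯ (+-cancelˡ-≤ L _ _ (≤-trans (≤-trans 2L≤ (m≤m+n s x⁺))
          (≤-reflexive (trans (sym eq) (lemma L (M * y) (U ∸ pre e y q) x))))))
    where
    lemma : ∀ l m u x → l + m + u + x ≡ l + (m + (u + x))
    lemma = solve-∀
  ... | inj₂ (inj₁ (j , j< , refl)) with divmod-unique M y j (low<M (m∸n≤m U (pre e y q)) x≤)
    (low<M (m∸n≤m U (pre e j (suc q))) x⁺≤)
                                        (+-cancelˡ-≡ L _ _ (trans (sym (lemma L (M * y)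
                                          (U ∸ pre e y q) x)) (trans eq (lemma L (M * j) (U ∸ pre e j (suc q)) x⁺))))
    where
    lemma : ∀ l m u x → l + m + u + x ≡ l + (m + (u + x))
    lemma = solve-∀
  ... | refl , low = j< , refl , +-cancelˡ-≡ (U ∸ pre e y (suc q)) _ _
    (trans (sym low) (trans (cong (_+ x) (pre-step e<E j< q<Q)) (lemma (U ∸ pre e y (suc q)) (a e y q) x)))
    where
    lemma : ∀ u a x → u + a + x ≡ u + (x + a)
    lemma = solve-∀

  τ′≤R : ∀ q → τ′ q ≤ R
  τ′≤R q with q <? Q
  ... | yes lt rewrite <⇒<ᵇ≡ lt = ≤-trans (term≤∑ Q τ lt) (m≤n+m _ W)
  ... | no ≮ rewrite ≥⇒<ᵇ≡ (≮⇒≥ ≮) = ≤-trans (m∸n≤m W (∑ Q τ)) (m≤m+n W _)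

  module _ {f : Flow} (feas : Feasible f) (full : ∀ i → i < bins → Flow.load f i ≡ Cap) where
    open Flow f
    open Feasible feas

    T₄≡δ : ∀ {e q} → e < E → q ≤ Q → T₄ e q ≡ δ e q
    T₄≡δ {e} {q} e<E q≤ = aux (split₄ e q e<E (s≤s q≤))
      (trans (sym (load-star f e<E q≤)) (full _ (+-monoʳ-< V (bin<V e<E q≤))))
      where
      aux : ∀ {s t} → Split (fillSize e q) 2 s t → s ≡ Cap → t ≡ δ e q
      aux (select (select none)) eq = contradiction (δ>0 e<E q≤)
        (≤⇒≯ (≤-reflexive (+-cancelʳ-≡ Cap _ _ (trans (cong (δ e q +_) (sym (+-identityʳ Cap))) eq))))
      -- Here the filler of size `δ e q` fills the bin by itself. Then it equals `Cap`, and the two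
      -- fillers are interchangeable.
      aux (select (unselect none)) eq = trans (+-identityʳ Cap) (sym (trans (sym (+-identityʳ (δ e q))) eq))
      aux (unselect (select none)) eq = +-identityʳ (δ e q)
      aux (unselect (unselect none)) ()

    equation : ∀ {e q} → e < E → q ≤ Q → In f e q + Acc f e q ≡ Out f e q + Acc⁺ f e q
    equation {e} {q} e<E q≤ = load⇒eq f feas e<E q≤ (T₄≡δ e<E q≤) (full (bin e q) (≤-trans (bin<V e<E q≤) (m≤m+n V V)))

    S₃≤W : ∀ {e q} → suc e < E → q ≤ Q → S₃ e q ≤ W
    S₃≤W {e} {q} lt q≤ = ≤-trans (m≤m+n _ (T₃ e q))
      (≤-reflexive (trans (split-total (split₃ e q (∸-monoˡ-≤ 1 lt) (s≤s q≤))) (trans (∑-const W 1) (*-identityʳ W))))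

    Acc≤R : ∀ e {q} → e < E → q ≤ Q → Acc f e q ≤ R
    Acc≤R zero    e<E q≤ = z≤n
    Acc≤R (suc e) e<E q≤ = ≤-trans (S₃≤W e<E q≤) (m≤m+n W _)

    Acc⁺≤R : ∀ {e q} → e < E → q ≤ Q → Acc⁺ f e q ≤ R
    Acc⁺≤R {e} {q} e<E q≤ with suc e <? E
    ... | yes lt rewrite <⇒<ᵇ≡ lt = ≤-trans (S₃≤W lt q≤) (m≤m+n W _)
    ... | no ≮ rewrite ≥⇒<ᵇ≡ (≮⇒≥ ≮) = τ′≤R q

    -- The number of return items sent back to column 0 announces `y`, at first only with `y ≤ N e`.
    -- Column 0 can balance this only by the item of an actual option `y`, and each column passes
    -- the same option on to the next.
    row : ∀ e → e < E → Σ ℕ λ y → y < N e × ∀ q → q < Q → Acc⁺ f e q ≡ Acc f e q + a e y q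
    row e e<E with split-const⁻ (split₂ e 0 e<E (s≤s z≤n))
    ... | y , eq , y≤ = y , proj₁ (go 0 Q>0) , λ q q<Q → proj₂ (proj₂ (go q q<Q))
      where
      go : ∀ q → q < Q → y < N e × S₁ e q ≡ sz e q y × Acc⁺ f e q ≡ Acc f e q + a e y q
      step : ∀ q → q < Q → In f e q ≡ L + M * y + (U ∸ pre e y q) →
        y < N e × S₁ e q ≡ sz e q y × Acc⁺ f e q ≡ Acc f e q + a e y q
      step q q<Q h = forced e<E q<Q y≤ (Acc≤R e e<E (<⇒≤ q<Q)) (Acc⁺≤R e<E (<⇒≤ q<Q)) (split₁ e q e<E q<Q)
        (trans (cong (_+ Acc f e q) (sym h))
          (trans (equation e<E (<⇒≤ q<Q))
            (cong (_+ Acc⁺ f e q) (cong (λ b → if b then S₁ e q else L + S₂ e 0) (<⇒<ᵇ≡ q<Q)))))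
      go zero q<Q = step 0 q<Q (trans (cong (L + U +_) eq) (lemma L U (M * y)))
        where
        lemma : ∀ l u m → l + u + m ≡ l + m + u
        lemma = solve-∀
      go (suc q) q<Q = step (suc q) q<Q (proj₁ (proj₂ (go q (<-trans (n<1+n q) q<Q))))

    flow⇒solvable : Solvable I
    flow⇒solvable = σ , (λ e e<E → proj₁ (h e e<E)) , λ q q<Q → total q q<Q E refl
      where
      rows : Σ (ℕ → ℕ) λ σ → ∀ e → e < E → σ e < N e × ∀ q → q < Q → Acc⁺ f e q ≡ Acc f e q + a e (σ e) q
      rows = choose {P = λ e y → y < N e × ∀ q → q < Q → Acc⁺ f e q ≡ Acc f e q + a e y q} 0 E row
      σ = proj₁ rows
      h = proj₂ rows
      -- The units that arrive in row `e` are the partial sum over the rows above. Below the last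
      -- row `Acc⁺` is the target by definition, which closes the sum.
      partial : ∀ q → q < Q → ∀ e → e < E → ∑ e (λ e → a e (σ e) q) ≡ Acc f e q
      partial q q<Q zero    _ = refl
      partial q q<Q (suc e) lt = trans (∑-last e (λ e → a e (σ e) q))
        (trans (cong (_+ a e (σ e) q) (partial q q<Q e (<-trans (n<1+n e) lt)))
        (trans (sym (proj₂ (h e (<-trans (n<1+n e) lt)) q q<Q)) (cong (λ b → if b then S₃ e q else τ′ q) (<⇒<ᵇ≡ lt))))
      total : ∀ q → q < Q → ∀ m → m ≡ E → ∑ m (λ e → a e (σ e) q) ≡ τ q
      total q q<Q zero    eq = contradiction (subst (0 <_) (sym eq) E>0) (<-irrefl refl)
      total q q<Q (suc e) eq = trans (∑-last e (λ e → a e (σ e) q)) (trans (cong (_+ a e (σ e) q) (partial q q<Q e e<E))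
        (trans (sym (proj₂ (h e e<E) q q<Q))
          (trans (cong (λ b → if b then S₃ e q else τ′ q) (≥⇒<ᵇ≡ (≤-reflexive (sym eq))))
            (cong (λ b → if b then τ q else W ∸ ∑ Q τ) (<⇒<ᵇ≡ q<Q)))))
        where e<E = ≤-reflexive eq

  module _ (σ : ℕ → ℕ) (σ<N : ∀ e → e < E → σ e < N e) (sums : ∀ q → q < Q → ∑ E (λ e → a e (σ e) q) ≡ τ q) where

    a′ : ℕ → ℕ → ℕ
    a′ e q = if q <ᵇ Q then a e (σ e) q else U ∸ pre e (σ e) Q

    a′≤U : ∀ {e q} → e < E → q ≤ Q → a′ e q ≤ U
    a′≤U {e} {q} e<E q≤ with q <? Q
    ... | yes lt rewrite <⇒<ᵇ≡ lt = ≤-trans (term≤∑ Q (a e (σ e)) lt) (pre≤U e<E (σ<N e e<E) ≤-refl)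
    ... | no ≮ rewrite ≥⇒<ᵇ≡ (≮⇒≥ ≮) = m∸n≤m U (pre e (σ e) Q)

    level : ℕ → ℕ → ℕ
    level e q = ∑ e (λ e → a′ e q)

    level≤W : ∀ {e q} → e ≤ E → q ≤ Q → level e q ≤ W
    level≤W {e} {q} e≤E q≤ = ≤-trans (∑-mono e λ j j<e → a′≤U (≤-trans j<e e≤E) q≤)
      (≤-trans (≤-reflexive (∑-const e U)) (*-monoˡ-≤ U e≤E))

    -- In the slack column, exchanging the order of summation identifies the sum of the totals
    -- `pre e (σ e) Q` with the sum of the targets.
    level-E : ∀ {q} → q ≤ Q → level E q ≡ τ′ q
    level-E {q} q≤ with q <? Q
    ... | yes lt rewrite <⇒<ᵇ≡ lt = sums q lt
    ... | no ≮ rewrite ≥⇒<ᵇ≡ (≮⇒≥ ≮) = begin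
        ∑ E (λ e → U ∸ pre e (σ e) Q)                                  ≡⟨ sym (m+n∸n≡m _ (∑ Q τ)) ⟩
        ∑ E (λ e → U ∸ pre e (σ e) Q) + ∑ Q τ ∸ ∑ Q τ                  ≡⟨ cong
          (λ z → ∑ E (λ e → U ∸ pre e (σ e) Q) + z ∸ ∑ Q τ) pre-sum ⟩
        ∑ E (λ e → U ∸ pre e (σ e) Q) + ∑ E (λ e → pre e (σ e) Q) ∸ ∑ Q τ ≡⟨ cong (_∸ ∑ Q τ)
          (sym (∑-+ E (λ e → U ∸ pre e (σ e) Q) (λ e → pre e (σ e) Q))) ⟩
        ∑ E (λ e → U ∸ pre e (σ e) Q + pre e (σ e) Q) ∸ ∑ Q τ          ≡⟨ cong (_∸ ∑ Q τ)
          (trans (∑-cong E λ e e<E → m∸n+n≡m (pre≤U e<E (σ<N e e<E) ≤-refl)) (∑-const E U)) ⟩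
        W ∸ ∑ Q τ                                                      ∎
        where
        open ≡-Reasoning
        pre-sum : ∑ Q τ ≡ ∑ E (λ e → pre e (σ e) Q)
        pre-sum = trans (∑-cong Q λ q lt → sym (sums q lt)) (∑-swap Q E (λ q e → a e (σ e) q))

    s₁ : ∀ e q → e < E → q < Q → Σ ℕ (Split (sz e q) (N e) (sz e q (σ e)))
    s₁ e q e<E q<Q = split-one (sz e q) (N e) (σ<N e e<E)

    s₃ : ∀ e q → e < E ∸ 1 → q < suc Q → Σ ℕ (Split (λ _ → 1) W (level (suc e) q))
    s₃ e q e< q< = let (t , p) = split-const 1 W (level≤W {suc e} {q} (<⇒≤ (E∸1<E e<)) (≤-pred q<))
                   in t , subst (λ s → Split (λ _ → 1) W s t) (*-identityˡ (level (suc e) q)) p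

    rest : ∀ {f n s} → Σ ℕ (Split f n s) → Split f n s (∑ n f ∸ s)
    rest {f} {n} {s} (t , p) = subst (Split f n s) (trans (sym (m+n∸m≡n s t)) (cong (_∸ s) (split-total p))) p

    theFlow : Flow
    theFlow = record
      { S₁ = λ e q → sz e q (σ e)     ; T₁ = λ e q → ∑ (N e) (sz e q) ∸ sz e q (σ e)
      ; S₂ = λ e _ → M * σ e          ; T₂ = λ e _ → ∑ (N e) (λ _ → M) ∸ M * σ e
      ; S₃ = λ e q → level (suc e) q  ; T₃ = λ e q → ∑ W (λ _ → 1) ∸ level (suc e) q
      ; S₄ = λ _ _ → Cap                ; T₄ = δ
      }

    theFeasible : Feasible theFlow
    theFeasible = record
      { split₁ = λ e q e<E q<Q → rest (s₁ e q e<E q<Q)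
      ; split₂ = λ e q e<E _ → rest (split-const M (N e) (<⇒≤ (σ<N e e<E)))
      ; split₃ = λ e q e< q< → rest (s₃ e q e< q<)
      ; split₄ = λ e q _ _ → subst (λ s → Split (fillSize e q) 2 s (δ e q)) (+-identityʳ Cap)
                   (subst (λ t → Split (fillSize e q) 2 (Cap + 0) t) (+-identityʳ (δ e q)) (unselect (select none)))
      }

    theLoad : ∀ i → i < bins → Flow.load theFlow i ≡ Cap
    theLoad i i< with i <? V
    ... | yes i<V with bin-surjective E i<V
    ...   | e , q , e<E , q≤ , refl = eq⇒load theFlow theFeasible e<E q≤ refl (eqn q q≤)
      where
      Acc-level : ∀ e q → Acc theFlow e q ≡ level e q
      Acc-level zero    q = refl
      Acc-level (suc e) q = refl
      Acc⁺-level : ∀ q → q ≤ Q → Acc⁺ theFlow e q ≡ level (suc e) q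
      Acc⁺-level q q≤ with suc e <? E
      ... | yes lt rewrite <⇒<ᵇ≡ lt = refl
      ... | no ≮ rewrite ≥⇒<ᵇ≡ (≮⇒≥ ≮) = trans (sym (level-E q≤)) (cong (λ m → level m q) (≤-antisym (≮⇒≥ ≮) e<E))
      In-digits : ∀ q → In theFlow e q ≡ L + M * σ e + (U ∸ pre e (σ e) q)
      In-digits zero    = lemma L U (M * σ e)
        where
        lemma : ∀ l u m → l + u + m ≡ l + m + u
        lemma = solve-∀
      In-digits (suc q) = refl
      Out-digits : ∀ q → q ≤ Q → In theFlow e q ≡ Out theFlow e q + a′ e q
      Out-digits q q≤ with q <? Q
      ... | no ≮ with refl ← ≤-antisym q≤ (≮⇒≥ ≮) rewrite ≥⇒<ᵇ≡ (≤-refl {Q}) = In-digits Q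
      ... | yes lt rewrite <⇒<ᵇ≡ lt = trans (In-digits q)
        (trans (cong (L + M * σ e +_) (pre-step e<E (σ<N e e<E) lt)) (sym (+-assoc (L + M * σ e) _ _)))
      eqn : ∀ q → q ≤ Q → In theFlow e q + Acc theFlow e q ≡ Out theFlow e q + Acc⁺ theFlow e q
      eqn q q≤ = trans (cong₂ _+_ (Out-digits q q≤) (Acc-level e q))
        (trans (lemma (Out theFlow e q) (a′ e q) (level e q))
        (cong (Out theFlow e q +_) (trans (sym (∑-last e (λ e → a′ e q))) (sym (Acc⁺-level q q≤)))))
        where
        lemma : ∀ o a l → o + a + l ≡ o + (l + a)
        lemma = solve-∀
    theLoad i i< | no i≮ with bin-surjective E {i ∸ V}
      (+-cancelˡ-< V _ _ (subst (_< V + V) (sym (m+[n∸m]≡n (≮⇒≥ i≮))) i<))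
    ...   | e , q , e<E , q≤ , eq = trans
      (cong (Flow.load theFlow) (trans (sym (m+[n∸m]≡n (≮⇒≥ i≮))) (cong (V +_) eq))) (load-star theFlow e<E q≤)

  solvable⇒asg : Solvable I → Σ (ℕ → ℕ) λ ℓ → Asg items ℓ × ∀ i → i < bins → ℓ i ≡ Cap
  solvable⇒asg (σ , p , q) = _ , flow⇒asg (theFlow σ p q) (theFeasible σ p q) , theLoad σ p q

  asg⇒solvable : ∀ {ℓ} → Asg items ℓ → (∀ i → i < bins → ℓ i ≡ Cap) → Solvable I
  asg⇒solvable p h = let (f , feas , eq) = asg⇒flow p in flow⇒solvable feas λ i i< → trans (sym (eq i)) (h i i<)

-- Assignments as packings

Item : Set
Item = ℕ × ℕ × ℕ

dest : Item → Bool → ℕ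
dest (_ , u , v) b = if b then v else u

Proper : ℕ → Item → Set
Proper k (z , u , v) = 0 < z × u < k × v < k × u ≢ v

mark : ℕ → ℕ → ℕ → Bool
mark u v i = (i ≡ᵇ u) ∨ (i ≡ᵇ v)

pairSet : ∀ k → ℕ → ℕ → Subset k
pairSet k u v = Vec.tabulate (mark u v ∘ toℕ)

map-upTo-tabulate : ∀ {A : Set} k (f : ℕ → A) g → map f (applyUpTo g k) ≡ toList (Vec.tabulate {n = k} (f ∘ g ∘ toℕ))
map-upTo-tabulate zero    f g = refl
map-upTo-tabulate (suc k) f g = cong (f (g 0) ∷_) (map-upTo-tabulate k f (g ∘ suc))

∣empty∣ : ∀ k → ∣ Vec.tabulate {n = k} (λ _ → false) ∣ ≡ 0
∣empty∣ zero    = refl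
∣empty∣ (suc k) = ∣empty∣ k

∣singleton∣ : ∀ {k v} → v < k → ∣ Vec.tabulate {n = k} (λ i → toℕ i ≡ᵇ v) ∣ ≡ 1
∣singleton∣ {suc k} {zero}  lt       = cong suc (∣empty∣ k)
∣singleton∣ {suc k} {suc v} (s≤s lt) = ∣singleton∣ lt

∨-false : ∀ b → (b ∨ false) ≡ b
∨-false false = refl
∨-false true  = refl

∣pairSet∣ : ∀ {k u v} → u < k → v < k → u ≢ v → ∣ pairSet k u v ∣ ≡ 2
∣pairSet∣ {suc k} {zero}  {zero}  _ _ ne = contradiction refl ne
∣pairSet∣ {suc k} {zero}  {suc v} _ (s≤s v<) ne = cong suc (∣singleton∣ v<)
∣pairSet∣ {suc k} {suc u} {zero}  (s≤s u<) _ ne = cong suc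
  (trans (cong (∣_∣ {k}) (tabulate-cong λ i → ∨-false (toℕ i ≡ᵇ u))) (∣singleton∣ u<))
∣pairSet∣ {suc k} {suc u} {suc v} (s≤s u<) (s≤s v<) ne = ∣pairSet∣ u< v< (ne ∘ cong suc)

does-≟ : ∀ {k} (x y : Fin k) → does (x ≟ᶠ y) ≡ (toℕ x ≡ᵇ toℕ y)
does-≟ zero    zero    = refl
does-≟ zero    (suc y) = refl
does-≟ (suc x) zero    = refl
does-≟ (suc x) (suc y) = does-≟ x y

mark-dest : ∀ z u v b → mark u v (dest (z , u , v) b) ≡ true
mark-dest z u v false rewrite ≡ᵇ-refl u = refl
mark-dest z u v true  rewrite ≡ᵇ-refl v = lemma (v ≡ᵇ u)
  where
  lemma : ∀ b → (b ∨ true) ≡ true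
  lemma false = refl
  lemma true  = refl

module _ {k : ℕ} where

  dest<k : ∀ {it} → Proper k it → ∀ b → dest it b < k
  dest<k (_ , u< , v< , _) false = u<
  dest<k (_ , u< , v< , _) true  = v<

  asg-sum : ∀ {its ℓ} → All (Proper k) its → Asg its ℓ → ∑ k ℓ ≡ sum (map proj₁ its)
  asg-sum []         p = ∑-zero k λ i _ → p i
  asg-sum {it@(z , u , v) ∷ its} (pr ∷ prs) (b , ℓ′ , p , h) = trans (∑-cong k λ i _ → h i)
    (trans (∑-+ k (put (dest it b) z) ℓ′) (cong₂ _+_ (single k (dest<k pr b)) (asg-sum prs p)))
    where
    single : ∀ k {w} → w < k → ∑ k (put w z) ≡ z
    single (suc k) {zero}  lt       = trans (cong (z +_) (∑-zero k λ _ _ → refl)) (+-identityʳ z)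
    single (suc k) {suc w} (s≤s lt) = single k lt

  assign : ∀ {its ℓ} → All (Proper k) its → Asg its ℓ → Fin (length its) → Fin k
  assign {it ∷ its} (pr ∷ prs) (b , _ , p , _) zero    = fromℕ< (dest<k pr b)
  assign {it ∷ its} (pr ∷ prs) (b , _ , p , _) (suc j) = assign prs p j

  assign-load : ∀ {its ℓ} (prs : All (Proper k) its) (p : Asg its ℓ) (i : Fin k) →
                ∑ᶠ (λ j → if does (assign prs p j ≟ᶠ i) then proj₁ (List.lookup its j) else 0) ≡ ℓ (toℕ i)
  assign-load []         p i = sym (p (toℕ i))
  assign-load {(z , u , v) ∷ its} (pr ∷ prs) (b , ℓ′ , p , h) i = trans (cong₂ _+_
    (cong (λ b → if b then z else 0)
      (trans (does-≟ (fromℕ< (dest<k pr b)) i) (cong (_≡ᵇ toℕ i) (toℕ-fromℕ< (dest<k pr b)))))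
    (assign-load prs p i)) (sym (h (toℕ i)))

  assign-mark : ∀ {its ℓ} (prs : All (Proper k) its) (p : Asg its ℓ) j →
                mark (proj₁ (proj₂ (List.lookup its j))) (proj₂ (proj₂ (List.lookup its j)))
                  (toℕ (assign prs p j)) ≡ true
  assign-mark {(z , u , v) ∷ its} (pr ∷ prs) (b , _ , p , _) zero = trans
    (cong (mark u v) (toℕ-fromℕ< (dest<k pr b))) (mark-dest z u v b)
  assign-mark {it ∷ its} (pr ∷ prs) (b , _ , p , _) (suc j) = assign-mark prs p j

  ∑ᶠ-lookup : ∀ (its : List Item) → ∑ᶠ (λ j → proj₁ (List.lookup its j)) ≡ sum (map proj₁ its)
  ∑ᶠ-lookup []         = refl
  ∑ᶠ-lookup (it ∷ its) = cong (proj₁ it +_) (∑ᶠ-lookup its)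

  module _ {its : List Item} (prs : All (Proper k) its) where

    toPacking : Packing k
    toPacking = record
      { size      = λ j → proj₁ (List.lookup its j)
      ; size>0    = λ j → proj₁ (at j)
      ; allowed   = λ j → pairSet k (proj₁ (proj₂ (List.lookup its j))) (proj₂ (proj₂ (List.lookup its j)))
      ; ∣allowed∣ = λ j → let (_ , u< , v< , ne) = at j in ∣pairSet∣ u< v< ne
      }
      where
      at : ∀ j → Proper k (List.lookup its j)
      at = go prs
        where
        go : ∀ {its} → All (Proper k) its → ∀ j → Proper k (List.lookup its j)
        go (p ∷ ps) zero    = p
        go (p ∷ ps) (suc j) = go ps j

    encode-toPacking : concat (map (encItem k) its) ≡ encodePacking toPacking
    encode-toPacking = cong concat (go its)
      where
      go : ∀ its → map (encItem k) its ≡ List.tabulate λ j → unary (proj₁ (List.lookup its j)) ++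
             toList (pairSet k (proj₁ (proj₂ (List.lookup its j))) (proj₂ (proj₂ (List.lookup its j))))
      go []         = refl
      go ((z , u , v) ∷ its) = cong₂ _∷_ (cong (unary z ++_) (map-upTo-tabulate k (mark u v) (λ i → i))) (go its)

    asg⇒packing : ∀ {ℓ B} → NonZero k → Asg its ℓ → (∀ i → i < k → ℓ i ≡ B) → RestrictedUnaryBinPacking
      (concat (map (encItem k) its)) k
    asg⇒packing {ℓ} {B} nz p h = nz , toPacking , encode-toPacking , assign prs p ,
      (λ i → trans (cong (k *_) (trans (assign-load prs p i) (h (toℕ i) (toℕ<n i))))
               (trans (sym (trans (∑-cong k h) (∑-const k B))) (trans (asg-sum prs p) (sym (∑ᶠ-lookup its))))) ,
      λ { _ j refl → lookup⇒[]= _ _ (trans (lookup∘tabulate (mark _ _ ∘ toℕ) (assign prs p j)) (assign-mark prs p j)) }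

unary-injective : ∀ m n {xs ys} → unary m ++ xs ≡ unary n ++ ys → m ≡ n × xs ≡ ys
unary-injective zero    zero    eq = refl , proj₂ (∷-injective eq)
unary-injective zero    (suc n) ()
unary-injective (suc m) zero    ()
unary-injective (suc m) (suc n) eq = let (p , q) = unary-injective m n (proj₂ (∷-injective eq)) in cong suc p , q

++-split : ∀ {A : Set} (xs ys : List A) {xs′ ys′} → length xs ≡ length ys → xs ++ xs′ ≡ ys ++ ys′ → xs ≡ ys × xs′ ≡ ys′
++-split []       []       _   eq = refl , eq
++-split (x ∷ xs) (y ∷ ys) len eq =
  let (p , q) = ∷-injective eq ; (r , s) = ++-split xs ys (suc-injective len) q in cong₂ _∷_ p r , s

encItem-injective : ∀ k z (a : Vec Bool k) {xs} it {ys} → (unary z ++ toList a) ++ xs ≡ encItem k it ++ ys →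
                    z ≡ proj₁ it × a ≡ pairSet k (proj₁ (proj₂ it)) (proj₂ (proj₂ it)) × xs ≡ ys
encItem-injective k z a {xs} (z′ , u , v) {ys} eq =
  let bits = map (mark u v) (upTo k)
      bits≡ = map-upTo-tabulate k (mark u v) (λ i → i)
      (p , q) = unary-injective z z′ (trans (sym (++-assoc (unary z) (toList a) xs))
        (trans eq (++-assoc (unary z′) bits ys)))
      (r , s) = ++-split (toList a) bits
        (trans (length-toList a) (sym (trans (cong length bits≡) (length-toList (pairSet k u v))))) q
  in p , toList-inj a (pairSet k u v) (trans r bits≡) , s
  where
  toList-inj : ∀ {n} (a b : Vec Bool n) → toList a ≡ toList b → a ≡ b
  toList-inj []      []      eq = refl
  toList-inj (x ∷ a) (y ∷ b) eq = cong₂ _∷_ (proj₁ (∷-injective eq)) (toList-inj a b (proj₂ (∷-injective eq)))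

unary≢[] : ∀ z {xs ys} → (unary z ++ xs) ++ ys ≢ []
unary≢[] zero    ()
unary≢[] (suc z) ()

mark⇒dest : ∀ z u v i → mark u v i ≡ true → Σ Bool λ b → dest (z , u , v) b ≡ i
mark⇒dest z u v i h with i ≟ u | i ≟ v
... | yes refl | _        = false , refl
... | no _     | yes refl = true , refl
... | no ≢u    | no ≢v    with () ← trans (sym h) (cong₂ _∨_ (≢⇒≡ᵇ ≢u) (≢⇒≡ᵇ ≢v))

-- The packing behind a word is arbitrary, and only its encoding is known to agree with that of the
-- items. A unary size marks its own end and exactly `k` bits follow, so sizes and allowed bins can
-- be recovered item by item.
packing⇒asg : ∀ {k} m (size : Fin m → ℕ) (allowed : Fin m → Subset k) (bin : Fin m → Fin k) (its : List Item) →
              concat (List.tabulate λ j → unary (size j) ++ toList (allowed j)) ≡ concat (map (encItem k) its) →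
              (∀ j → bin j ∈ˢ allowed j) →
              (∑ᶠ size ≡ sum (map proj₁ its)) ×
                (Σ (ℕ → ℕ) λ ℓ → Asg its ℓ × ∀ i → ℓ (toℕ i) ≡ ∑ᶠ (λ j → if does (bin j ≟ᶠ i) then size j else 0))
packing⇒asg zero size allowed bin [] eq resp = refl , (λ _ → 0) , (λ _ → refl) , λ _ → refl
packing⇒asg zero size allowed bin ((z , u , v) ∷ its) eq resp = contradiction (sym eq) (unary≢[] z)
packing⇒asg (suc m) size allowed bin [] eq resp = contradiction eq (unary≢[] (size zero))
packing⇒asg {k} (suc m) size allowed bin (it@(z , u , v) ∷ its) eq resp =
  let (z≡ , a≡ , rest) = encItem-injective k (size zero) (allowed zero) it eq
      (s≡ , ℓ , p , h) = packing⇒asg m (size ∘ suc) (allowed ∘ suc) (bin ∘ suc) its rest (resp ∘ suc)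
      (b , d≡) = mark⇒dest z u v (toℕ (bin zero)) (trans (sym (lookup∘tabulate (mark u v ∘ toℕ) (bin zero)))
                   (trans (cong (λ a → Vec.lookup a (bin zero)) (sym a≡)) ([]=⇒lookup (resp zero))))
  in cong₂ _+_ z≡ s≡ , (λ i → put (dest it b) z i + ℓ i) , (b , ℓ , p , λ _ → refl) ,
     λ i → cong₂ _+_ (trans (cong (λ b → if b then z else 0) (trans (cong (_≡ᵇ toℕ i) d≡) (sym (does-≟ (bin zero) i))))
                            (cong (λ z → if does (bin zero ≟ᶠ i) then z else 0) (sym z≡))) (h i)

rubp⇒asg : ∀ {k B its} → RestrictedUnaryBinPacking (concat (map (encItem k) its)) k → sum (map proj₁ its) ≡ k * B →
           Σ (ℕ → ℕ) λ ℓ → Asg its ℓ × ∀ i → i < k → ℓ i ≡ B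
rubp⇒asg {k} {B} {its} (nz , P , eq , bin , bal , resp) total =
  let (s≡ , ℓ , p , h) = packing⇒asg _ (Packing.size P) (Packing.allowed P) bin its (sym eq) (λ j → resp (bin j) j refl)
  in ℓ , p , λ i i<k → let f = fromℕ< i<k in
       *-cancelˡ-≡ (ℓ i) B k ⦃ nz ⦄ (trans (cong (k *_) (trans (cong ℓ (sym (toℕ-fromℕ< i<k))) (h f)))
         (trans (bal f) (trans s≡ total)))

≡ᵇ-sound : ∀ {m n} → (m ≡ᵇ n) ≡ true → m ≡ n
≡ᵇ-sound {m} {n} h = ≡ᵇ⇒≡ m n (subst T (sym h) tt)

module GridPacking (I : Instance) (E>0 : 0 < Instance.E I) (Q>0 : 0 < Instance.Q I) where
  open Instance I
  open Grid I
  open GridBins I Q>0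
  open GridFlow I E>0 Q>0

  all-grid : ∀ {P : ℕ × ℕ × ℕ → Set} m n f → (∀ e q → e < m → q < n → All P (f e q)) → All P (grid m n f)
  all-grid m n f h = All.concat⁺ (All.map⁺
    (All.applyUpTo⁺₁ (λ e → e) m λ {e} e< → All.concat⁺
      (All.map⁺ (All.applyUpTo⁺₁ (λ q → q) n λ {q} q< → h e q e< q<))))

  proper : ∀ {z u v} → 0 < z → u < V → v < V → u ≢ v → Proper bins (z , u , v)
  proper z> u< v< ne = z> , ≤-trans u< (m≤m+n V V) , ≤-trans v< (m≤m+n V V) , ne

  items-proper : All (Proper bins) items
  items-proper =
    All.++⁺ (all-grid E Q choiceItems λ e q e< q< → All.map⁺ (All.applyUpTo⁺₁ (λ s → s) (N e) λ {s} _ →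
           proper (≤-trans (R<L z≤n) (≤-trans (m≤m+n L (M * s)) (m≤m+n (L + M * s) _)))
             (bin<V e< (<⇒≤ q<)) (bin<V e< q<)
                  (λ eq → 1+n≢n (sym (proj₂ (bin-injective {e} {e} (<⇒≤ q<) q< eq))))))
    (All.++⁺ (all-grid E 1 returnItems λ e q e< q< → All.map⁺ (All.applyUpTo⁺₁ (λ s → s) (N e) λ {s} _ →
           proper (s≤s z≤n) (bin<V e< ≤-refl) (bin<V e< z≤n)
             (λ eq → Q≢0 (proj₂ (bin-injective {e} {e} ≤-refl z≤n eq)))))
    (All.++⁺ (all-grid (E ∸ 1) (suc Q) sumItems λ e q e< q< → All.map⁺ (All.applyUpTo⁺₁ (λ s → s) W λ {s} _ →
           proper (s≤s z≤n) (bin<V (≤-trans e< (m∸n≤m E 1)) (≤-pred q<)) (bin<V (E∸1<E e<) (≤-pred q<))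
                  (λ eq → 1+n≢n (sym (proj₁ (bin-injective {e} {suc e} (≤-pred q<) (≤-pred q<) eq))))))
      (all-grid E (suc Q) fillItems λ e q e< q< → fill (δ>0 e< (≤-pred q<))
        (bin<V e< (≤-pred q<)) ∷ fill (s≤s z≤n) (bin<V e< (≤-pred q<)) ∷ [])))
    where
    fill : ∀ {z u} → 0 < z → u < V → Proper bins (z , u , V + u)
    fill z> u< = z> , ≤-trans u< (m≤m+n V V) , +-monoʳ-< V u< , λ eq → <⇒≱ u<
      (≤-trans (m≤m+n V _) (≤-reflexive (sym eq)))

  nonZero-bins : NonZero bins
  nonZero-bins = >-nonZero′ (≤-trans (*-mono-≤ E>0 (s≤s {n = Q} z≤n)) (m≤m+n V V))
    where
    >-nonZero′ : ∀ {n} → 0 < n → NonZero n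
    >-nonZero′ (s≤s _) = _

  solvable⇔packing : Solvable I ⇔ RestrictedUnaryBinPacking (proj₁ output) (proj₂ output)
  solvable⇔packing = mk⇔ forward backward
    where
    forward : Solvable I → RestrictedUnaryBinPacking (proj₁ output) (proj₂ output)
    forward s = subst (λ b → let o = if b then (concat (map (encItem bins) items) , bins) else ([] , 0) in RestrictedUnaryBinPacking (proj₁ o) (proj₂ o))
      (sym ok) (asg⇒packing items-proper nonZero-bins p h)
      where
      p = proj₁ (proj₂ (solvable⇒asg s))
      h = proj₂ (proj₂ (solvable⇒asg s))
      -- The loads add up to the total size, so if all of them are `Cap`, the test succeeds.
      ok : consistent ≡ true
      ok = trans (cong (_≡ᵇ bins * Cap)
        (trans (sym (asg-sum items-proper p)) (trans (∑-cong bins h) (∑-const bins Cap)))) (≡ᵇ-refl (bins * Cap))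
    backward : RestrictedUnaryBinPacking (proj₁ output) (proj₂ output) → Solvable I
    backward = go consistent refl
      where
      go : ∀ b → consistent ≡ b → (let o = if b then (concat (map (encItem bins) items) , bins) else ([] , 0) in RestrictedUnaryBinPacking (proj₁ o) (proj₂ o)) → Solvable I
      go true eq r = let (ℓ , p , h) = rubp⇒asg r (≡ᵇ-sound eq) in asg⇒solvable p h
      go false _ (() , _)

∧-true : ∀ {a b} → a ∧ b ≡ true → a ≡ true × b ≡ true
∧-true {true} h = refl , h

∧-intro : ∀ {a b} → a ≡ true → b ≡ true → a ∧ b ≡ true
∧-intro refl h = h

<ᵇ-sound : ∀ {m n} → (m <ᵇ n) ≡ true → m < n
<ᵇ-sound {m} {n} h = <ᵇ⇒< m n (subst T (sym h) tt)

-- Raw and typed circuits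

tag : ∀ {w} → Gate w → ℕ
tag (¬ᵍ _) = 1
tag (⋀ _)  = 2
tag (⋁ _)  = 3

rawGate : ∀ {w} → Gate w → El RGate
rawGate g = tag g , map toℕ (preds g)

rawGates : ∀ {n w} → Gates n w → List (El RGate)
rawGates inputs   = []
rawGates (G ▷ g)  = rawGate g ∷ rawGates G

rawCircuit : Circuit → El RCircuit
rawCircuit C = #inputs , rawGates gates , toℕ output
  where open Circuit C

length-rawGates : ∀ {n w} (G : Gates n w) → length (rawGates G) + n ≡ w
length-rawGates inputs  = refl
length-rawGates (G ▷ g) = cong suc (length-rawGates G)

-- Circuits as strings

encIndices-raw : ∀ {w} (is : List (Fin w)) → encIndices (map toℕ is) ≡ encodeIndices is
encIndices-raw is = cong (λ z → concat z ++ [ false ]) (sym (map-∘ is))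

encGate-raw : ∀ {w} (g : Gate w) → encGate (rawGate g) ≡ encodeGate g
encGate-raw (¬ᵍ i) = refl
encGate-raw (⋀ is) = cong (λ z → true ∷ false ∷ z) (encIndices-raw is)
encGate-raw (⋁ is) = cong (λ z → true ∷ true ∷ z) (encIndices-raw is)

encGates-raw : ∀ {n w} (G : Gates n w) → encGates (rawGates G) ≡ encodeGates G
encGates-raw inputs  = refl
encGates-raw (G ▷ g) = cong₂ (λ s z → s ++ true ∷ z) (encGates-raw G) (encGate-raw g)

encRaw-raw : ∀ C → encRaw (rawCircuit C) ≡ encodeCircuit C
encRaw-raw C = cong (λ z → unary #inputs ++ z ++ false ∷ unary (toℕ output)) (encGates-raw gates)
  where open Circuit C

run : El State → List Bool → El State
run = foldl (λ s b → parseStep b s)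

run-++ : ∀ s xs ys → run s (xs ++ ys) ≡ run (run s xs) ys
run-++ = foldl-++ (λ s b → parseStep b s)

run-inputs : ∀ j {c n t is gs} → run (0 , c , n , t , is , gs) (unary j) ≡ (1 , 0 , c + j , t , is , gs)
run-inputs zero    {c} {n} {t} {is} {gs} = cong (λ z → 1 , 0 , z , t , is , gs) (sym (+-identityʳ c))
run-inputs (suc j) {c} {n} {t} {is} {gs} = trans (run-inputs j) (cong (λ z → 1 , 0 , z , t , is , gs) (sym (+-suc c j)))

run-not : ∀ j {c n t is gs} → run (3 , c , n , t , is , gs) (unary j) ≡ (1 , 0 , n , t , is , (1 , c + j ∷ []) ∷ gs)
run-not zero    {c} {n} {t} {is} {gs} = cong (λ z → 1 , 0 , n , t , is , (1 , z ∷ []) ∷ gs) (sym (+-identityʳ c))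
run-not (suc j) {c} {n} {t} {is} {gs} = trans (run-not j)
  (cong (λ z → 1 , 0 , n , t , is , (1 , z ∷ []) ∷ gs) (sym (+-suc c j)))

run-index : ∀ j {c n t is gs} → run (6 , c , n , t , is , gs) (unary j) ≡ (5 , 0 , n , t , c + j ∷ is , gs)
run-index zero    {c} {n} {t} {is} {gs} = cong (λ z → 5 , 0 , n , t , z ∷ is , gs) (sym (+-identityʳ c))
run-index (suc j) {c} {n} {t} {is} {gs} = trans (run-index j)
  (cong (λ z → 5 , 0 , n , t , z ∷ is , gs) (sym (+-suc c j)))

run-output : ∀ j {c n t is gs} → run (7 , c , n , t , is , gs) (unary j) ≡ (8 , c + j , n , t , is , gs)
run-output zero    {c} {n} {t} {is} {gs} = cong (λ z → 8 , z , n , t , is , gs) (sym (+-identityʳ c))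
run-output (suc j) {c} {n} {t} {is} {gs} = trans (run-output j) (cong (λ z → 8 , z , n , t , is , gs) (sym (+-suc c j)))

-- Arguments accumulate in reverse; `result` turns them round only after the whole word has been
-- read.
run-indices : ∀ js {n t is gs} → run (5 , 0 , n , t , is , gs) (encIndices js) ≡
  (1 , 0 , n , t , [] , (t , js ʳ++ is) ∷ gs)
run-indices []       = refl
run-indices (j ∷ js) {n} {t} {is} {gs} = trans
  (cong (run (6 , 0 , n , t , is , gs)) (++-assoc (unary j) (concat (map (λ i → true ∷ unary i) js)) [ false ]))
  (trans (run-++ (6 , 0 , n , t , is , gs) (unary j) (encIndices js))
    (trans (cong (λ s → run s (encIndices js)) (run-index j)) (run-indices js)))

reversed : El RGate → El RGate
reversed (t , is) = t , reverse is

run-gate : ∀ {w} (g : Gate w) {n t is gs} → Σ ℕ λ t′ → Σ (List ℕ) λ is′ →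
           run (1 , 0 , n , t , is , gs) (true ∷ encGate (rawGate g)) ≡
             (1 , 0 , n , t′ , is′ , reversed (rawGate g) ∷ gs)
run-gate (¬ᵍ i) = _ , _ , run-not (toℕ i)
run-gate (⋀ is) = _ , _ , run-indices (map toℕ is)
run-gate (⋁ is) = _ , _ , run-indices (map toℕ is)

run-gates : ∀ {n w m} (G : Gates m w) → Σ ℕ λ t′ → Σ (List ℕ) λ is′ →
            run (1 , 0 , n , 0 , [] , []) (encGates (rawGates G)) ≡ (1 , 0 , n , t′ , is′ , map reversed (rawGates G))
run-gates inputs = 0 , [] , refl
run-gates {n} (G ▷ g) =
  let (t , is , eq) = run-gates {n} G ; (t′ , is′ , eq′) = run-gate g
  in t′ , is′ , trans (run-++ (1 , 0 , n , 0 , [] , []) (encGates (rawGates G)) (true ∷ encGate (rawGate g)))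
                  (trans (cong (λ s → run s (true ∷ encGate (rawGate g))) eq) eq′)

parse-raw : ∀ C → parse (encRaw (rawCircuit C)) ≡ rawCircuit C
parse-raw C =
  let (t , is , eq) = run-gates {#inputs} gates
      rest = encGates (rawGates gates) ++ false ∷ unary (toℕ output)
  in trans (cong result (trans (run-++ start (unary #inputs) rest) (trans (cong (λ s → run s rest) (run-inputs #inputs))
       (trans (run-++ (1 , 0 , #inputs , 0 , [] , []) (encGates (rawGates gates)) (false ∷ unary (toℕ output)))
         (trans (cong (λ s → run s (false ∷ unary (toℕ output))) eq) (run-output (toℕ output)))))))
     (cong (λ z → #inputs , z , toℕ output) (trans (sym (map-∘ (rawGates gates)))
       (trans (map-cong (λ g → cong (proj₁ g ,_) (reverse-involutive (proj₂ g))) (rawGates gates))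
         (map-id (rawGates gates)))))
  where open Circuit C

eqBits-refl : ∀ x → eqBits x x ≡ true
eqBits-refl []          = refl
eqBits-refl (false ∷ x) = eqBits-refl x
eqBits-refl (true ∷ x)  = eqBits-refl x

eqBits-sound : ∀ x y → eqBits x y ≡ true → x ≡ y
eqBits-sound []          []          h = refl
eqBits-sound (false ∷ x) (false ∷ y) h = cong (false ∷_) (eqBits-sound x y h)
eqBits-sound (true ∷ x)  (true ∷ y)  h = cong (true ∷_) (eqBits-sound x y h)

gateOK-raw : ∀ {w} (g : Gate w) → gateOK w (rawGate g) ≡ true
gateOK-raw {w} g = ∧-intro (shape g) (inRange (preds g))
  where
  shape : ∀ {w} (g : Gate w) → (if tag g ≡ᵇ 1 then length (map toℕ (preds g)) ≡ᵇ 1 else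
    ((tag g ≡ᵇ 2) ∨ (tag g ≡ᵇ 3))) ≡ true
  shape (¬ᵍ i) = refl
  shape (⋀ is) = refl
  shape (⋁ is) = refl
  inRange : ∀ is → all (_<ᵇ w) (map toℕ is) ≡ true
  inRange []       = refl
  inRange (i ∷ is) = ∧-intro (<⇒<ᵇ≡ (toℕ<n i)) (inRange is)

scoped-raw : ∀ {n w} (G : Gates n w) → scoped n (rawGates G) ≡ true
scoped-raw inputs  = refl
scoped-raw {n} (G ▷ g) = ∧-intro
  (trans (cong (λ w → gateOK w (rawGate g)) (length-rawGates G)) (gateOK-raw g)) (scoped-raw G)

typedIndices : ∀ w is → all (_<ᵇ w) is ≡ true → Σ (List (Fin w)) λ js → map toℕ js ≡ is
typedIndices w []       h = [] , refl
typedIndices w (i ∷ is) h = let (p , q) = ∧-true h ; (js , eq) = typedIndices w is q in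
  fromℕ< (<ᵇ-sound p) ∷ js , cong₂ _∷_ (toℕ-fromℕ< (<ᵇ-sound p)) eq

typedGate : ∀ w g → gateOK w g ≡ true → Σ (Gate w) λ g′ → rawGate g′ ≡ g
typedGate w (t , is) h with ∧-true h
... | shape , range with typedIndices w is range
typedGate w (1 , i ∷ [])    h | shape , range | j ∷ [] , eq = ¬ᵍ j , cong (1 ,_) eq
typedGate w (2 , is)        h | shape , range | js , eq = ⋀ js , cong (2 ,_) eq
typedGate w (3 , is)        h | shape , range | js , eq = ⋁ js , cong (3 ,_) eq

typedGates : ∀ n gs → scoped n gs ≡ true → Σ (Gates n (length gs + n)) λ G → rawGates G ≡ gs
typedGates n []       h = inputs , refl
typedGates n (g ∷ gs) h =
  let (p , q) = ∧-true h ; (G , eq) = typedGates n gs q ; (g′ , eq′) = typedGate (length gs + n) g p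
  in G ▷ g′ , cong₂ _∷_ eq′ eq

-- Circuits as formulas

drop-[] : ∀ {A : Set} i → drop {A = A} i [] ≡ []
drop-[] zero    = refl
drop-[] (suc i) = refl

isZero-tag : ∀ {w} (g : Gate w) → isZero (tag g) ≡ false
isZero-tag (¬ᵍ _) = refl
isZero-tag (⋀ _)  = refl
isZero-tag (⋁ _)  = refl

all-max : ∀ {w m} (f : ℕ → Bool) (h : Fin w → ℕ) is → (∀ i → f (toℕ i) ≡ true ⇔ h i ≤ m) → all f
  (map toℕ is) ≡ true ⇔ maximum (map h is) ≤ m
all-max f h []       eq = mk⇔ (λ _ → z≤n) (λ _ → refl)
all-max f h (i ∷ is) eq = mk⇔
  (λ p → let (a , b) = ∧-true p in ⊔-lub (to (eq i) a) (to (all-max f h is eq) b))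
  (λ le → ∧-intro (from (eq i) (≤-trans (m≤m⊔n (h i) _) le)) (from (all-max f h is eq) (≤-trans (m≤n⊔m (h i) _) le)))

depths wefts : ∀ {n w} → Gates n w → Vec ℕ w
depths {n} G = annotate gateDepth (Vec.replicate n 0) G
wefts  {n} G = annotate gateWeft (Vec.replicate n 0) G

depthOK⇔ : ∀ δ {n w} (G : Gates n w) i → depthOK δ (rawGates G) (toℕ i) ≡ true ⇔ lookup (depths G) i ≤ δ
depthOK⇔ zero    {n} inputs  i rewrite drop-[] {El RGate} (toℕ i) | lookup-replicate {n = n} i 0 = mk⇔
  (λ _ → z≤n) (λ _ → refl)
depthOK⇔ zero    (G ▷ g) zero    = mk⇔ (λ ()) (λ ())
depthOK⇔ zero    (G ▷ g) (suc i) = depthOK⇔ zero G i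
depthOK⇔ (suc δ) {n} inputs  i rewrite drop-[] {El RGate} (toℕ i) | lookup-replicate {n = n} i 0 = mk⇔
  (λ _ → z≤n) (λ _ → refl)
depthOK⇔ (suc δ) (G ▷ g) zero    = mk⇔ (λ p → s≤s (to e p)) (λ { (s≤s le) → from e le })
  where e = all-max (depthOK δ (rawGates G)) (lookup (depths G)) (preds g) (depthOK⇔ δ G)
depthOK⇔ (suc δ) (G ▷ g) (suc i) = depthOK⇔ (suc δ) G i

-- The equivalence for an argument is available only if its depth is small enough, as `unroll`
-- distorts deeper nodes; `ok` carries this condition.
all-max-map : ∀ {w m} {A : Set} (f : A → Bool) (u : ℕ → A) (ok : ℕ → Bool) (h : Fin w → ℕ) is →
              (∀ i → ok (toℕ i) ≡ true → f (u (toℕ i)) ≡ true ⇔ h i ≤ m) → all ok (map toℕ is) ≡ true →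
              all f (map u (map toℕ is)) ≡ true ⇔ maximum (map h is) ≤ m
all-max-map f u ok h []       eq oks = mk⇔ (λ _ → z≤n) (λ _ → refl)
all-max-map f u ok h (i ∷ is) eq oks = let (o , os) = ∧-true oks in mk⇔
  (λ p → let (a , b) = ∧-true p in ⊔-lub (to (eq i o) a) (to (all-max-map f u ok h is eq os) b))
  (λ le → ∧-intro (from (eq i o) (≤-trans (m≤m⊔n (h i) _) le))
    (from (all-max-map f u ok h is eq os) (≤-trans (m≤n⊔m (h i) _) le)))

length-args : ∀ {w} {A : Set} (u : ℕ → A) (is : List (Fin w)) → length (map u (map toℕ is)) ≡ length is
length-args u is = trans (length-map u (map toℕ is)) (length-map toℕ is)

weft₀⇔ : ∀ δ {n w} (G : Gates n w) i → depthOK δ (rawGates G) (toℕ i) ≡ true →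
         weft₀ δ (unroll δ (rawGates G) (toℕ i)) ≡ true ⇔ lookup (wefts G) i ≤ 0
weft₀⇔ zero    {n} inputs  i ok rewrite lookup-replicate {n = n} i 0 = mk⇔ (λ _ → z≤n) (λ _ → refl)
weft₀⇔ zero    (G ▷ g) zero ()
weft₀⇔ zero    (G ▷ g) (suc i) ok = weft₀⇔ zero G i ok
weft₀⇔ (suc δ) {n} inputs  i ok rewrite drop-[] {El RGate} (toℕ i) | lookup-replicate {n = n} i 0 = mk⇔
  (λ _ → z≤n) (λ _ → refl)
weft₀⇔ (suc δ) (G ▷ g) zero ok rewrite isZero-tag g | length-args (unroll δ (rawGates G))
  (preds g) with 2 <ᵇ length (preds g)
... | true  = mk⇔ (λ ()) (λ ())
... | false = all-max-map (weft₀ δ) (unroll δ (rawGates G)) (depthOK δ (rawGates G)) (lookup (wefts G))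
  (preds g) (weft₀⇔ δ G) ok
weft₀⇔ (suc δ) (G ▷ g) (suc i) ok = weft₀⇔ (suc δ) G i ok

weft₁⇔ : ∀ δ {n w} (G : Gates n w) i → depthOK δ (rawGates G) (toℕ i) ≡ true →
         weft₁ δ (unroll δ (rawGates G) (toℕ i)) ≡ true ⇔ lookup (wefts G) i ≤ 1
weft₁⇔ zero    {n} inputs  i ok rewrite lookup-replicate {n = n} i 0 = mk⇔ (λ _ → z≤n) (λ _ → refl)
weft₁⇔ zero    (G ▷ g) zero ()
weft₁⇔ zero    (G ▷ g) (suc i) ok = weft₁⇔ zero G i ok
weft₁⇔ (suc δ) {n} inputs  i ok rewrite drop-[] {El RGate} (toℕ i) | lookup-replicate {n = n} i 0 = mk⇔
  (λ _ → z≤n) (λ _ → refl)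
weft₁⇔ (suc δ) (G ▷ g) zero ok rewrite isZero-tag g | length-args (unroll δ (rawGates G))
  (preds g) with 2 <ᵇ length (preds g)
... | true  = let e = all-max-map (weft₀ δ) (unroll δ (rawGates G)) (depthOK δ (rawGates G)) (lookup (wefts G)) (preds g) (weft₀⇔ δ G) ok
              in mk⇔ (λ p → s≤s (to e p)) (λ { (s≤s le) → from e le })
... | false = all-max-map (weft₁ δ) (unroll δ (rawGates G)) (depthOK δ (rawGates G)) (lookup (wefts G))
  (preds g) (weft₁⇔ δ G) ok
weft₁⇔ (suc δ) (G ▷ g) (suc i) ok = weft₁⇔ (suc δ) G i ok

gateValue-op : ∀ {w} (g : Gate w) vs → gateOp (tag g) (map (lookup vs) (preds g)) ≡ gateValue g vs
gateValue-op (¬ᵍ i) vs = cong not (∧-identityʳ (lookup vs i))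
gateValue-op (⋀ is) vs = refl
gateValue-op (⋁ is) vs = refl

module _ {n} (a : Vec Bool n) (B : List ℕ) (B≈a : ∀ p → memb (toℕ p) B ≡ lookup a p) where

  val-unroll : ∀ δ {w} (G : Gates n w) i → depthOK δ (rawGates G) (toℕ i) ≡ true →
               val δ (unroll δ (rawGates G) (toℕ i)) B ≡ lookup (annotate gateValue a G) i
  vals-unroll : ∀ δ {w} (G : Gates n w) is → all (depthOK δ (rawGates G)) (map toℕ is) ≡ true →
                map (λ c → val δ c B) (map (unroll δ (rawGates G)) (map toℕ is)) ≡ map
                  (lookup (annotate gateValue a G)) is
  val-unroll zero    inputs  i       ok = B≈a i
  val-unroll zero    (G ▷ g) zero    ()
  val-unroll zero    (G ▷ g) (suc i) ok = val-unroll zero G i ok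
  val-unroll (suc δ) inputs  i       ok rewrite drop-[] {El RGate} (toℕ i) = B≈a i
  val-unroll (suc δ) (G ▷ g) zero    ok rewrite isZero-tag g =
    trans (cong (gateOp (tag g)) (vals-unroll δ G (preds g) ok)) (gateValue-op g (annotate gateValue a G))
  val-unroll (suc δ) (G ▷ g) (suc i) ok = val-unroll (suc δ) G i ok
  vals-unroll δ G []       ok = refl
  vals-unroll δ G (i ∷ is) ok = let (o , os) = ∧-true ok in cong₂ _∷_ (val-unroll δ G i o) (vals-unroll δ G is os)

-- Satisfying assignments as increasing lists

positions : ∀ {n} → ℕ → Subset n → List ℕ
positions j []      = []
positions j (b ∷ a) = if b then j ∷ positions (suc j) a else positions (suc j) a

length-positions : ∀ {n} j (a : Subset n) → length (positions j a) ≡ ∣ a ∣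
length-positions j []          = refl
length-positions j (true ∷ a)  = cong suc (length-positions (suc j) a)
length-positions j (false ∷ a) = length-positions (suc j) a

memb-below : ∀ {n i j} (a : Subset n) → i < j → memb i (positions j a) ≡ false
memb-below []          lt = refl
memb-below (true ∷ a)  lt rewrite ≢⇒≡ᵇ (<⇒≢ lt) = memb-below a (m≤n⇒m≤1+n lt)
memb-below (false ∷ a) lt = memb-below a (m≤n⇒m≤1+n lt)

memb-positions : ∀ {n} j (a : Subset n) p → memb (j + toℕ p) (positions j a) ≡ lookup a p
memb-positions j (true ∷ a)  zero    rewrite +-identityʳ j | ≡ᵇ-refl j = refl
memb-positions j (false ∷ a) zero    rewrite +-identityʳ j = memb-below a ≤-refl
memb-positions j (true ∷ a)  (suc p) rewrite +-suc j (toℕ p) | ≢⇒≡ᵇ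
  (>⇒≢ (s≤s (m≤m+n j (toℕ p)))) = memb-positions (suc j) a p
memb-positions j (false ∷ a) (suc p) rewrite +-suc j (toℕ p) = memb-positions (suc j) a p

FormulaSat : ∀ d → El (F d) → ℕ → ℕ → Set
FormulaSat d φ n k = Σ (Subset n) λ a → ∣ a ∣ ≡ k × val d φ (positions 0 a) ≡ true

circuit⇔formula : ∀ d x k → let (n , gs , o) = parse x in
                  WeightedCircuitSat 1 d x k ⇔ (valid d (x , parse x) ≡ true × FormulaSat d (unroll d gs o) n k)
circuit⇔formula d x k = mk⇔ forward backward
  where
  Goal : El RCircuit → Set
  Goal (n , gs , o) = valid d (x , n , gs , o) ≡ true × FormulaSat d (unroll d gs o) n k
  forward : WeightedCircuitSat 1 d x k → Goal (parse x)
  forward (C , refl , weft≤ , depth≤ , a , |a| , sat) = subst Goal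
    (sym (trans (cong parse (sym (encRaw-raw C))) (parse-raw C)))
    (∧-intro (trans (cong (λ y → eqBits (encodeCircuit C) y) (encRaw-raw C)) (eqBits-refl (encodeCircuit C)))
      (∧-intro (scoped-raw gates) (∧-intro (<⇒<ᵇ≡ (subst (toℕ output <_) (sym (length-rawGates gates)) (toℕ<n output)))
        (∧-intro ok (from (weft₁⇔ d gates output ok) weft≤)))) ,
     a , |a| , trans (val-unroll a (positions 0 a) (memb-positions 0 a) d gates output ok) sat)
    where
    open Circuit C
    ok = from (depthOK⇔ d gates output) depth≤
  backward : Goal (parse x) → WeightedCircuitSat 1 d x k
  backward (v , s) = go (parse x) v s
    where
    Conclusion : ℕ → List (El RGate) → ℕ → Set
    Conclusion n gs o = eqBits x (encRaw (n , gs , o)) ≡ true → depthOK d gs o ≡ true → weft₁ d (unroll d gs o) ≡ true →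
                        FormulaSat d (unroll d gs o) n k → WeightedCircuitSat 1 d x k
    typed : ∀ {n w} (G : Gates n w) (j : Fin w) → Conclusion n (rawGates G) (toℕ j)
    typed G j e ok w (a , |a| , sat) =
      circuit , trans (eqBits-sound x _ e) (encRaw-raw circuit) , to (weft₁⇔ d G j ok) w , to (depthOK⇔ d G j) ok ,
      a , |a| , trans (sym (val-unroll a (positions 0 a) (memb-positions 0 a) d G j ok)) sat
      where
      circuit : Circuit
      circuit = record { gates = G ; output = j }
    go : ∀ R → valid d (x , R) ≡ true → FormulaSat d (unroll d (proj₁ (proj₂ R)) (proj₂ (proj₂ R)))
      (proj₁ R) k → WeightedCircuitSat 1 d x k
    go (n , gs , o) v s =
      let (e , v₁)  = ∧-true v
          (sc , v₂) = ∧-true v₁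
          (o< , v₃) = ∧-true v₂
          (ok , w)  = ∧-true v₃
          (G , eq)  = typedGates n gs sc
      in subst₂ (Conclusion n) eq (toℕ-fromℕ< (<ᵇ-sound o<)) (typed G (fromℕ< (<ᵇ-sound o<))) e ok w s

open import Data.Integer using (ℤ; +_; 0ℤ) renaming (_+_ to _+ᶻ_; _-_ to _-ᶻ_; _*_ to _*ᶻ_)
open import Data.Integer.Properties using (pos-+; pos-*; +-injective; ⊖-≥; m-n≡m⊖n)
  renaming (+-identityʳ to +ᶻ-identityʳ; +-identityˡ to +ᶻ-identityˡ; *-zeroʳ to *ᶻ-zeroʳ)
open import Data.Integer.Tactic.RingSolver using () renaming (solve-∀ to solveᶻ-∀)

-- Reading values off digests

nth-map : ∀ {A B : Set} (f : A → B) d d′ l {i} → i < length l → nth d (map f l) i ≡ f (nth d′ l i)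
nth-map f d d′ (x ∷ l) {zero}  lt       = refl
nth-map f d d′ (x ∷ l) {suc i} (s≤s lt) = nth-map f d d′ l lt

nth-++ˡ : ∀ {A : Set} (d : A) l l′ {i} → i < length l → nth d (l ++ l′) i ≡ nth d l i
nth-++ˡ d (x ∷ l) l′ {zero}  lt       = refl
nth-++ˡ d (x ∷ l) l′ {suc i} (s≤s lt) = nth-++ˡ d l l′ lt

nth-++ʳ : ∀ {A : Set} (d : A) l l′ i → nth d (l ++ l′) (length l + i) ≡ nth d l′ i
nth-++ʳ d []      l′ i = refl
nth-++ʳ d (x ∷ l) l′ i = nth-++ʳ d l l′ i

nth-applyUpTo : ∀ {A : Set} (d : A) g n {i} → i < n → nth d (applyUpTo g n) i ≡ g i
nth-applyUpTo d g (suc n) {zero}  lt       = refl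
nth-applyUpTo d g (suc n) {suc i} (s≤s lt) = nth-applyUpTo d (g ∘ suc) n lt

length-prodTable : ∀ t T₀ T₁ → length (prodTable t T₀ T₁) ≡ length T₁ * length T₀
length-prodTable t T₀ []       = refl
length-prodTable t T₀ (b ∷ T₁) = trans (length-++ (map (λ b₀ → gateOp t (b₀ ∷ b ∷ [])) T₀))
  (cong₂ _+_ (length-map _ T₀) (length-prodTable t T₀ T₁))

prodTable-index : ∀ t T₀ T₁ {i j} → i < length T₀ → j < length T₁ → i + length T₀ * j < length (prodTable t T₀ T₁)
prodTable-index t T₀ T₁ {i} {j} i< j< = ≤-trans (+-monoˡ-< (length T₀ * j) i<)
  (≤-trans (≤-reflexive (sym (*-suc (length T₀) j)))
  (≤-trans (*-monoʳ-≤ (length T₀) j<)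
    (≤-reflexive (trans (*-comm (length T₀) (length T₁)) (sym (length-prodTable t T₀ T₁))))))

nth-prodTable : ∀ t T₀ T₁ {i j} → i < length T₀ → j < length T₁ →
                nth false (prodTable t T₀ T₁) (i + length T₀ * j) ≡ gateOp t (nth false T₀ i ∷ nth false T₁ j ∷ [])
nth-prodTable t T₀ (b ∷ T₁) {i} {zero} i< j< =
  trans (cong (nth false (prodTable t T₀ (b ∷ T₁))) (trans (cong (λ z → i + z) (*-zeroʳ (length T₀))) (+-identityʳ i)))
    (trans (nth-++ˡ false block (prodTable t T₀ T₁) (subst (i <_) (sym (length-map _ T₀)) i<))
      (nth-map (λ b₀ → gateOp t (b₀ ∷ b ∷ [])) false false T₀ i<))
  where block = map (λ b₀ → gateOp t (b₀ ∷ b ∷ [])) T₀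
nth-prodTable t T₀ (b ∷ T₁) {i} {suc j} i< (s≤s j<) =
  trans (cong (nth false (prodTable t T₀ (b ∷ T₁)))
    (trans (trans (cong (λ z → i + z) (*-suc (length T₀) j)) (trans (sym (+-assoc i (length T₀) _))
          (trans (cong (_+ length T₀ * j) (+-comm i (length T₀))) (+-assoc (length T₀) i _))))
            (cong (_+ (i + length T₀ * j)) (sym (length-map _ T₀)))))
    (trans (nth-++ʳ false block (prodTable t T₀ T₁) (i + length T₀ * j)) (nth-prodTable t T₀ T₁ i< j<))
  where block = map (λ b₀ → gateOp t (b₀ ∷ b ∷ [])) T₀

count : List Bool → ℕ
count bs = sum (map bit bs)

count≤length : ∀ bs → count bs ≤ length bs
count≤length []           = z≤n
count≤length (true ∷ bs)  = s≤s (count≤length bs)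
count≤length (false ∷ bs) = m≤n⇒m≤1+n (count≤length bs)

count-and : ∀ bs → (count bs ≡ᵇ length bs) ≡ and bs
count-and []           = refl
count-and (true ∷ bs)  = count-and bs
count-and (false ∷ bs) = ≢⇒≡ᵇ (<⇒≢ (s≤s (count≤length bs)))

count-or : ∀ bs → not (isZero (count bs)) ≡ or bs
count-or []           = refl
count-or (true ∷ bs)  = refl
count-or (false ∷ bs) = count-or bs

countOp-gateOp : ∀ t bs → countOp t (length bs) (count bs) ≡ gateOp t bs
countOp-gateOp t bs with t ≡ᵇ 1 | t ≡ᵇ 2
... | true  | _     = cong not (count-and bs)
... | false | true  = count-and bs
... | false | false = count-or bs

-- Small gates with fewer than two arguments are padded to binary ones: a missing argument has
-- digest 0 and the one-entry table `neutral t ∷ []`.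
gateOp-neutral : ∀ t → gateOp t (neutral t ∷ neutral t ∷ []) ≡ gateOp t []
gateOp-neutral t with t ≡ᵇ 1 | t ≡ᵇ 2
... | true  | _     = refl
... | false | true  = refl
... | false | false = refl

gateOp-neutral₁ : ∀ t b → gateOp t (b ∷ neutral t ∷ []) ≡ gateOp t (b ∷ [])
gateOp-neutral₁ t b with t ≡ᵇ 1 | t ≡ᵇ 2
... | true  | _     = refl
... | false | true  = refl
... | false | false = refl

decode-bit : ∀ b → bit b < 2 × nth false (false ∷ true ∷ []) (bit b) ≡ b
decode-bit false = s≤s z≤n , refl
decode-bit true  = ≤-refl , refl

-- The range of digests and the value must be proved together: digits below the table lengths make
-- the mixed-radix number of a small gate decodable. For a large gate the count of true arguments
-- decides the value.
decode : ∀ δ φ B → digest δ φ B < length (table δ φ) × nth false (table δ φ) (digest δ φ B) ≡ val δ φ B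
decode zero    i            B = decode-bit (memb i B)
decode (suc δ) (t , i , cs) B with isZero t
... | true  = decode-bit (memb i B)
... | false with 2 <ᵇ length cs in big
...   | true  = subst (c <_) (sym
  (trans (length-map (countOp t (length cs)) (upTo (suc (length cs)))) (length-upTo (suc (length cs))))) c<
              , trans (nth-map (countOp t (length cs)) false 0 (upTo (suc (length cs)))
                (subst (c <_) (sym (length-upTo (suc (length cs)))) c<))
                (trans (cong (countOp t (length cs)) (nth-applyUpTo 0 (λ i → i) (suc (length cs)) c<))
                (trans (cong₂ (countOp t) (sym (length-map (λ c → val δ c B) cs)) c≡)
                  (countOp-gateOp t (map (λ c → val δ c B) cs))))
  where
  c : ℕ
  c = sum (map (λ c → bit (val δ c B)) cs)
  c≡ : c ≡ count (map (λ c → val δ c B) cs)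
  c≡ = cong sum (map-∘ cs)
  c< : c < suc (length cs)
  c< = s≤s (subst₂ _≤_ (sym c≡) (length-map (λ c → val δ c B) cs) (count≤length (map (λ c → val δ c B) cs)))
decode (suc δ) (t , i , []) B | false | false = s≤s z≤n , gateOp-neutral t
decode (suc δ) (t , i , c ∷ []) B | false | false =
  let (lt , eq) = decode δ c B ; T = table δ c in
  prodTable-index t T (neutral t ∷ []) lt (s≤s z≤n) ,
  trans (nth-prodTable t T (neutral t ∷ []) lt (s≤s z≤n))
    (trans (gateOp-neutral₁ t (nth false T (digest δ c B))) (cong (λ b → gateOp t (b ∷ [])) eq))
decode (suc δ) (t , i , c ∷ c′ ∷ []) B | false | false =
  let (lt , eq) = decode δ c B ; (lt′ , eq′) = decode δ c′ B in
  prodTable-index t (table δ c) (table δ c′) lt lt′ ,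
  trans (nth-prodTable t (table δ c) (table δ c′) lt lt′) (cong₂ (λ b b′ → gateOp t (b ∷ b′ ∷ [])) eq eq′)
decode (suc δ) (t , i , _ ∷ _ ∷ _ ∷ _) B | false | false with () ← big

-- Möbius inversion

Δ : ℕ → (List ℕ → ℤ) → List ℕ → ℤ
Δ a f B = f (a ∷ B) -ᶻ f B

-- Expanded, this is the alternating sum of `f B` over the sublists `B` of `A`, with sign given by
-- the parity of the number of omitted elements. Elements keep their order, so `f` need not be
-- invariant under permutation.
μ : (List ℕ → ℤ) → List ℕ → ℤ
μ f []      = f []
μ f (a ∷ A) = μ (Δ a f) A

μ-cong : ∀ {f g} A → (∀ B → f B ≡ g B) → μ f A ≡ μ g A
μ-cong []      eq = eq []
μ-cong (a ∷ A) eq = μ-cong A λ B → cong₂ _-ᶻ_ (eq (a ∷ B)) (eq B)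

μ-zero : ∀ A → μ (λ _ → 0ℤ) A ≡ 0ℤ
μ-zero []      = refl
μ-zero (a ∷ A) = μ-zero A

μ-+ : ∀ f g A → μ (λ B → f B +ᶻ g B) A ≡ μ f A +ᶻ μ g A
μ-+ f g []      = refl
μ-+ f g (a ∷ A) = trans (μ-cong A λ B → lemma (f (a ∷ B)) (g (a ∷ B)) (f B) (g B)) (μ-+ (Δ a f) (Δ a g) A)
  where
  lemma : ∀ x y z w → (x +ᶻ y) -ᶻ (z +ᶻ w) ≡ (x -ᶻ z) +ᶻ (y -ᶻ w)
  lemma = solveᶻ-∀

μ-* : ∀ c f A → μ (λ B → c *ᶻ f B) A ≡ c *ᶻ μ f A
μ-* c f []      = refl
μ-* c f (a ∷ A) = trans (μ-cong A λ B → lemma c (f (a ∷ B)) (f B)) (μ-* c (Δ a f) A)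
  where
  lemma : ∀ c x y → c *ᶻ x -ᶻ c *ᶻ y ≡ c *ᶻ (x -ᶻ y)
  lemma = solveᶻ-∀

μ-- : ∀ f g A → μ (λ B → f B -ᶻ g B) A ≡ μ f A -ᶻ μ g A
μ-- f g []      = refl
μ-- f g (a ∷ A) = trans (μ-cong A λ B → lemma (f (a ∷ B)) (g (a ∷ B)) (f B) (g B)) (μ-- (Δ a f) (Δ a g) A)
  where
  lemma : ∀ x y z w → (x -ᶻ y) -ᶻ (z -ᶻ w) ≡ (x -ᶻ z) -ᶻ (y -ᶻ w)
  lemma = solveᶻ-∀

∑ᶻ : List ℤ → ℤ
∑ᶻ = foldr _+ᶻ_ 0ℤ

∑ᶻ-++ : ∀ xs ys → ∑ᶻ (xs ++ ys) ≡ ∑ᶻ xs +ᶻ ∑ᶻ ys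
∑ᶻ-++ []       ys = sym (+ᶻ-identityˡ _)
∑ᶻ-++ (x ∷ xs) ys = trans (cong (x +ᶻ_) (∑ᶻ-++ xs ys)) (lemma x (∑ᶻ xs) (∑ᶻ ys))
  where
  lemma : ∀ x y z → x +ᶻ (y +ᶻ z) ≡ x +ᶻ y +ᶻ z
  lemma = solveᶻ-∀

-- For `x ∷ L`, the sublists containing `x` sum to `Δ x f L` and the others to `f L`, which
-- telescopes to `f (x ∷ L)`. The hypothesis makes up for the sublists cut off by `r`, and it passes
-- to `Δ x f` with order lowered by one.
möbius-inversion : ∀ r L f → (∀ A → A ⊆ L → r ≤ length A → μ f A ≡ 0ℤ) → ∑ᶻ (map (μ f) (subs r L)) ≡ f L
möbius-inversion zero    []      f van = sym (van [] [] z≤n)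
möbius-inversion (suc r) []      f van = +ᶻ-identityʳ (f [])
möbius-inversion zero    (x ∷ L) f van = trans (cong₂ _+ᶻ_
  (möbius-inversion zero L (Δ x f) λ A s _ → van (x ∷ A) (refl ∷ s) z≤n)
  (möbius-inversion zero L f λ A s _ → van A (x ∷ʳ s) z≤n)) (cancel (f (x ∷ L)) (f L))
  where
  cancel : ∀ a b → (a -ᶻ b) +ᶻ b ≡ a
  cancel = solveᶻ-∀
möbius-inversion (suc r) (x ∷ L) f van = begin
  f [] +ᶻ ∑ᶻ (map (μ f) (map (x ∷_) (subs r L) ++ subs⁺ r L))
    ≡⟨ cong (f [] +ᶻ_) (trans (cong ∑ᶻ (map-++ (μ f) (map (x ∷_) (subs r L)) (subs⁺ r L)))
      (∑ᶻ-++ (map (μ f) (map (x ∷_) (subs r L))) _)) ⟩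
  f [] +ᶻ (∑ᶻ (map (μ f) (map (x ∷_) (subs r L))) +ᶻ ∑ᶻ (map (μ f) (subs⁺ r L)))
    ≡⟨ cong (λ z → f [] +ᶻ (∑ᶻ z +ᶻ ∑ᶻ (map (μ f) (subs⁺ r L)))) (sym (map-∘ (subs r L))) ⟩
  f [] +ᶻ (∑ᶻ (map (μ (Δ x f)) (subs r L)) +ᶻ ∑ᶻ (map (μ f) (subs⁺ r L)))
    ≡⟨ swap (f []) (∑ᶻ (map (μ (Δ x f)) (subs r L))) (∑ᶻ (map (μ f) (subs⁺ r L))) ⟩
  ∑ᶻ (map (μ (Δ x f)) (subs r L)) +ᶻ (f [] +ᶻ ∑ᶻ (map (μ f) (subs⁺ r L)))
    ≡⟨ cong₂ _+ᶻ_ (möbius-inversion r L (Δ x f) λ A s le → van (x ∷ A) (refl ∷ s) (s≤s le))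
      (möbius-inversion (suc r) L f λ A s le → van A (x ∷ʳ s) le) ⟩
  (f (x ∷ L) -ᶻ f L) +ᶻ f L
    ≡⟨ cancel (f (x ∷ L)) (f L) ⟩
  f (x ∷ L) ∎
  where
  open ≡-Reasoning
  swap : ∀ a b c → a +ᶻ (b +ᶻ c) ≡ b +ᶻ (a +ᶻ c)
  swap = solveᶻ-∀
  cancel : ∀ a b → (a -ᶻ b) +ᶻ b ≡ a
  cancel = solveᶻ-∀

Ignores : {A : Set} → ℕ → (List ℕ → A) → Set
Ignores a f = ∀ B C → f (B ++ a ∷ C) ≡ f (B ++ C)

-- Differences along other elements still ignore `a`, and the difference along `a` is then
-- identically zero.
μ-ignores : ∀ {a A f} → a ∈ A → Ignores a f → μ f A ≡ 0ℤ
μ-ignores {a} {_ ∷ A} {f} (here refl) ig = trans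
  (μ-cong A λ B → trans (cong (_-ᶻ f B) (ig [] B)) (self (f B))) (μ-zero A)
  where
  self : ∀ x → x -ᶻ x ≡ 0ℤ
  self = solveᶻ-∀
μ-ignores {a} {b ∷ A} (there a∈) ig = μ-ignores a∈ λ B C → cong₂ _-ᶻ_ (ig (b ∷ B) C) (ig B C)

vars : ∀ δ → El (F δ) → List ℕ
vars zero    i            = i ∷ []
vars (suc δ) (t , i , cs) = if isZero t then i ∷ [] else concat (map (vars δ) cs)

memb-ignores : ∀ {a i} → a ≢ i → Ignores a (memb i)
memb-ignores {a} {i} ne []      C rewrite ≢⇒≡ᵇ {i} {a} (ne ∘ sym) = refl
memb-ignores {a} {i} ne (b ∷ B) C = cong ((i ≡ᵇ b) ∨_) (memb-ignores ne B C)

val-ignores : ∀ δ φ {a} → a ∉ vars δ φ → Ignores a (val δ φ)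
vals-ignores : ∀ δ cs {a} → a ∉ concat (map (vars δ) cs) → Ignores a (λ B → map (λ c → val δ c B) cs)
val-ignores zero    i            a∉ = memb-ignores (λ eq → a∉ (here eq))
val-ignores (suc δ) (t , i , cs) a∉ B C with isZero t
... | true  = memb-ignores (λ eq → a∉ (here eq)) B C
... | false = cong (gateOp t) (vals-ignores δ cs a∉ B C)
vals-ignores δ []       a∉ B C = refl
vals-ignores δ (c ∷ cs) a∉ B C = cong₂ _∷_ (val-ignores δ c (a∉ ∘ ∈-++⁺ˡ) B C)
  (vals-ignores δ cs (a∉ ∘ ∈-++⁺ʳ (vars δ c)) B C)

length-vars : ∀ δ φ → weft₀ δ φ ≡ true → length (vars δ φ) ≤ 2 ^ δ
length-vars zero    i            w = ≤-refl
length-vars (suc δ) (t , i , cs) w with isZero t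
... | true = m^n>0 2 (suc δ)
length-vars (suc δ) (t , i , [])     w | false = z≤n
length-vars (suc δ) (t , i , c ∷ []) w | false =
  ≤-trans (≤-reflexive (length-++ (vars δ c))) (+-mono-≤ (length-vars δ c (proj₁ (∧-true w))) z≤n)
length-vars (suc δ) (t , i , c ∷ c′ ∷ []) w | false = let (w₁ , w₂) = ∧-true w in
  ≤-trans (≤-reflexive (length-++ (vars δ c))) (+-mono-≤ (length-vars δ c w₁)
    (≤-trans (≤-reflexive (length-++ (vars δ c′))) (+-mono-≤ (length-vars δ c′ (proj₁ (∧-true w₂))) z≤n)))
length-vars (suc δ) (t , i , _ ∷ _ ∷ _ ∷ _) () | false

pigeonhole : ∀ A V → Unique A → length V < length A → Σ ℕ λ a → a ∈ A × a ∉ V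
pigeonhole (a ∷ A) V (a∉A ∷ u) lt with a ∈? V
... | no a∉V = a , here refl , a∉V
... | yes a∈V with ∈-∃++ a∈V
...   | V₁ , V₂ , refl =
  let (b , b∈ , b∉) = pigeonhole A (V₁ ++ V₂) u
        (≤-trans (≤-reflexive (trans (cong suc (length-++ V₁))
          (trans (sym (+-suc (length V₁) (length V₂))) (sym (length-++ V₁))))) (≤-pred lt))
  in b , there b∈ , λ b∈V → case-⊎ (b∉ ∘ ∈-++⁺ˡ)
    (λ { (here eq) → All.lookup a∉A b∈ (sym eq) ; (there b∈V₂) → b∉ (∈-++⁺ʳ V₁ b∈V₂) }) (∈-++⁻ V₁ b∈V)

+digest : ∀ δ → El (F δ) → List ℕ → ℤ
+digest δ φ B = + digest δ φ B

-- With weft 0 all gates have fan-in at most 2, which leaves at most `2 ^ δ` variables; a longer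
-- list of distinct elements contains one that the formula ignores.
μ-bit : ∀ δ φ A → weft₀ δ φ ≡ true → Unique A → 2 ^ δ < length A → μ (λ B → + bit (val δ φ B)) A ≡ 0ℤ
μ-bit δ φ A w u lt = let (a , a∈ , a∉) = pigeonhole A (vars δ φ) u (≤-trans (s≤s (length-vars δ φ w)) lt)
                     in μ-ignores a∈ λ B C → cong (+_ ∘ bit) (val-ignores δ φ a∉ B C)

-- A large gate contributes a sum of bits of formulas of weft 0, each killed by `μ-bit`. At a small
-- gate the digest is a linear combination of digests of its arguments, and `μ` is linear.
μ-digest : ∀ δ φ A → weft₁ δ φ ≡ true → Unique A → 2 ^ δ < length A → μ (+digest δ φ) A ≡ 0ℤ
μ-digest zero    i            A w u lt = μ-bit zero i A refl u lt
μ-digest (suc δ) (t , i , cs) A w u lt with isZero t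
... | true  = μ-bit zero i A refl u (≤-trans (s≤s (m^n>0 2 (suc δ))) lt)
... | false with 2 <ᵇ length cs in big
...   | true = go cs w
  where
  half : 2 ^ δ < length A
  half = ≤-trans (s≤s (m≤m+n (2 ^ δ) _)) lt
  go : ∀ cs → all (weft₀ δ) cs ≡ true → μ (λ B → + sum (map (λ c → bit (val δ c B)) cs)) A ≡ 0ℤ
  go []       w = μ-zero A
  go (c ∷ cs) w = let (w₁ , w₂) = ∧-true w in
    trans (μ-cong A λ B → pos-+ (bit (val δ c B)) _)
      (trans (μ-+ (λ B → + bit (val δ c B)) (λ B → + sum (map (λ c → bit (val δ c B)) cs)) A)
      (cong₂ _+ᶻ_ (μ-bit δ c A w₁ u half) (go cs w₂)))
μ-digest (suc δ) (t , i , []) A w u lt | false | false = μ-zero A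
μ-digest (suc δ) (t , i , c ∷ []) A w u lt | false | false =
  trans (μ-cong A λ B → cong +_ (trans (cong (λ z → digest δ c B + z) (*-zeroʳ (length (table δ c)))) (+-identityʳ _)))
    (μ-digest δ c A (proj₁ (∧-true w)) u (≤-trans (s≤s (m≤m+n (2 ^ δ) _)) lt))
μ-digest (suc δ) (t , i , c ∷ c′ ∷ []) A w u lt | false | false =
  let (w₁ , w₂) = ∧-true w ; half = ≤-trans (s≤s (m≤m+n (2 ^ δ) _)) lt ; n = length (table δ c) in
  trans (μ-cong A λ B → trans (pos-+ (digest δ c B) _) (cong (+digest δ c B +ᶻ_) (pos-* n (digest δ c′ B))))
    (trans (μ-+ (+digest δ c) (λ B → + n *ᶻ +digest δ c′ B) A) (cong₂ _+ᶻ_ (μ-digest δ c A w₁ u half)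
      (trans (μ-* (+ n) (+digest δ c′) A)
        (trans (cong (+ n *ᶻ_) (μ-digest δ c′ A (proj₁ (∧-true w₂)) u half)) (*ᶻ-zeroʳ (+ n))))))
μ-digest (suc δ) (t , i , _ ∷ _ ∷ _ ∷ _) A w u lt | false | false with () ← big

mob-μ : ∀ {δ} r φ base A → length A ≤ r → (let (p , n) = mob {δ} r φ base A in + p -ᶻ + n) ≡ μ
  (λ B → +digest δ φ (base ++ B)) A
mob-μ {δ} zero    φ base [] le = trans (+ᶻ-identityʳ _) (cong (+digest δ φ) (sym (++-identityʳ base)))
mob-μ {δ} (suc r) φ base [] le = trans (+ᶻ-identityʳ _) (cong (+digest δ φ) (sym (++-identityʳ base)))
mob-μ {δ} (suc r) φ base (a ∷ A) (s≤s le) =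
  let (p , n) = mob {δ} r φ (base ++ [ a ]) A ; (p′ , n′) = mob {δ} r φ base A in
  trans (cong₂ _-ᶻ_ (pos-+ p n′) (pos-+ n p′)) (trans (lemma (+ p) (+ n) (+ p′) (+ n′))
    (trans (cong₂ _-ᶻ_ (mob-μ r φ (base ++ [ a ]) A le) (mob-μ r φ base A le))
      (trans (sym (μ-- (λ B → +digest δ φ ((base ++ [ a ]) ++ B)) (λ B → +digest δ φ (base ++ B)) A))
        (μ-cong A λ B → cong (λ l → +digest δ φ l -ᶻ +digest δ φ (base ++ B)) (++-assoc base [ a ] B)))))
  where
  lemma : ∀ p n p′ n′ → (p +ᶻ n′) -ᶻ (n +ᶻ p′) ≡ (p -ᶻ n) -ᶻ (p′ -ᶻ n′)
  lemma = solveᶻ-∀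

unique-⊆ : ∀ {A L : List ℕ} → A ⊆ L → Unique L → Unique A
unique-⊆ []         []       = []
unique-⊆ (y ∷ʳ s)   (_ ∷ u)  = unique-⊆ s u
unique-⊆ (refl ∷ s) (x∉ ∷ u) = All-resp-⊆ s x∉ ∷ unique-⊆ s u

subs-⊆ : ∀ r (L : List ℕ) {A} → A ∈ subs r L → A ⊆ L × length A < r
subs⁺-⊆ : ∀ r (L : List ℕ) {A} → A ∈ subs⁺ r L → A ⊆ L × length A < suc r
subs-⊆ (suc r) L (here refl) = []⊆ L , s≤s z≤n
  where
  []⊆ : ∀ (L : List ℕ) → [] ⊆ L
  []⊆ []      = []
  []⊆ (x ∷ L) = x ∷ʳ []⊆ L
subs-⊆ (suc r) L (there A∈) = subs⁺-⊆ r L A∈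
subs⁺-⊆ r (x ∷ L) A∈ with ∈-++⁻ (map (x ∷_) (subs r L)) A∈
... | inj₂ A∈⁺ = let (s , lt) = subs⁺-⊆ r L A∈⁺ in x ∷ʳ s , lt
... | inj₁ A∈ˣ with ∈-map⁻ (x ∷_) A∈ˣ
...   | A′ , A′∈ , refl = let (s , lt) = subs-⊆ r L A′∈ in refl ∷ s , s≤s lt

⊆-subs : ∀ r {L A : List ℕ} → A ⊆ L → length A < r → A ∈ subs r L
⊆-subs⁺ : ∀ r {L : List ℕ} x {A} → (x ∷ A) ⊆ L → length A < r → (x ∷ A) ∈ subs⁺ r L
⊆-subs (suc r) {A = []}    s lt       = here refl
⊆-subs (suc r) {A = x ∷ A} s (s≤s lt) = there (⊆-subs⁺ r x s lt)
⊆-subs⁺ r {y ∷ L} x (_ ∷ʳ s)   lt = ∈-++⁺ʳ (map (y ∷_) (subs r L)) (⊆-subs⁺ r x s lt)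
⊆-subs⁺ r {y ∷ L} x (refl ∷ s) lt = ∈-++⁺ˡ (∈-map⁺ (x ∷_) (⊆-subs r s lt))

digest-inversion : ∀ δ r φ L → weft₁ δ φ ≡ true → Unique L → 2 ^ δ < r →
                   ∑ᶻ (map (λ A → let (p , n) = mob {δ} r φ [] A in + p -ᶻ + n) (subs r L)) ≡ +digest δ φ L
digest-inversion δ r φ L w u lt = trans (cong ∑ᶻ (map-cong-local (All.tabulate λ {A} A∈ →
    mob-μ r φ [] A (<⇒≤ (proj₂ (subs-⊆ r L A∈))))))
  (möbius-inversion r L (+digest δ φ) λ A s le → μ-digest δ φ A w (unique-⊆ s u) (≤-trans lt le))

-- Positions in lists, and increasing lists

nth-∈ : ∀ {A : Set} d (l : List A) {i} → i < length l → nth d l i ∈ l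
nth-∈ d (x ∷ l) {zero}  lt       = here refl
nth-∈ d (x ∷ l) {suc i} (s≤s lt) = there (nth-∈ d l lt)

∈-nth : ∀ {A : Set} d {l : List A} {x} → x ∈ l → Σ ℕ λ i → i < length l × nth d l i ≡ x
∈-nth d (here refl) = 0 , s≤s z≤n , refl
∈-nth d (there x∈)  = let (i , lt , eq) = ∈-nth d x∈ in suc i , s≤s lt , eq

nth-ext : ∀ {A : Set} d (l l′ : List A) → length l ≡ length l′ → (∀ i → i < length l → nth d l i ≡ nth d l′ i) → l ≡ l′
nth-ext d []      []        len eq = refl
nth-ext d (x ∷ l) (x′ ∷ l′) len eq = cong₂ _∷_ (eq 0 (s≤s z≤n))
  (nth-ext d l l′ (suc-injective len) λ i lt → eq (suc i) (s≤s lt))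

∑-nth : ∀ {A : Set} d (l : List A) (g : A → ℕ) → ∑ (length l) (λ e → g (nth d l e)) ≡ sum (map g l)
∑-nth d []      g = refl
∑-nth d (x ∷ l) g = cong (λ z → g x + z) (∑-nth d l g)

term≤sum : ∀ {A : Set} (f : A → ℕ) {x l} → x ∈ l → f x ≤ sum (map f l)
term≤sum f (here refl)        = m≤m+n (f _) _
term≤sum f {l = y ∷ _} (there x∈) = ≤-trans (term≤sum f x∈) (m≤n+m _ (f y))

∈-keep⁻ : ∀ {A : Set} (p : A → Bool) l {x} → x ∈ keep p l → x ∈ l × p x ≡ true
∈-keep⁻ p (y ∷ l) x∈ with p y in eq
∈-keep⁻ p (y ∷ l) (here refl) | true = here refl , eq
∈-keep⁻ p (y ∷ l) (there x∈)  | true = let (a , b) = ∈-keep⁻ p l x∈ in there a , b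
∈-keep⁻ p (y ∷ l) x∈          | false = let (a , b) = ∈-keep⁻ p l x∈ in there a , b

∈-keep⁺ : ∀ {A : Set} (p : A → Bool) {l x} → x ∈ l → p x ≡ true → x ∈ keep p l
∈-keep⁺ p (here refl) px rewrite px = here refl
∈-keep⁺ p {y ∷ l} (there x∈) px with p y
... | true  = there (∈-keep⁺ p x∈ px)
... | false = ∈-keep⁺ p x∈ px

subs-map : ∀ {A B : Set} (f : A → B) r L → subs r (map f L) ≡ map (map f) (subs r L)
subs⁺-map : ∀ {A B : Set} (f : A → B) r L → subs⁺ r (map f L) ≡ map (map f) (subs⁺ r L)
subs-map f zero    L = refl
subs-map f (suc r) L = cong ([] ∷_) (subs⁺-map f r L)
subs⁺-map f r []      = refl
subs⁺-map f r (x ∷ L) = trans (cong₂ _++_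
  (trans (cong (map (f x ∷_)) (subs-map f r L)) (trans (sym (map-∘ (subs r L))) (map-∘ (subs r L)))) (subs⁺-map f r L))
  (sym (map-++ (map f) (map (x ∷_) (subs r L)) (subs⁺ r L)))

positions-⊆ : ∀ {n} j (a : Subset n) g → (∀ i → g i ≡ j + i) → positions j a ⊆ applyUpTo g n
positions-⊆ j []          g eq = []
positions-⊆ j (true ∷ a)  g eq = trans (sym (+-identityʳ j)) (sym (eq 0)) ∷ positions-⊆ (suc j) a
  (g ∘ suc) λ i → trans (eq (suc i)) (+-suc j i)
positions-⊆ j (false ∷ a) g eq = g 0 ∷ʳ positions-⊆ (suc j) a (g ∘ suc) λ i → trans (eq (suc i)) (+-suc j i)

positions-surjective : ∀ n j L → AllPairs _<_ L → All (j ≤_) L → All (_< j + n) L → Σ (Subset n) λ a → positions j a ≡ L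
positions-surjective zero j []      _ _        _        = [] , refl
positions-surjective zero j (x ∷ L) _ (j≤ ∷ _) (x< ∷ _) = contradiction (subst (x <_) (+-identityʳ j) x<) (≤⇒≯ j≤)
positions-surjective (suc n) j []   _ _        _        =
  let (a , eq) = positions-surjective n (suc j) [] [] [] [] in false ∷ a , eq
positions-surjective (suc n) j (x ∷ L) (x<L ∷ s) (j≤ ∷ js) (x< ∷ xs) with x ≟ j
... | yes refl = let (a , eq) = positions-surjective n (suc x) L s x<L (All.map (λ {y} → subst (y <_) (+-suc x n)) xs)
                 in true ∷ a , cong (x ∷_) eq
... | no x≢j = let j<x = ≤∧≢⇒< j≤ (x≢j ∘ sym)
                   (a , eq) = positions-surjective n (suc j) (x ∷ L) (x<L ∷ s)
                     (j<x ∷ All.map (λ x<y → ≤-trans j<x (<⇒≤ x<y)) x<L)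
                                (subst (x <_) (+-suc j n) x< ∷ All.map (λ {y} → subst (y <_) (+-suc j n)) xs)
               in false ∷ a , eq

sorted-⊆ : ∀ {A L : List ℕ} → A ⊆ L → AllPairs _<_ L → AllPairs _<_ A
sorted-⊆ []         []       = []
sorted-⊆ (y ∷ʳ s)   (_ ∷ u)  = sorted-⊆ s u
sorted-⊆ (refl ∷ s) (x∉ ∷ u) = All-resp-⊆ s x∉ ∷ sorted-⊆ s u

sorted-upTo : ∀ n → AllPairs _<_ (upTo n)
sorted-upTo n = AllPairs.applyUpTo⁺₁ (λ i → i) n λ i<j _ → i<j

pair-⊆ : ∀ {i j k} → i < j → j < k → (i ∷ j ∷ []) ⊆ upTo k
pair-⊆ {i} {j} {k} i<j j<k = go k (λ i → i) i<j j<k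
  where
  single : ∀ k (g : ℕ → ℕ) {j} → j < k → (g j ∷ []) ⊆ applyUpTo g k
  empty : ∀ (L : List ℕ) → [] ⊆ L
  empty []      = []
  empty (x ∷ L) = x ∷ʳ empty L
  single (suc k) g {zero}  lt       = refl ∷ empty _
  single (suc k) g {suc j} (s≤s lt) = g 0 ∷ʳ single k (g ∘ suc) lt
  go : ∀ k (g : ℕ → ℕ) {i j} → i < j → j < k → (g i ∷ g j ∷ []) ⊆ applyUpTo g k
  go (suc k) g {zero}  {suc j} _         (s≤s lt) = refl ∷ single k (g ∘ suc) lt
  go (suc k) g {suc i} {suc j} (s≤s i<j) (s≤s lt) = g 0 ∷ʳ go k (g ∘ suc) i<j lt

nth-map0 : ∀ (f : ℕ → ℕ) l {i} → i < length l → nth 0 (map f l) i ≡ f (nth 0 l i)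
nth-map0 f l = nth-map f 0 0 l

-- Correctness of the vector sums

module Correct (d : ℕ) (φ : El (F d)) (n k : ℕ) (w : weft₁ d φ ≡ true) where
  open Reduction d hiding (nP; kP; φP)

  I : Instance
  I = inst (φ , n , k)
  open Instance I

  R Qc β κ : ℕ
  R  = length (rows k)
  Qc = length (coords k)
  β  = length (table d φ)
  κ  = offset φ n

  -- The three kinds of rows are addressed as `e < k`, `k + 0` and `k + suc e`, the forms in which
  -- `∑-rows` leaves them.
  firstCase : ∀ {A : Set} {x y z : A} {e} → e < k → (if e <ᵇ k then x else if e ≡ᵇ k then y else z) ≡ x
  firstCase e<k rewrite <⇒<ᵇ≡ e<k = refl

  middleCase : ∀ {A : Set} {x y z : A} → (if (k + 0) <ᵇ k then x else if (k + 0) ≡ᵇ k then y else z) ≡ y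
  middleCase rewrite +-identityʳ k | ≥⇒<ᵇ≡ (≤-refl {k}) | ≡ᵇ-refl k = refl

  lastCase : ∀ {A : Set} {x y : A} (z : ℕ → A) e →
             (if (k + suc e) <ᵇ k then x else if (k + suc e) ≡ᵇ k then y else z ((k + suc e) ∸ suc k)) ≡ z e
  lastCase z e rewrite ≥⇒<ᵇ≡ (m≤m+n k (suc e)) | ≢⇒≡ᵇ {k + suc e} {k} (λ eq → m+1+n≢m k eq) =
    cong z (trans (cong (_∸ suc k) (+-suc k e)) (m+n∸m≡n k e))

  ∑-rows : ∀ f → ∑ E f ≡ ∑ k f + (f (k + 0) + ∑ R (λ e → f (k + suc e)))
  ∑-rows f = ∑-split k (suc R) f

  picked : (ℕ → ℕ) → ℕ → List ℕ
  picked σ e = pick n k e (σ (k + suc e))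

  coordsOf : ℕ → List (ℕ × ℕ × ℕ)
  coordsOf e = map (λ j → e , j , nth 0 (row k e) j) (upTo (length (row k e)))

  ∈-coords⁻ : ∀ {c} → c ∈ coords k → let (e , j , i) = c in e < R × j < length (row k e) × i ≡ nth 0 (row k e) j
  ∈-coords⁻ c∈ with ∈-concat⁻′ (map coordsOf (upTo R)) c∈
  ... | xs , c∈xs , xs∈ with ∈-map⁻ coordsOf xs∈
  ...   | e , e∈ , refl with ∈-map⁻ (λ j → e , j , nth 0 (row k e) j) c∈xs
  ...     | j , j∈ , refl = ∈-upTo⁻ e∈ , ∈-upTo⁻ j∈ , refl

  ∈-coords⁺ : ∀ {e j} → e < R → j < length (row k e) → (e , j , nth 0 (row k e) j) ∈ coords k
  ∈-coords⁺ {e} e< j< = ∈-concat⁺′ (∈-map⁺ (λ j → e , j , nth 0 (row k e) j) (∈-upTo⁺ j<))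
    (∈-map⁺ coordsOf (∈-upTo⁺ e<))

  row-⊆ : ∀ {e} → e < R → row k e ⊆ upTo k × length (row k e) < r
  row-⊆ e< = subs-⊆ r (upTo k) (nth-∈ [] (rows k) e<)

  row<k : ∀ {e j} → e < R → j < length (row k e) → nth 0 (row k e) j < k
  row<k {e} e< j< = ∈-upTo⁻ (Sublist.lookup (proj₁ (row-⊆ e<)) (nth-∈ 0 (row k e) j<))

  cons-sum : ∀ σ {q e j i} → q < Qc → nth (0 , 0 , 0) (coords k) q ≡ (e , j , i) → e < R → i < k →
             ∑ E (λ e → a e (σ e) q) ≡ (n ∸ σ i) + nth 0 (picked σ e) j
  cons-sum σ {q} {e} {j} {i} q< eq e< i<k = begin
    ∑ E (λ x → a x (σ x) q)
      ≡⟨ ∑-cong E (λ x _ → trans (cong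
        (λ b → if b then consWeight n k (nth (0 , 0 , 0) (coords k) q) x (σ x) else sumWeight
          (φ , n , k) x (σ x)) (<⇒<ᵇ≡ q<))
                                 (cong (λ c → consWeight n k c x (σ x)) eq)) ⟩
    ∑ E f
      ≡⟨ ∑-rows f ⟩
    ∑ k f + (f (k + 0) + ∑ R (λ x → f (k + suc x)))
      ≡⟨ cong₂ _+_ (trans (∑-cong k λ x x<k → firstCase x<k) (∑-put< k (λ x → n ∸ σ x) i<k))
           (cong₂ _+_ middleCase (trans (∑-cong R λ x _ →
             lastCase {x = if (k + suc x) ≡ᵇ i then n ∸ σ (k + suc x) else 0} {y = 0}
               (λ y → if y ≡ᵇ e then nth 0 (pick n k y (σ (k + suc x))) j else 0) x)
                                        (∑-put< R (λ x → nth 0 (picked σ x) j) e<))) ⟩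
    (n ∸ σ i) + (0 + nth 0 (picked σ e) j) ∎
    where
    open ≡-Reasoning
    f : ℕ → ℕ
    f x = consWeight n k (e , j , i) x (σ x)

  weigh : List ℕ → ℕ
  weigh T = proj₁ (möbius φ T) + (κ ∸ proj₂ (möbius φ T))

  top : ℕ → ℕ
  top s = if nth false (table d φ) s then β ∸ s else suc (target φ n k)

  digest-sum : ∀ σ → ∑ E (λ e → a e (σ e) Qc) ≡ top (σ (k + 0)) + ∑ R (λ e → weigh (picked σ e))
  digest-sum σ = begin
    ∑ E (λ x → a x (σ x) Qc)
      ≡⟨ ∑-cong E (λ x _ → cong (λ b → if b then consWeight n k (nth (0 , 0 , 0) (coords k) Qc) x
        (σ x) else f x) (≥⇒<ᵇ≡ (≤-refl {Qc}))) ⟩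
    ∑ E f
      ≡⟨ ∑-rows f ⟩
    ∑ k f + (f (k + 0) + ∑ R (λ x → f (k + suc x)))
      ≡⟨ cong₂ _+_ (∑-zero k λ x x<k → firstCase x<k)
           (cong₂ _+_ middleCase (∑-cong R λ x _ → lastCase {x = 0} {y = top (σ (k + suc x))}
             (λ y → weigh (pick n k y (σ (k + suc x)))) x)) ⟩
    top (σ (k + 0)) + ∑ R (λ e → weigh (picked σ e)) ∎
    where
    open ≡-Reasoning
    f : ℕ → ℕ
    f x = sumWeight (φ , n , k) x (σ x)

  ∈-choices⁻ : ∀ A {T} → T ∈ choices n A → T ∈ subs r (upTo n) × length T ≡ length A
  ∈-choices⁻ A T∈ = let (p , q) = ∈-keep⁻ (λ T → length T ≡ᵇ length A) (subs r (upTo n)) T∈ in p , ≡ᵇ-sound q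

  2^d<r : 2 ^ d < r
  2^d<r = s≤s (m≤n+m (2 ^ d) 2)

  unique-upTo : Unique (upTo n)
  unique-upTo = AllPairs.map <⇒≢ (sorted-upTo n)

  -- Passing to integers undoes the shift by `κ` in each row; the hypothesis guarantees that `κ ∸ m`
  -- is a true difference.
  weigh-sum : ∀ As → (∀ {A} → A ∈ As → proj₂ (möbius φ A) ≤ κ) →
              + sum (map weigh As) ≡ ∑ᶻ (map (λ A → + proj₁ (möbius φ A) -ᶻ + proj₂ (möbius φ A)) As) +ᶻ
                + (length As * κ)
  weigh-sum []       le = refl
  weigh-sum (A ∷ As) le = trans (pos-+ (weigh A) (sum (map weigh As)))
    (trans (cong₂ _+ᶻ_ one (weigh-sum As (le ∘ there)))
    (trans (lemma (+ p) (+ m) (+ κ) (∑ᶻ (map h As)) (+ (length As * κ)))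
      (cong (λ z → (+ p -ᶻ + m) +ᶻ ∑ᶻ (map h As) +ᶻ z) (sym (pos-+ κ (length As * κ))))))
    where
    p = proj₁ (möbius φ A)
    m = proj₂ (möbius φ A)
    h : List ℕ → ℤ
    h A = + proj₁ (möbius φ A) -ᶻ + proj₂ (möbius φ A)
    one : + (p + (κ ∸ m)) ≡ + p +ᶻ (+ κ -ᶻ + m)
    one = trans (pos-+ p (κ ∸ m)) (cong (+ p +ᶻ_) (sym (trans (m-n≡m⊖n κ m) (⊖-≥ (le (here refl))))))
    lemma : ∀ p m κ s l → p +ᶻ (κ -ᶻ m) +ᶻ (s +ᶻ l) ≡ (p -ᶻ m) +ᶻ s +ᶻ (κ +ᶻ l)
    lemma = solveᶻ-∀

  -- The inclusion says at once that `v` is increasing and below `n` on the indices, so that `v`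
  -- enumerates a set of `k` inputs, whose small sublists are the images of the rows.
  module Assignment (v : ℕ → ℕ) (L⊆ : map v (upTo k) ⊆ upTo n) where

    L : List ℕ
    L = map v (upTo k)

    rows-L : map (map v) (rows k) ≡ subs r L
    rows-L = sym (subs-map v r (upTo k))

    weights-sum : sum (map weigh (subs r L)) ≡ digest d φ L + R * κ
    weights-sum = +-injective (trans (weigh-sum (subs r L) m≤κ)
      (trans (cong₂ _+ᶻ_ (digest-inversion d r φ L w (unique-⊆ L⊆ unique-upTo) 2^d<r)
      (cong (λ z → + (z * κ)) (trans (cong length (sym rows-L)) (length-map (map v) (rows k)))))
        (sym (pos-+ (digest d φ L) (R * κ)))))
      where
      m≤κ : ∀ {A} → A ∈ subs r L → proj₂ (möbius φ A) ≤ κ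
      m≤κ A∈ = let (s , lt) = subs-⊆ r L A∈ in term≤sum (λ T → proj₂ (möbius φ T)) (⊆-subs r (⊆-trans s L⊆) lt)

    rows-sum : ∀ σ → (∀ e → e < R → picked σ e ≡ map v (row k e)) → ∑ R
      (λ e → weigh (picked σ e)) ≡ digest d φ L + R * κ
    rows-sum σ eq = trans (∑-cong R λ e e< → cong weigh (eq e e<)) (trans (∑-nth [] (rows k) (weigh ∘ map v))
      (trans (cong sum (trans (map-∘ (rows k)) (cong (map weigh) rows-L))) weights-sum))

  solvable⇒sat : Solvable I → FormulaSat d φ n k
  solvable⇒sat (σ , σ<N , sums) =
    let (α , eq) = positions-surjective n 0 L sorted (All.tabulate λ _ → z≤n)
          (All.tabulate λ x∈ → ∈-upTo⁻ (Sublist.lookup L⊆ x∈))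
    in α , trans (sym (length-positions 0 α)) (trans (cong length eq) (trans (length-map σ (upTo k)) (length-upTo k))) ,
       trans (cong (val d φ) eq) true-at-L
    where
    picked∈ : ∀ {e} → e < R → picked σ e ∈ choices n (row k e)
    picked∈ {e} e< = nth-∈ [] (choices n (row k e))
      (subst (σ (k + suc e) <_) (lastCase (λ e → length (choices n (row k e))) e)
        (σ<N (k + suc e) (+-monoʳ-< k (s≤s e<))))
    v<n : ∀ {i} → i < k → σ i < n
    v<n {i} i<k = subst (σ i <_) (firstCase i<k) (σ<N i (≤-trans i<k (m≤m+n k _)))
    consistent : ∀ {e} → e < R → picked σ e ≡ map σ (row k e)
    consistent {e} e< = nth-ext 0 (picked σ e) (map σ (row k e)) (trans len (sym (length-map σ (row k e)))) λ j j<T →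
      let j< = subst (j <_) len j<T
          (q , q< , eq) = ∈-nth (0 , 0 , 0) (∈-coords⁺ e< j<)
          i<k = row<k e< j<
          σi<n = v<n i<k
          total = trans (sym (cons-sum σ q< eq e< i<k))
            (trans (sums q (m≤n⇒m≤1+n q<)) (cong (λ b → if b then n else target φ n k) (<⇒<ᵇ≡ q<)))
      in trans (+-cancelˡ-≡ (n ∸ σ (nth 0 (row k e) j)) _ _ (trans total (sym (m∸n+n≡m (<⇒≤ σi<n)))))
        (sym (nth-map0 σ (row k e) j<))
      where
      len : length (picked σ e) ≡ length (row k e)
      len = proj₂ (∈-choices⁻ (row k e) (picked∈ e<))
    -- The pair of `i` and `j` is a row because `2 < r`. Its chosen option is a sublist of `upTo n`,
    -- hence increasing, and by consistency it consists of `σ i` and `σ j`.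
    increasing : ∀ {i j} → i < j → j < k → σ i < σ j
    increasing {i} {j} i<j j<k with ∈-nth [] (⊆-subs r (pair-⊆ i<j j<k) (s≤s (s≤s (s≤s z≤n))))
    ... | e , e< , eq = head< (subst (AllPairs _<_) (trans (consistent e<) (cong (map σ) eq))
            (sorted-⊆ (proj₁ (subs-⊆ r (upTo n) (proj₁ (∈-choices⁻ (row k e) (picked∈ e<))))) (sorted-upTo n)))
      where
      head< : ∀ {x y} → AllPairs _<_ (x ∷ y ∷ []) → x < y
      head< ((lt ∷ []) ∷ _) = lt
    L : List ℕ
    L = map σ (upTo k)
    sorted : AllPairs _<_ L
    sorted = subst (AllPairs _<_) (sym (map-upTo σ k)) (AllPairs.applyUpTo⁺₁ σ k increasing)
    L⊆ : L ⊆ upTo n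
    L⊆ = let (α , eq) = positions-surjective n 0 L sorted (All.tabulate λ _ → z≤n)
                          (subst (All (_< n)) (sym (map-upTo σ k)) (All.applyUpTo⁺₁ σ k v<n))
         in subst (_⊆ upTo n) eq (positions-⊆ 0 α (λ i → i) λ _ → refl)
    open Assignment σ L⊆ using (rows-sum)
    s D : ℕ
    s = σ (k + 0)
    D = digest d φ L
    s<β : s < β
    s<β = subst (s <_) middleCase (σ<N (k + 0) (+-monoʳ-< k (s≤s z≤n)))
    total : top s + (D + R * κ) ≡ R * κ + β
    total = trans (cong (λ z → top s + z) (sym (rows-sum σ λ e → consistent))) (trans (sym (digest-sum σ))
      (trans (sums Qc ≤-refl) (cong (λ b → if b then n else target φ n k) (≥⇒<ᵇ≡ (≤-refl {Qc})))))
    -- The last coordinate forces the chosen digest `s` to be the actual digest `D`, and the penalty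
    -- rules out digests that decode to false.
    true-at-L : val d φ L ≡ true
    true-at-L = go (nth false (table d φ) s) refl total
      where
      go : ∀ b → nth false (table d φ) s ≡ b → (if b then β ∸ s else suc (target φ n k)) +
        (D + R * κ) ≡ R * κ + β → val d φ L ≡ true
      go false _  tot = contradiction (≤-reflexive tot) (<⇒≱ (m≤m+n (suc (R * κ + β)) (D + R * κ)))
      go true  eq tot = trans (sym (proj₂ (decode d φ L))) (trans (cong (nth false (table d φ)) D≡s) eq)
        where
        lemma : ∀ a b c → a + (b + c) ≡ b + (a + c)
        lemma a b c = trans (sym (+-assoc a b c)) (trans (cong (_+ c) (+-comm a b)) (+-assoc b a c))
        D≡s : D ≡ s
        D≡s = +-cancelˡ-≡ (R * κ) D s (+-cancelˡ-≡ (β ∸ s) _ _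
          (trans (cong (λ z → β ∸ s + z) (+-comm (R * κ) D)) (trans tot
          (trans (cong (λ z → R * κ + z) (sym (m∸n+n≡m (<⇒≤ s<β)))) (lemma (R * κ) (β ∸ s) s)))))

  sat⇒solvable : FormulaSat d φ n k → Solvable I
  sat⇒solvable (α , |α| , sat) = σ , σ<N , sums
    where
    L : List ℕ
    L = positions 0 α
    v : ℕ → ℕ
    v = nth 0 L
    k≡ : length L ≡ k
    k≡ = trans (length-positions 0 α) |α|
    L≡ : map v (upTo k) ≡ L
    L≡ = trans (cong (map v ∘ upTo) (sym k≡)) (trans (map-upTo v (length L)) (all-nth L))
      where
      all-nth : ∀ L → applyUpTo (nth 0 L) (length L) ≡ L
      all-nth []      = refl
      all-nth (x ∷ L) = cong (x ∷_) (all-nth L)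
    L⊆ : map v (upTo k) ⊆ upTo n
    L⊆ = subst (_⊆ upTo n) (sym L≡) (positions-⊆ 0 α (λ i → i) λ _ → refl)
    open Assignment v L⊆ using (rows-sum)
    D : ℕ
    D = digest d φ L
    v<n : ∀ {i} → i < k → v i < n
    v<n i<k = ∈-upTo⁻ (Sublist.lookup L⊆ (∈-map⁺ v (∈-upTo⁺ i<k)))
    idx : Σ (ℕ → ℕ) λ g → ∀ e → e < R → g e < length (choices n (row k e)) × nth []
      (choices n (row k e)) (g e) ≡ map v (row k e)
    idx = choose {P = λ e s → s < length (choices n (row k e)) × nth [] (choices n (row k e)) s ≡ map v
      (row k e)} 0 R λ e e< →
      let (s , lt) = row-⊆ e< in ∈-nth [] (∈-keep⁺ (λ T → length T ≡ᵇ length (row k e))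
        (⊆-subs r (⊆-trans (map⁺ v s) L⊆) (subst (_< r) (sym (length-map v (row k e))) lt))
        (trans (cong (_≡ᵇ length (row k e)) (length-map v (row k e))) (≡ᵇ-refl (length (row k e)))))
    σ : ℕ → ℕ
    σ e = if e <ᵇ k then v e else if e ≡ᵇ k then D else proj₁ idx (e ∸ suc k)
    σ-first : ∀ {e} → e < k → σ e ≡ v e
    σ-first = firstCase
    σ-middle : σ (k + 0) ≡ D
    σ-middle = middleCase
    σ-last : ∀ e → σ (k + suc e) ≡ proj₁ idx e
    σ-last e = lastCase (proj₁ idx) e
    σ<N : ∀ e → e < E → σ e < N e
    σ<N e e<E with e <? k
    ... | yes e<k = subst₂ _<_ (sym (σ-first e<k)) (sym (firstCase e<k)) (v<n e<k)
    ... | no e≮k = subst (λ e → σ e < N e) (m+[n∸m]≡n (≮⇒≥ e≮k))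
      (beyond (e ∸ k) (+-cancelˡ-< k _ _ (subst (_< E) (sym (m+[n∸m]≡n (≮⇒≥ e≮k))) e<E)))
      where
      beyond : ∀ j → j < suc R → σ (k + j) < N (k + j)
      beyond zero    _        = subst₂ _<_ (sym σ-middle) (sym middleCase) (proj₁ (decode d φ L))
      beyond (suc j) (s≤s j<) = subst₂ _<_ (sym (σ-last j))
        (sym (lastCase (λ e → length (choices n (row k e))) j)) (proj₁ (proj₂ idx j j<))
    picked≡ : ∀ e → e < R → picked σ e ≡ map v (row k e)
    picked≡ e e< = trans (cong (pick n k e) (σ-last e)) (proj₂ (proj₂ idx e e<))
    sums : ∀ q → q < Q → ∑ E (λ e → a e (σ e) q) ≡ τ q
    sums q q<Q with q <? Qc
    ... | yes q< = trans (cons-sum σ q< refl e< i<k) (trans (cong₂ _+_ (cong (n ∸_) (σ-first i<k)) at-j)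
                     (trans (m∸n+n≡m (<⇒≤ (v<n i<k))) (sym (cong (λ b → if b then n else target φ n k) (<⇒<ᵇ≡ q<)))))
      where
      c = nth (0 , 0 , 0) (coords k) q
      e = proj₁ c
      j = proj₁ (proj₂ c)
      i = proj₂ (proj₂ c)
      facts = ∈-coords⁻ (nth-∈ (0 , 0 , 0) (coords k) q<)
      e< : e < R
      e< = proj₁ facts
      i<k : i < k
      i<k = subst (_< k) (sym (proj₂ (proj₂ facts))) (row<k e< (proj₁ (proj₂ facts)))
      at-j : nth 0 (picked σ e) j ≡ v i
      at-j = trans (cong (λ T → nth 0 T j) (picked≡ e e<))
        (trans (nth-map0 v (row k e) (proj₁ (proj₂ facts))) (cong v (sym (proj₂ (proj₂ facts)))))
    ... | no q≮ with refl ← ≤-antisym (≤-pred q<Q) (≮⇒≥ q≮) =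
      trans (digest-sum σ) (trans (cong₂ _+_ (cong top σ-middle)
        (trans (rows-sum σ picked≡) (cong (λ L → digest d φ L + R * κ) L≡)))
        (trans at-top (sym (cong (λ b → if b then n else target φ n k) (≥⇒<ᵇ≡ (≤-refl {Qc}))))))
      where
      at-top : top D + (D + R * κ) ≡ R * κ + β
      at-top = trans (cong (λ b → (if b then β ∸ D else suc (target φ n k)) + (D + R * κ))
        (trans (proj₂ (decode d φ L)) sat))
        (trans (sym (+-assoc (β ∸ D) D (R * κ)))
          (trans (cong (_+ R * κ) (m∸n+n≡m (<⇒≤ (proj₁ (decode d φ L))))) (+-comm β (R * κ))))

  solvable⇔sat : Solvable I ⇔ FormulaSat d φ n k
  solvable⇔sat = mk⇔ solvable⇒sat sat⇒solvable

-- Assembling the reduction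

guarded-≤ : ∀ b {o : List Bool × ℕ} {m} → proj₂ o ≤ m → proj₂ (if b then o else ([] , 0)) ≤ m
guarded-≤ true  le = le
guarded-≤ false le = z≤n

guarded-⇔ : ∀ b {P : Set} {o : List Bool × ℕ} → (b ≡ true → P ⇔ RestrictedUnaryBinPacking (proj₁ o) (proj₂ o)) →
            let o′ = if b then o else ([] , 0) in (b ≡ true × P) ⇔ RestrictedUnaryBinPacking (proj₁ o′) (proj₂ o′)
guarded-⇔ true  h = mk⇔ (to (h refl) ∘ proj₂) (λ p → refl , from (h refl) p)
guarded-⇔ false h = mk⇔ (λ ()) (λ ())

module Final (d : ℕ) where
  open Reduction d

  packing-correct : ∀ φ n k → weft₁ d φ ≡ true → FormulaSat d φ n k ⇔ RestrictedUnaryBinPacking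
    (proj₁ (Grid.output (inst (φ , n , k)))) (proj₂ (Grid.output (inst (φ , n , k))))
  packing-correct φ n k w = mk⇔ (to S⇔P ∘ from S⇔F) (to S⇔F ∘ from S⇔P)
    where
    S⇔F = Correct.solvable⇔sat d φ n k w
    S⇔P = GridPacking.solvable⇔packing (inst (φ , n , k))
      (≤-trans (s≤s z≤n) (m≤n+m (suc (length (rows k))) k)) (s≤s z≤n)

  env : List Bool → ℕ → El Env
  env x k = let (n , gs , o) = parse x in unroll d gs o , n , k

  output-param : ∀ γ → proj₂ (Grid.output (inst γ)) ≤ numBins (proj₂ (proj₂ γ))
  output-param γ = guarded-≤ (Grid.consistent (inst γ))
    {concat (map (encItem (Grid.bins (inst γ))) (Grid.items (inst γ))) , Grid.bins (inst γ)} ≤-refl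

  transform-param : ∀ x k → proj₂ (transform d (x , k)) ≤ numBins k
  transform-param x k = guarded-≤ (valid d (x , parse x)) (output-param (env x k))

  transform-correct : ∀ x k → WeightedCircuitSat 1 d x k ⇔
                      RestrictedUnaryBinPacking (proj₁ (transform d (x , k))) (proj₂ (transform d (x , k)))
  transform-correct x k = ⇔-trans (circuit⇔formula d x k) (guarded-⇔ (valid d (x , parse x)) λ v →
    packing-correct (unroll d (proj₁ (proj₂ (parse x))) (proj₂ (proj₂ (parse x)))) (proj₁ (parse x)) k
      (valid⇒weft₁ (parse x) v))
    where
    valid⇒weft₁ : ∀ R → let (n , gs , o) = R in valid d (x , R) ≡ true → weft₁ d (unroll d gs o) ≡ true
    valid⇒weft₁ (n , gs , o) v =
      let (_ , v) = ∧-true {eqBits x (encRaw (n , gs , o))} v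
          (_ , v) = ∧-true {scoped n gs} v
          (_ , v) = ∧-true {o <ᵇ length gs + n} v
      in proj₂ (∧-true {depthOK d gs o} v)

theorem3 : (W[ 1 ] -Hard) RestrictedUnaryBinPacking
theorem3 A (d , R) = ≤fpt-∘-PT R (transformP d) numBinsP transform-param transform-correct
  where
  open Final d
  open Reduction d
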